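{- Let $H\cong\mathbb{Z}_{2p^e}$, where $p$ is an odd prime and $e\ge1$, let $H_0$ be the unique subgroup of $H$ of order $p^e$, and let $b$ be the unique involution of $H$. A connected non-bipartite graph $\mathrm{Cay}(H,S)$ is unstable if and only if (1) $e>1$ and $(S\cap H_0)h=S\cap H_0$ for some $h\in H_0$ with $h\ne 1_H$; or (2) $\mathrm{Cay}(H,S)\cong\mathrm{Cay}(H,Sb)$, where $Sb=\{sb:s\in S\}$.
   Context: For a group $H$ and $S\subseteq H$ with $1_H\notin S$ and $S=S^{ -1}$, the Cayley graph $\mathrm{Cay}(H,S)$ has vertex set $H$ and edges $\{x,sx\}$ for $x\in H$, $s\in S$. For a graph $\Gamma$, $\Gamma\times K_2$ has vertex set $V(\Gamma)\times\{0,1\}$ and edges $\{(u,0),(v,1)\}$ for $\{u,v\}\in E(\Gamma)$. $\Gamma$ is stable if $\mathrm{Aut}(\Gamma\times K_2)\cong\mathrm{Aut}(\Gamma)\times\mathbb{Z}_2$, and unstable otherwise. -}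

module Defs where

open import Data.Nat using (ℕ; zero; suc; _*_; _^_; _>_; _≥_)
open import Data.Nat.DivMod using (_mod_)
open import Data.Nat.Divisibility using (_∣_)
open import Data.Nat.Primality using (Prime)
open import Data.Fin using (Fin; toℕ)
open import Data.Fin.Subset using (Subset; _∈_; _∉_)
open import Data.Bool using (Bool; true; false; _xor_)
open import Data.Product using (Σ; _×_; _,_; proj₁; proj₂)
open import Data.Sum using (_⊎_)
open import Data.Empty using (⊥)
open import Relation.Nullary using (¬_)
open import Relation.Binary.PropositionalEquality using (_≡_; _≢_; refl; sym; trans; cong)
open import Function using (_∘_)
open import Function.Bundles using (_⇔_)

record Graph : Set₁ where
  field
    V : Set
    E : V → V → Set
open Graph public

data Walk (Γ : Graph) : V Γ → V Γ → Set where
  here : ∀ {x} → Walk Γ x x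
  step : ∀ {x y z} → E Γ x y → Walk Γ y z → Walk Γ x z

Connected : Graph → Set
Connected Γ = ∀ x y → Walk Γ x y

Bipartite : Graph → Set
Bipartite Γ = Σ (V Γ → Bool) λ c → ∀ x y → E Γ x y → c x ≢ c y

NonBipartite : Graph → Set
NonBipartite Γ = ¬ Bipartite Γ

_×K₂ : Graph → Graph
Γ ×K₂ = record
  { V = V Γ × Bool
  ; E = λ a c → E Γ (proj₁ a) (proj₁ c) × (proj₂ a ≢ proj₂ c) }

record Iso (Γ Δ : Graph) : Set where
  field
    to      : V Γ → V Δ
    from    : V Δ → V Γ
    from-to : ∀ x → from (to x) ≡ x
    to-from : ∀ y → to (from y) ≡ y
    pres    : ∀ x y → E Γ x y → E Δ (to x) (to y)
    refl'   : ∀ x y → E Δ (to x) (to y) → E Γ x y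
open Iso public

Aut : Graph → Set
Aut Γ = Iso Γ Γ

_≈A_ : ∀ {Γ} → Aut Γ → Aut Γ → Set
_≈A_ {Γ} f g = ∀ x → to f x ≡ to g x

_∘A_ : ∀ {Γ} → Aut Γ → Aut Γ → Aut Γ
_∘A_ {Γ} f g = record
  { to = to f ∘ to g
  ; from = from g ∘ from f
  ; from-to = λ x → trans (cong (from g) (from-to f (to g x))) (from-to g x)
  ; to-from = λ y → trans (cong (to f) (to-from g (from f y))) (to-from f y)
  ; pres = λ x y e → pres f _ _ (pres g x y e)
  ; refl' = λ x y e → refl' g x y (refl' f _ _ e)
  }

AutZ₂ : Graph → Set
AutZ₂ Γ = Aut Γ × Bool

_≈P_ : ∀ {Γ} → AutZ₂ Γ → AutZ₂ Γ → Set
_≈P_ {Γ} a c = (_≈A_ {Γ} (proj₁ a) (proj₁ c)) × (proj₂ a ≡ proj₂ c)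

_∙P_ : ∀ {Γ} → AutZ₂ Γ → AutZ₂ Γ → AutZ₂ Γ
_∙P_ {Γ} a c = (_∘A_ {Γ} (proj₁ a) (proj₁ c)) , (proj₂ a xor proj₂ c)

record AutIso (Γ : Graph) : Set where
  field
    φ     : Aut (Γ ×K₂) → AutZ₂ Γ
    φ-cong : ∀ f g → _≈A_ {Γ ×K₂} f g → _≈P_ {Γ} (φ f) (φ g)
    hom   : ∀ f g → _≈P_ {Γ} (φ (_∘A_ {Γ ×K₂} f g)) (_∙P_ {Γ} (φ f) (φ g))
    inj   : ∀ f g → _≈P_ {Γ} (φ f) (φ g) → _≈A_ {Γ ×K₂} f g
    surj  : ∀ y → Σ (Aut (Γ ×K₂)) λ f → _≈P_ {Γ} (φ f) y

Stable : Graph → Set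
Stable Γ = AutIso Γ

Unstable : Graph → Set
Unstable Γ = ¬ Stable Γ

-- The cyclic group ℤ_n on Fin n (additive notation: the paper's product xy is x ⊕ y)

_⊕_ : ∀ {n} → Fin n → Fin n → Fin n
_⊕_ {suc k} x y = (toℕ x Data.Nat.+ toℕ y) mod (suc k)

IsIdentity : ∀ {n} → Fin n → Set
IsIdentity x = toℕ x ≡ 0

Cay : (n : ℕ) → (Fin n → Set) → Graph
Cay n S = record { V = Fin n ; E = λ x y → Σ (Fin n) λ s → S s × (y ≡ s ⊕ x) }

⟦_⟧ : ∀ {n} → Subset n → Fin n → Set
⟦ S ⟧ x = x ∈ S

_·_ : ∀ {n} → Subset n → Fin n → Fin n → Set
(S · b) y = Σ _ λ s → s ∈ S × (y ≡ s ⊕ b)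

-- H₀ for H = ℤ_{2p^e}: the unique subgroup of order p^e, i.e. the even residues
InH₀ : ∀ {n} → Fin n → Set
InH₀ x = 2 ∣ toℕ x

InSH₀ : ∀ {n} → Subset n → Fin n → Set
InSH₀ S x = x ∈ S × InH₀ x

IdNotIn : ∀ {n} → Subset n → Set
IdNotIn S = ∀ x → IsIdentity x → x ∉ S

InverseClosed : ∀ {n} → Subset n → Set
InverseClosed {n} S = ∀ s → s ∈ S → Σ (Fin n) λ t → t ∈ S × IsIdentity (s ⊕ t)

Involution : ∀ {n} → Fin n → Set
Involution b = ¬ IsIdentity b × IsIdentity (b ⊕ b)

Cond1 : (n e : ℕ) → Subset n → Set
Cond1 n e S = e > 1 × Σ (Fin n) λ h → InH₀ h × ¬ IsIdentity h ×
  (∀ y → (Σ (Fin n) λ s → InSH₀ S s × (y ≡ s ⊕ h)) ⇔ InSH₀ S y)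

Cond2 : (n : ℕ) → Subset n → Fin n → Set
Cond2 n S b = Iso (Cay n ⟦ S ⟧) (Cay n (S · b))

{-# OPTIONS --safe #-}

-- Put m = p^e and H = H₀ × ⟨b⟩. The graph Γ × K₂ is the Cayley graph of G = H × ⟨u⟩ with
-- connection set S + u. Write z ≈ w if an automorphism followed by a translation fixes 0 and
-- maps z to w; then Γ is stable iff the orbit of u is {u}. As in Schur's theory, counting
-- walks of prime length q modulo q shows that ≈ is preserved by the multipliers prime to 2p,
-- and walks of length two modulo 2 show that elements x ∈ H₀ with x ≉ x + b have orbits in H₀.
-- Since the units congruent to 1 modulo p act on the cosets of the subgroups J i of the cyclic
-- p-group H₀, an orbit meets such a coset in a coset of some J r. If S₀ = S ∩ H₀ is not a union
-- of cosets of J 1, these facts force the orbit of u into {u, u + b}. If it is all of {u, u + b},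
-- every automorphism has a sign at every vertex; signs are constant on the cosets of larger and
-- larger J i, until S is J i-periodic outside J i, and then an automorphism with sign b on J i,
-- copied to all the cosets of J i, is an isomorphism from Cay(H, S) to Cay(H, S b).
-- Conversely, a period of S₀ or such an isomorphism gives an automorphism of Γ × K₂ outside
-- Aut Γ × ℤ₂; by finiteness the two groups are then not even abstractly isomorphic.

module Submission where

-- The obstacle is the prime 2. Multipliers prime to 2p fix the bits of b and of the layer, so they
-- never compare x with x + b, and doubling, which forgets both bits, is no multiplier at all.
-- Counting modulo 2 turns this loss into information: it sees exactly the points over which a set
-- distinguishes x from x + b.
--
-- The bound on the orbit of u rests on two opposite mechanisms. Take s in S₀ and t of order p with
-- s + t outside S₀. If the orbit of s stays in H₀, the parity argument makes S₀ visible inside one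
-- layer, and an offset of u becomes a period of S₀. Otherwise s + u and s + b + u share an orbit;
-- then s is rigid against the group spanned by the orbit of u, and comparing two edges with the
-- same displacement s + u forces the offset to change sign.
--
-- An automorphism sending u to u + b is known to be twisted only at 0, while an isomorphism from
-- Cay(H, S) to Cay(H, S b) must be twisted at every vertex. Hence the climb through the J i: it
-- ends where edges between different cosets no longer see positions within them, so that the map
-- may be chosen on each coset independently.

open import Algebra.Bundles using (AbelianGroup; Semiring)
open import Algebra.Structures using (IsAbelianGroup)
open import Data.Bool using (Bool; true; false; _xor_; _∧_; not)
open import Data.Empty using (⊥; ⊥-elim)
open import Data.Fin as Fin using (Fin; zero; suc; toℕ)
open import Data.Nat as ℕ using (ℕ; zero; suc; _≤_; _<_; s≤s; z≤n)
open import Data.Nat.Primality using (Prime; euclidsLemma; prime⇒nonTrivial; prime⇒nonZero; prime⇒irreducible; ¬prime[0])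
open import Data.Product using (Σ; ∃; ∃₂; _×_; _,_; proj₁; proj₂)
open import Data.Sum using (_⊎_; inj₁; inj₂)
open import Data.Unit using (⊤; tt)
open import Function using (_∘_)
open import Function.Bundles using (_↔_; Inverse; _⇔_; mk⇔)
open import Relation.Nullary using (Dec; yes; no; ¬_; does)

-- A solver for identities in abelian groups, by integer coefficients.

module GroupSolver {c ℓ} (A : AbelianGroup c ℓ) where
  open import Data.Integer as ℤ using (ℤ; +_; -[1+_]; 0ℤ; 1ℤ; _⊖_)
  open import Data.Integer.Properties using ([1+m]⊖[1+n]≡m⊖n)
  open import Data.Vec using (Vec; []; _∷_; lookup; replicate; zipWith; map)
  import Relation.Binary.PropositionalEquality as ≡
  open AbelianGroup A
  open import Algebra.Properties.AbelianGroup A using (⁻¹-∙-comm; ε⁻¹≈ε; ⁻¹-involutive)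
  open import Algebra.Properties.CommutativeSemigroup commutativeSemigroup using (interchange)
  open import Algebra.Properties.Monoid.Mult monoid renaming (_×_ to _⋆_)
  open import Relation.Binary.Reasoning.Setoid setoid

  infixl 6 _:+_ _:-_
  infix 8 :-_

  data Expr (n : ℕ) : Set where
    var  : Fin n → Expr n
    :0   : Expr n
    _:+_ : Expr n → Expr n → Expr n
    :-_  : Expr n → Expr n

  _:-_ : ∀ {n} → Expr n → Expr n → Expr n
  x :- y = x :+ (:- y)

  ⟦_⟧ : ∀ {n} → Expr n → Vec Carrier n → Carrier
  ⟦ var i ⟧ ρ = lookup ρ i
  ⟦ :0 ⟧ ρ = ε
  ⟦ x :+ y ⟧ ρ = ⟦ x ⟧ ρ ∙ ⟦ y ⟧ ρ
  ⟦ :- x ⟧ ρ = ⟦ x ⟧ ρ ⁻¹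

  unit : ∀ {n} → Fin n → Vec ℤ n
  unit zero = 1ℤ ∷ replicate _ 0ℤ
  unit (suc i) = 0ℤ ∷ unit i

  coefficients : ∀ {n} → Expr n → Vec ℤ n
  coefficients (var i) = unit i
  coefficients :0 = replicate _ 0ℤ
  coefficients (x :+ y) = zipWith ℤ._+_ (coefficients x) (coefficients y)
  coefficients (:- x) = map ℤ.-_ (coefficients x)

  _⊠_ : ℤ → Carrier → Carrier
  (+ n) ⊠ x = n ⋆ x
  -[1+ n ] ⊠ x = (suc n ⋆ x) ⁻¹

  combination : ∀ {n} → Vec ℤ n → Vec Carrier n → Carrier
  combination [] [] = ε
  combination (a ∷ as) (x ∷ ρ) = a ⊠ x ∙ combination as ρ

  ⟦_⇓⟧ : ∀ {n} → Expr n → Vec Carrier n → Carrier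
  ⟦ e ⇓⟧ = combination (coefficients e)

  ⊖-⊠ : ∀ m n x → (m ⊖ n) ⊠ x ≈ m ⋆ x ∙ (n ⋆ x) ⁻¹
  ⊖-⊠ m zero x = sym (trans (∙-congˡ ε⁻¹≈ε) (identityʳ _))
  ⊖-⊠ zero (suc n) x = sym (identityˡ _)
  ⊖-⊠ (suc m) (suc n) x = begin
    (suc m ⊖ suc n) ⊠ x ≡⟨ ≡.cong (_⊠ x) ([1+m]⊖[1+n]≡m⊖n m n) ⟩
    (m ⊖ n) ⊠ x ≈⟨ ⊖-⊠ m n x ⟩
    m ⋆ x ∙ (n ⋆ x) ⁻¹ ≈⟨ identityˡ _ ⟨
    ε ∙ (m ⋆ x ∙ (n ⋆ x) ⁻¹) ≈⟨ ∙-congʳ (inverseʳ x) ⟨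
    x ∙ x ⁻¹ ∙ (m ⋆ x ∙ (n ⋆ x) ⁻¹) ≈⟨ interchange _ _ _ _ ⟩
    x ∙ m ⋆ x ∙ (x ⁻¹ ∙ (n ⋆ x) ⁻¹) ≈⟨ ∙-congˡ (⁻¹-∙-comm x (n ⋆ x)) ⟩
    x ∙ m ⋆ x ∙ (x ∙ n ⋆ x) ⁻¹ ∎

  +-⊠ : ∀ a b x → (a ℤ.+ b) ⊠ x ≈ a ⊠ x ∙ b ⊠ x
  +-⊠ (+ m) (+ n) x = ×-homo-+ x m n
  +-⊠ (+ m) -[1+ n ] x = ⊖-⊠ m (suc n) x
  +-⊠ -[1+ m ] (+ n) x = trans (⊖-⊠ n (suc m) x) (comm _ _)
  +-⊠ -[1+ m ] -[1+ n ] x = begin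
    (suc (suc (m ℕ.+ n)) ⋆ x) ⁻¹ ≡⟨ ≡.cong (λ k → (k ⋆ x) ⁻¹) (≡.cong suc (+-suc m n)) ⟨
    ((suc m ℕ.+ suc n) ⋆ x) ⁻¹ ≈⟨ ⁻¹-cong (×-homo-+ x (suc m) (suc n)) ⟩
    (suc m ⋆ x ∙ suc n ⋆ x) ⁻¹ ≈⟨ ⁻¹-∙-comm _ _ ⟨
    (suc m ⋆ x) ⁻¹ ∙ (suc n ⋆ x) ⁻¹ ∎
    where open import Data.Nat.Properties using (+-suc)

  neg-⊠ : ∀ a x → (ℤ.- a) ⊠ x ≈ (a ⊠ x) ⁻¹
  neg-⊠ (+ zero) x = sym ε⁻¹≈ε
  neg-⊠ (+ suc n) x = refl
  neg-⊠ -[1+ n ] x = sym (⁻¹-involutive _)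

  combination-0 : ∀ {n} (ρ : Vec Carrier n) → combination (replicate n 0ℤ) ρ ≈ ε
  combination-0 [] = refl
  combination-0 (x ∷ ρ) = trans (identityˡ _) (combination-0 ρ)

  combination-unit : ∀ {n} (i : Fin n) ρ → combination (unit i) ρ ≈ lookup ρ i
  combination-unit zero (x ∷ ρ) = trans (∙-cong (identityʳ x) (combination-0 ρ)) (identityʳ x)
  combination-unit (suc i) (x ∷ ρ) = trans (identityˡ _) (combination-unit i ρ)

  combination-+ : ∀ {n} (as bs : Vec ℤ n) ρ →
    combination (zipWith ℤ._+_ as bs) ρ ≈ combination as ρ ∙ combination bs ρ
  combination-+ [] [] [] = sym (identityˡ ε)
  combination-+ (a ∷ as) (b ∷ bs) (x ∷ ρ) =
    trans (∙-cong (+-⊠ a b x) (combination-+ as bs ρ)) (interchange _ _ _ _)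

  combination-neg : ∀ {n} (as : Vec ℤ n) ρ → combination (map ℤ.-_ as) ρ ≈ combination as ρ ⁻¹
  combination-neg [] [] = sym ε⁻¹≈ε
  combination-neg (a ∷ as) (x ∷ ρ) =
    trans (∙-cong (neg-⊠ a x) (combination-neg as ρ)) (⁻¹-∙-comm _ _)

  correct : ∀ {n} (e : Expr n) ρ → ⟦ e ⇓⟧ ρ ≈ ⟦ e ⟧ ρ
  correct (var i) ρ = combination-unit i ρ
  correct :0 ρ = combination-0 ρ
  correct (x :+ y) ρ = trans (combination-+ (coefficients x) _ ρ) (∙-cong (correct x ρ) (correct y ρ))
  correct (:- x) ρ = trans (combination-neg (coefficients x) ρ) (⁻¹-cong (correct x ρ))

  open import Relation.Binary.Reflection setoid var ⟦_⟧ ⟦_⇓⟧ correct public using (solve; _⊜_)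

-- The Frobenius congruence in semirings.

module BinomialDivisibility where
  open import Data.Nat
  open import Data.Nat.Properties
  open import Data.Nat.Divisibility
  open import Data.Nat.DivMod using (m/n*n≡m)
  open import Data.Nat.Combinatorics using (_C_; nCk≡n!/k![n-k]!; k![n∸k]!∣n!)
  open import Relation.Binary.PropositionalEquality

  prime∤! : ∀ {q} → Prime q → ∀ k → k < q → q ∣ k ! → ⊥
  prime∤! pr zero k<q q∣1 = <-irrefl (sym (∣1⇒≡1 q∣1)) (nonTrivial⇒n>1 _ {{prime⇒nonTrivial pr}})
  prime∤! pr (suc k) k<q q∣ with euclidsLemma (suc k) (k !) pr q∣
  ... | inj₁ q∣k = <⇒≱ k<q (∣⇒≤ q∣k)
  ... | inj₂ q∣k! = prime∤! pr k (<-trans (n<1+n k) k<q) q∣k!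

  -- `q` divides q! = C(q, k) k! (q - k)!, and neither factorial has a prime factor as large as `q`.
  prime∣C : ∀ {q} → Prime q → ∀ k → 0 < k → k < q → q ∣ q C k
  prime∣C {q@(suc q-1)} pr k 0<k k<q with euclidsLemma (q C k) (k ! * (q ∸ k) !) pr q∣product
    where
    k≤q = <⇒≤ k<q
    C*k![q-k]!≡q! : (q C k) * (k ! * (q ∸ k) !) ≡ q !
    C*k![q-k]!≡q! = trans (cong (_* (k ! * (q ∸ k) !)) (nCk≡n!/k![n-k]! k≤q))
                          (m/n*n≡m {{k !* (q ∸ k) !≢0}} (k![n∸k]!∣n! k≤q))
    q∣product : q ∣ (q C k) * (k ! * (q ∸ k) !)
    q∣product = subst (q ∣_) (sym C*k![q-k]!≡q!) (m∣m*n (q-1 !))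
  ... | inj₁ q∣C = q∣C
  ... | inj₂ q∣rest with euclidsLemma (k !) ((q ∸ k) !) pr q∣rest
  ...   | inj₁ q∣k! = ⊥-elim (prime∤! pr k k<q q∣k!)
  ...   | inj₂ q∣[q-k]! = ⊥-elim (prime∤! pr (q ∸ k) (∸-monoʳ-< 0<k (<⇒≤ k<q)) q∣[q-k]!)

module Frobenius {a ℓ} (R : Semiring a ℓ) where
  open Semiring R
  open import Data.Nat using (_∸_)
  open import Data.Fin using (fromℕ; inject₁)
  open import Data.Fin.Properties using (toℕ<n; toℕ-inject₁; toℕ-fromℕ)
  open import Data.Nat.Combinatorics using (_C_; nCn≡1)
  open import Data.Nat.Divisibility using (divides)
  open import Data.Nat.Properties using (n∸n≡0; *-comm)
  import Relation.Binary.PropositionalEquality as ≡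
  open import Algebra.Properties.Semiring.Sum R
  open import Algebra.Properties.Semiring.Mult R renaming (_×_ to _⋆_)
  open import Algebra.Properties.CommutativeMonoid.Mult +-commutativeMonoid using (×-distrib-+)
  open import Algebra.Properties.Semiring.Exp R
  open import Algebra.Properties.Semiring.Binomial R using (binomialTerm; theorem)
  open import Relation.Binary.Reasoning.Setoid setoid

  ×-zero : ∀ n → n ⋆ 0# ≈ 0#
  ×-zero zero = refl
  ×-zero (suc n) = trans (+-identityˡ _) (×-zero n)

  sum-multiple : ∀ q {n} (t : Fin n → Carrier) →
    (∀ k → ∃ λ c → t k ≈ q ⋆ c) → ∃ λ c → sum t ≈ q ⋆ c
  sum-multiple q {zero} t h = 0# , sym (×-zero q)
  sum-multiple q {suc n} t h with h Fin.zero | sum-multiple q (λ k → t (Fin.suc k)) (λ k → h (Fin.suc k))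
  ... | c , t₀≈ | d , ts≈ = c + d , trans (+-cong t₀≈ ts≈) (sym (×-distrib-+ c d q))

  -- The inner binomial terms are multiples of `q`. A semiring has no subtraction, so the congruence
  -- becomes an equation with an explicit surplus `q ⋆ c`, which falls on the side of the separate
  -- powers.
  frobenius-+ : ∀ {q} → Prime q → ∀ x y → x * y ≈ y * x →
    ∃ λ c → (x + y) ^ q ≈ x ^ q + y ^ q + q ⋆ c
  frobenius-+ {zero} pr = ⊥-elim (¬prime[0] pr)
  frobenius-+ {q@(suc r)} pr x y xy≈yx = proj₁ middle , (begin
    (x + y) ^ q ≈⟨ theorem x y xy≈yx q ⟩
    term Fin.zero + sum (λ k → term (Fin.suc k)) ≈⟨ +-congˡ (sum-init-last (λ k → term (Fin.suc k))) ⟩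
    term Fin.zero + (sum (λ k → term (Fin.suc (inject₁ k))) + term (Fin.suc (fromℕ r)))
                                                      ≈⟨ +-cong first (+-cong (proj₂ middle) final) ⟩
    y ^ q + (q ⋆ proj₁ middle + x ^ q) ≈⟨ +-congˡ (+-comm _ _) ⟩
    y ^ q + (x ^ q + q ⋆ proj₁ middle) ≈⟨ +-assoc _ _ _ ⟨
    y ^ q + x ^ q + q ⋆ proj₁ middle ≈⟨ +-congʳ (+-comm _ _) ⟩
    x ^ q + y ^ q + q ⋆ proj₁ middle ∎)
    where
    term = binomialTerm x y q
    first : term Fin.zero ≈ y ^ q
    first = trans (+-identityʳ _) (*-identityˡ _)
    final : term (Fin.suc (fromℕ r)) ≈ x ^ q
    final = at (suc (toℕ (fromℕ r))) (≡.cong suc (toℕ-fromℕ r))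
      where
      at : ∀ j → j ≡.≡ q → (q C j) ⋆ (x ^ j * y ^ (q ∸ j)) ≈ x ^ q
      at .q ≡.refl = begin
        (q C q) ⋆ (x ^ q * y ^ (q ∸ q)) ≡⟨ ≡.cong₂ (λ m n → m ⋆ (x ^ q * y ^ n)) (nCn≡1 q) (n∸n≡0 q) ⟩
        1 ⋆ (x ^ q * y ^ 0) ≈⟨ +-identityʳ _ ⟩
        x ^ q * 1# ≈⟨ *-identityʳ _ ⟩
        x ^ q ∎
    middle : ∃ λ c → sum (λ k → term (Fin.suc (inject₁ k))) ≈ q ⋆ c
    middle = sum-multiple q _ multiple
      where
      multiple : ∀ k → ∃ λ c → term (Fin.suc (inject₁ k)) ≈ q ⋆ c
      multiple k with BinomialDivisibility.prime∣C pr (suc (toℕ (inject₁ k))) (s≤s z≤n)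
                        (s≤s (≡.subst (_< r) (≡.sym (toℕ-inject₁ k)) (toℕ<n k)))
      ... | divides d C≡d*q = d ⋆ power , (begin
          (q C suc (toℕ (inject₁ k))) ⋆ power ≡⟨ ≡.cong (_⋆ power) (≡.trans C≡d*q (*-comm d q)) ⟩
          (q ℕ.* d) ⋆ power ≈⟨ ×-assocˡ power q d ⟨
          q ⋆ (d ⋆ power) ∎)
        where power = x ^ suc (toℕ (inject₁ k)) * y ^ (r ∸ toℕ (inject₁ k))

  *-sum-comm : ∀ {n} x (t : Fin n → Carrier) → (∀ k → x * t k ≈ t k * x) → x * sum t ≈ sum t * x
  *-sum-comm x t h = begin
    x * sum t ≈⟨ *-distribˡ-sum x t ⟩
    sum (λ k → x * t k) ≈⟨ sum-cong-≋ h ⟩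
    sum (λ k → t k * x) ≈⟨ *-distribʳ-sum x t ⟨
    sum t * x ∎

  frobenius-sum : ∀ {q} → Prime q → ∀ {n} (t : Fin n → Carrier) → (∀ i j → t i * t j ≈ t j * t i) →
    ∃ λ c → sum t ^ q ≈ sum (λ i → t i ^ q) + q ⋆ c
  frobenius-sum {zero} pr {zero} t h = ⊥-elim (¬prime[0] pr)
  frobenius-sum {q@(suc _)} pr {zero} t h = 0# , trans (zeroˡ _) (sym (trans (+-identityˡ _) (×-zero q)))
  frobenius-sum {q} pr {suc n} t h
    with frobenius-+ pr (t Fin.zero) (sum (λ k → t (Fin.suc k))) (*-sum-comm _ _ λ k → h Fin.zero (Fin.suc k))
       | frobenius-sum pr (λ k → t (Fin.suc k)) (λ i j → h (Fin.suc i) (Fin.suc j))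
  ... | c , head≈ | d , tail≈ = d + c , (begin
    sum t ^ q ≈⟨ head≈ ⟩
    t Fin.zero ^ q + sum (λ k → t (Fin.suc k)) ^ q + q ⋆ c ≈⟨ +-congʳ (+-congˡ tail≈) ⟩
    t Fin.zero ^ q + (sum (λ k → t (Fin.suc k) ^ q) + q ⋆ d) + q ⋆ c
                                                                ≈⟨ +-congʳ (+-assoc _ _ _) ⟨
    sum (λ k → t k ^ q) + q ⋆ d + q ⋆ c ≈⟨ +-assoc _ _ _ ⟩
    sum (λ k → t k ^ q) + (q ⋆ d + q ⋆ c) ≈⟨ +-congˡ (×-distrib-+ d c q) ⟨
    sum (λ k → t k ^ q) + q ⋆ (d + c) ∎)

open import Relation.Binary.PropositionalEquality hiding (J)

-- Search over finite types.

module Finite {A : Set} {N} (enum : Fin N ↔ A) where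
  open import Data.Nat using (_^_)
  open import Data.Fin using (finToFun; funToFin)
  open import Data.Fin.Properties as Finₚ using (any?; all?; finToFun-funToFin)
  open import Relation.Nullary.Decidable using (map′)
  open import Relation.Unary using (Decidable)
  open import Relation.Binary.Definitions using (DecidableEquality)

  open Inverse enum public using (to; from)

  to-from : ∀ x → to (from x) ≡ x
  to-from x = Inverse.inverseˡ enum refl

  from-to : ∀ i → from (to i) ≡ i
  from-to i = Inverse.inverseʳ enum refl

  infix 4 _≟_
  _≟_ : DecidableEquality A
  x ≟ y = map′ (λ e → trans (sym (to-from x)) (trans (cong to e) (to-from y))) (cong from) (from x Finₚ.≟ from y)

  ∃? : ∀ {P : A → Set} → Decidable P → Dec (∃ P)
  ∃? {P} P? = map′ (λ (i , p) → to i , p) (λ (x , p) → from x , subst P (sym (to-from x)) p) (any? (P? ∘ to))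

  ∀? : ∀ {P : A → Set} → Decidable P → Dec (∀ x → P x)
  ∀? {P} P? = map′ (λ h x → subst P (to-from x) (h (from x))) (λ h i → h (to i)) (all? (P? ∘ to))

  -- A function decoded from its table agrees with the original only pointwise, so `P` has to
  -- respect pointwise equality. This is what makes the existence of a suitable automorphism
  -- decidable.
  ∃?-function : ∀ {P : (A → A) → Set} → Decidable P → (∀ {f g} → f ≗ g → P f → P g) → Dec (∃ P)
  ∃?-function {P} P? resp = map′ (λ (c , p) → decode c , p) encode (any? (P? ∘ decode))
    where
    decode : Fin (N ^ N) → A → A
    decode c x = to (finToFun c (from x))
    encode : ∃ P → Σ _ λ c → P (decode c)
    encode (f , p) = funToFin (from ∘ f ∘ to) , resp agree p
      where
      agree : f ≗ decode (funToFin (from ∘ f ∘ to))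
      agree x = sym (trans (cong to (finToFun-funToFin (from ∘ f ∘ to) (from x)))
                    (trans (to-from _) (cong f (to-from x))))

-- Counting walks in a finite abelian group modulo a prime.

module GroupWalks {G : Set} {_+_ : G → G → G} {0# : G} { -_ : G → G}
  (isAbelianGroup : IsAbelianGroup _≡_ _+_ 0# -_) {N} (enum : Fin N ↔ G) where

  open import Data.Nat.Properties as ℕₚ using ()
  open import Data.Fin.Permutation using (Permutation; permutation)
  open import Relation.Nullary.Decidable using (_×-dec_; dec-true; dec-false)
  import Data.Bool as Bool
  open import Algebra.Properties.CommutativeMonoid.Sum ℕₚ.+-0-commutativeMonoid
    using (sum; sum-permute; sum-cong-≗; sum-remove)

  abelianGroup : AbelianGroup _ _
  abelianGroup = record { isAbelianGroup = isAbelianGroup }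

  open IsAbelianGroup isAbelianGroup using (assoc; identityʳ)
  open AbelianGroup abelianGroup using (monoid)
  open import Algebra.Properties.Monoid.Mult monoid renaming (_×_ to _⋆_) using ()
  open GroupSolver abelianGroup using (solve; _⊜_; _:+_; _:-_; :-_)
  open Finite enum

  infixl 6 _⊝_
  _⊝_ : G → G → G
  x ⊝ y = x + (- y)

  x+[y-x]≡y : ∀ x y → x + (y ⊝ x) ≡ y
  x+[y-x]≡y = solve 2 (λ x y → x :+ (y :- x) ⊜ y) refl

  [x+y]-x≡y : ∀ x y → (x + y) ⊝ x ≡ y
  [x+y]-x≡y = solve 2 (λ x y → (x :+ y) :- x ⊜ y) refl

  ∑ : (G → ℕ) → ℕ
  ∑ φ = sum (λ i → φ (to i))

  ∑-cong : ∀ {φ ψ} → φ ≗ ψ → ∑ φ ≡ ∑ ψ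
  ∑-cong e = sum-cong-≗ (e ∘ to)

  ∑-permute : ∀ (f g : G → G) → (∀ x → f (g x) ≡ x) → (∀ x → g (f x) ≡ x) → ∀ φ → ∑ φ ≡ ∑ (φ ∘ f)
  ∑-permute f g fg gf φ = trans (sum-permute (φ ∘ to) π) (sum-cong-≗ {N} {λ i → φ (to (from (f (to i))))} {λ i → φ (f (to i))} λ i → cong φ (to-from _))
    where
    cancel : ∀ (h k : G → G) → (∀ x → h (k x) ≡ x) → ∀ i → from (h (to (from (k (to i))))) ≡ i
    cancel h k hk i = trans (cong (from ∘ h) (to-from _)) (trans (cong from (hk _)) (from-to i))
    π : Permutation N N
    π = permutation (from ∘ f ∘ to) (from ∘ g ∘ to) (cancel f g fg) (cancel g f gf)

  sum-zero : ∀ {n} {t : Fin n → ℕ} → (∀ i → t i ≡ 0) → sum t ≡ 0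
  sum-zero {zero} h = refl
  sum-zero {suc n} h = cong₂ ℕ._+_ (h Fin.zero) (sum-zero (h ∘ Fin.suc))

  ∑-single : ∀ {φ} a → (∀ z → z ≢ a → φ z ≡ 0) → ∑ φ ≡ φ a
  ∑-single {φ} a h = go (from a) (to-from a) h-to
    where
    h-to : ∀ i → i ≢ from a → φ (to i) ≡ 0
    h-to i i≢ = h (to i) λ e → i≢ (trans (sym (from-to i)) (cong from e))
    go : ∀ {n} {t : Fin n → G} (i : Fin n) → t i ≡ a → (∀ j → j ≢ i → φ (t j) ≡ 0) → sum (φ ∘ t) ≡ φ a
    go {suc n} {t} i tᵢ≡a h′ = begin
      sum (φ ∘ t) ≡⟨ sum-remove {i = i} (φ ∘ t) ⟩
      φ (t i) ℕ.+ sum (λ j → φ (t (Fin.punchIn i j))) ≡⟨ cong₂ ℕ._+_ (cong φ tᵢ≡a) (sum-zero λ j → h′ _ (punchInᵢ≢i i j)) ⟩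
      φ a ℕ.+ 0 ≡⟨ ℕₚ.+-identityʳ _ ⟩
      φ a ∎
      where
      open ≡-Reasoning
      open import Data.Fin.Properties using (punchInᵢ≢i)

  ∑-zero : ∀ {φ} → (∀ z → φ z ≡ 0) → ∑ φ ≡ 0
  ∑-zero h = sum-zero (h ∘ to)

  ∑-+ : ∀ φ ψ → ∑ (λ z → φ z ℕ.+ ψ z) ≡ ∑ φ ℕ.+ ∑ ψ
  ∑-+ φ ψ = ∑-distrib-+ (φ ∘ to) (ψ ∘ to)
    where open import Algebra.Properties.CommutativeMonoid.Sum ℕₚ.+-0-commutativeMonoid using (∑-distrib-+)

  -- Additive operators on functions `G → ℕ` stand in for the group ring, with `shift y` for the
  -- group element y. They form a semiring, to which the Frobenius congruence applies.
  record Operator : Set where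
    field
      apply   : (G → ℕ) → G → ℕ
      cong-≗  : ∀ {φ ψ} → φ ≗ ψ → apply φ ≗ apply ψ
      homo-+  : ∀ φ ψ x → apply (λ y → φ y ℕ.+ ψ y) x ≡ apply φ x ℕ.+ apply ψ x
      homo-0  : ∀ x → apply (λ _ → 0) x ≡ 0
  open Operator

  _≋_ : Operator → Operator → Set
  A ≋ B = ∀ φ x → apply A φ x ≡ apply B φ x

  _⊞_ _⊡_ : Operator → Operator → Operator
  A ⊞ B = record
    { apply  = λ φ x → apply A φ x ℕ.+ apply B φ x
    ; cong-≗ = λ e x → cong₂ ℕ._+_ (cong-≗ A e x) (cong-≗ B e x)
    ; homo-+ = λ φ ψ x → trans (cong₂ ℕ._+_ (homo-+ A φ ψ x) (homo-+ B φ ψ x))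
                               (ℕ-interchange (apply A φ x) _ _ _)
    ; homo-0 = λ x → cong₂ ℕ._+_ (homo-0 A x) (homo-0 B x)
    }
    where open import Algebra.Properties.CommutativeSemigroup ℕₚ.+-commutativeSemigroup renaming (interchange to ℕ-interchange)
  A ⊡ B = record
    { apply  = λ φ → apply A (apply B φ)
    ; cong-≗ = λ e → cong-≗ A (cong-≗ B e)
    ; homo-+ = λ φ ψ x → trans (cong-≗ A (homo-+ B φ ψ) x) (homo-+ A _ _ x)
    ; homo-0 = λ x → trans (cong-≗ A (homo-0 B) x) (homo-0 A x)
    }

  zeroOp oneOp : Operator
  zeroOp = record { apply = λ _ _ → 0 ; cong-≗ = λ _ _ → refl ; homo-+ = λ _ _ _ → refl ; homo-0 = λ _ → refl }
  oneOp = record { apply = λ φ → φ ; cong-≗ = λ e → e ; homo-+ = λ _ _ _ → refl ; homo-0 = λ _ → refl }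

  shift : G → Operator
  shift y = record
    { apply = λ φ x → φ (x + y) ; cong-≗ = λ e x → e (x + y)
    ; homo-+ = λ _ _ _ → refl ; homo-0 = λ _ → refl }

  operators : Semiring _ _
  operators = record
    { Carrier = Operator ; _≈_ = _≋_ ; _+_ = _⊞_ ; _*_ = _⊡_ ; 0# = zeroOp ; 1# = oneOp
    ; isSemiring = record
      { isSemiringWithoutAnnihilatingZero = record
        { +-isCommutativeMonoid = record
          { isMonoid = record
            { isSemigroup = record
              { isMagma = record
                { isEquivalence = record
                  { refl = λ _ _ → refl ; sym = λ e φ x → sym (e φ x) ; trans = λ e e′ φ x → trans (e φ x) (e′ φ x) }
                ; ∙-cong = λ e e′ φ x → cong₂ ℕ._+_ (e φ x) (e′ φ x) }
              ; assoc = λ A B C φ x → ℕₚ.+-assoc (apply A φ x) _ _ }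
            ; identity = (λ _ _ _ → refl) , λ A φ x → ℕₚ.+-identityʳ _ }
          ; comm = λ A B φ x → ℕₚ.+-comm (apply A φ x) _ }
        ; *-cong = λ {A} {A′} {B} e e′ φ x → trans (cong-≗ A (e′ φ) x) (e _ x)
        ; *-assoc = λ _ _ _ _ _ → refl
        ; *-identity = (λ _ _ _ → refl) , λ _ _ _ → refl
        ; distrib = (λ A B C φ x → homo-+ A _ _ x) , λ _ _ _ _ _ → refl }
      ; zero = (λ _ _ _ → refl) , λ A φ x → homo-0 A x } }

  module O where
    open Semiring operators public
    open import Algebra.Properties.Semiring.Sum operators public using () renaming (sum to ⨁)
    open import Algebra.Properties.Semiring.Mult operators public using (_×_)
    open import Algebra.Properties.Semiring.Exp operators public using (_^_)
  open O using (_^_; ⨁)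

  pick : Bool → ℕ → ℕ
  pick true n = n
  pick false n = 0

  term : Bool → G → Operator
  term true y = shift y
  term false y = zeroOp

  -- The adjacency operator of the Cayley digraph of `X`; its n-th power sums a function over the
  -- endpoints of the walks of length n.
  walk : (G → Bool) → Operator
  walk X = ⨁ (λ i → term (X (to i)) (to i))

  apply-⨁ : ∀ {n} (t : Fin n → Operator) φ x → apply (⨁ t) φ x ≡ sum (λ i → apply (t i) φ x)
  apply-⨁ {zero} t φ x = refl
  apply-⨁ {suc n} t φ x = cong (apply (t Fin.zero) φ x ℕ.+_) (apply-⨁ (t ∘ Fin.suc) φ x)

  apply-× : ∀ n A φ x → apply (n O.× A) φ x ≡ n ℕ.* apply A φ x
  apply-× zero A φ x = refl
  apply-× (suc n) A φ x = cong (apply A φ x ℕ.+_) (apply-× n A φ x)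

  apply-walk : ∀ X φ x → apply (walk X) φ x ≡ ∑ (λ y → pick (X y) (φ (x + y)))
  apply-walk X φ x = trans (apply-⨁ (λ i → term (X (to i)) (to i)) φ x) (∑-cong λ y → apply-term (X y) y)
    where
    apply-term : ∀ c y → apply (term c y) φ x ≡ pick c (φ (x + y))
    apply-term true y = refl
    apply-term false y = refl

  term-comm : ∀ b c y z → (term b y ⊡ term c z) ≋ (term c z ⊡ term b y)
  term-comm true true y z φ x = cong φ (solve 3 (λ x y z → (x :+ y) :+ z ⊜ (x :+ z) :+ y) refl x y z)
  term-comm true false y z φ x = refl
  term-comm false true y z φ x = refl
  term-comm false false y z φ x = refl

  apply-term-^ : ∀ n b y φ x → 0 < n → apply (term b y ^ n) φ x ≡ pick b (φ (x + (n ⋆ y)))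
  apply-term-^ (suc n) false y φ x _ = refl
  apply-term-^ (suc n) true y φ x _ = go (suc n) x
    where
    go : ∀ n x → apply (shift y ^ n) φ x ≡ φ (x + (n ⋆ y))
    go zero x = cong φ (sym (identityʳ x))
    go (suc n) x = trans (go n (x + y)) (cong φ (assoc x y _))

  -- The Frobenius endomorphism of 𝔽_q[G], lifted to ℕ.
  opaque
    walk-^ : ∀ {q} → Prime q → ∀ X → ∃ λ c → ∀ φ x →
      apply (walk X ^ q) φ x ≡ ∑ (λ y → pick (X y) (φ (x + (q ⋆ y)))) ℕ.+ q ℕ.* apply c φ x
    walk-^ {zero} pr = ⊥-elim (¬prime[0] pr)
    walk-^ {q@(suc _)} pr X with Frobenius.frobenius-sum operators pr (λ i → term (X (to i)) (to i))
                               (λ i j → term-comm (X (to i)) (X (to j)) _ _)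
    ... | c , e = c , λ φ x → trans (e φ x) (cong₂ ℕ._+_
            (trans (apply-⨁ (λ i → term (X (to i)) (to i) ^ q) φ x)
                   (sum-cong-≗ λ i → apply-term-^ q (X (to i)) (to i) φ x (s≤s z≤n)))
            (apply-× q c φ x))

  record Permutes (f f⁻¹ : G → G) : Set where
    field
      inverseˡ : ∀ x → f (f⁻¹ x) ≡ x
      inverseʳ : ∀ x → f⁻¹ (f x) ≡ x

  -- Two sets and a domain are allowed because an automorphism may carry one coset of a subgroup to
  -- another coset with a different connection set. For sets closed under `≈` the domain is
  -- everything and both sets coincide.
  record Preserves (f : G → G) (D : G → Set) (X X′ : G → Bool) : Set where
    field
      preserves : ∀ {x} y → D x → X y ≡ X′ (f (x + y) ⊝ f x)
      closed    : ∀ {x} y → D x → X y ≡ true → D (x + y)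

  δ : ∀ {P : Set} → Dec P → ℕ
  δ d = pick (does d) 1

  δ-true : ∀ {P} (d : Dec P) → P → δ d ≡ 1
  δ-true d p rewrite dec-true d p = refl

  δ-false : ∀ {P} (d : Dec P) → ¬ P → δ d ≡ 0
  δ-false d ¬p rewrite dec-false d ¬p = refl

  opaque
    count : (G → Bool) → ℕ → G → ℕ
    count X q w = ∑ (λ y → pick (X y) (δ ((q ⋆ y) ≟ w)))

    count-def : ∀ X q w → count X q w ≡ ∑ (λ y → pick (X y) (δ ((q ⋆ y) ≟ w)))
    count-def X q w = refl

  true≢false : true ≢ false
  true≢false ()

  scale : ℕ → (G → Bool) → G → Bool
  scale q X z = does (∃? λ y → (X y Bool.≟ true) ×-dec ((q ⋆ y) ≟ z))

  scale-intro : ∀ q X {y} → X y ≡ true → scale q X (q ⋆ y) ≡ true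
  scale-intro q X {y} Xy = dec-true (∃? λ y′ → (X y′ Bool.≟ true) ×-dec ((q ⋆ y′) ≟ (q ⋆ y))) (y , Xy , refl)

  does-true : ∀ {P : Set} (d : Dec P) → does d ≡ true → P
  does-true (yes p) _ = p

  scale-elim : ∀ q X z → scale q X z ≡ true → ∃ λ y → X y ≡ true × q ⋆ y ≡ z
  scale-elim q X z = does-true (∃? λ y → (X y Bool.≟ true) ×-dec ((q ⋆ y) ≟ z))

  InjectiveOn : ℕ → (G → Bool) → Set
  InjectiveOn q X = ∀ {y z} → X y ≡ true → X z ≡ true → q ⋆ y ≡ q ⋆ z → y ≡ z

  count-injective : ∀ q X w → InjectiveOn q X → count X q w ≡ pick (scale q X w) 1
  count-injective q X w inj with scale q X w in eq
  ... | true with scale-elim q X w eq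
  ...   | a , Xa , qa≡w = trans (count-def X q w) (trans (∑-single a others) at-a)
    where
    others : ∀ z → z ≢ a → pick (X z) (δ ((q ⋆ z) ≟ w)) ≡ 0
    others z z≢a with X z in Xz
    ... | false = refl
    ... | true = δ-false ((q ⋆ z) ≟ w) λ qz≡w → z≢a (inj Xz Xa (trans qz≡w (sym qa≡w)))
    at-a : pick (X a) (δ ((q ⋆ a) ≟ w)) ≡ 1
    at-a rewrite Xa = δ-true ((q ⋆ a) ≟ w) qa≡w
  count-injective q X w inj | false = trans (count-def X q w) (∑-zero zeroes)
    where
    zeroes : ∀ z → pick (X z) (δ ((q ⋆ z) ≟ w)) ≡ 0
    zeroes z with X z in Xz
    ... | false = refl
    ... | true = δ-false ((q ⋆ z) ≟ w) λ qz≡w → true≢false (trans (sym (scale-intro q X Xz)) (trans (cong (scale q X) qz≡w) eq))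

  module _ {f f⁻¹ : G → G} (perm : Permutes f f⁻¹) {D : G → Set} {X X′ : G → Bool} (P : Preserves f D X X′) where
    open Permutes perm
    open Preserves P

    f-injective : ∀ {x y} → f x ≡ f y → x ≡ y
    f-injective {x} {y} e = trans (sym (inverseʳ x)) (trans (cong f⁻¹ e) (inverseʳ y))

    -- Reindexing by y ↦ f (x + y) - f x, a permutation of G that takes the X-steps at x to the
    -- X′-steps at f x.
    walk-preserved : ∀ {φ φ′} → (∀ {x} → D x → φ x ≡ φ′ (f x)) →
      ∀ {x} → D x → apply (walk X) φ x ≡ apply (walk X′) φ′ (f x)
    walk-preserved {φ} {φ′} hφ {x} Dx = begin
      apply (walk X) φ x ≡⟨ apply-walk X φ x ⟩
      ∑ (λ y → pick (X y) (φ (x + y))) ≡⟨ ∑-cong along ⟩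
      ∑ (λ y → pick (X′ (move y)) (φ′ (f x + move y))) ≡⟨ ∑-permute move back move-back back-move (λ y → pick (X′ y) (φ′ (f x + y))) ⟨
      ∑ (λ y → pick (X′ y) (φ′ (f x + y))) ≡⟨ apply-walk X′ φ′ (f x) ⟨
      apply (walk X′) φ′ (f x) ∎
      where
      open ≡-Reasoning
      move back : G → G
      move y = f (x + y) ⊝ f x
      back w = f⁻¹ (f x + w) ⊝ x
      move-back : ∀ w → move (back w) ≡ w
      move-back w = trans (cong (_⊝ f x) (trans (cong f (x+[y-x]≡y x _)) (inverseˡ _))) ([x+y]-x≡y _ _)
      back-move : ∀ y → back (move y) ≡ y
      back-move y = trans (cong (_⊝ x) (trans (cong f⁻¹ (x+[y-x]≡y (f x) _)) (inverseʳ _))) ([x+y]-x≡y _ _)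
      along : ∀ y → pick (X y) (φ (x + y)) ≡ pick (X′ (move y)) (φ′ (f x + move y))
      along y with X y in Xy | X′ (move y) | preserves y Dx
      ... | true  | true  | _ = trans (hφ (closed y Dx Xy)) (cong φ′ (sym (x+[y-x]≡y (f x) _)))
      ... | false | false | _ = refl
      ... | true  | false | e = ⊥-elim (true≢false e)
      ... | false | true  | e = ⊥-elim (true≢false (sym e))

    walk-^-preserved : ∀ {φ φ′} → (∀ {x} → D x → φ x ≡ φ′ (f x)) →
      ∀ n {x} → D x → apply (walk X ^ n) φ x ≡ apply (walk X′ ^ n) φ′ (f x)
    walk-^-preserved hφ zero Dx = hφ Dx
    walk-^-preserved hφ (suc n) Dx = walk-preserved (λ Dy → walk-^-preserved hφ n Dy) Dx

    opaque
      -- Both sides count, modulo `q`, the walks of length `q` from x to x + y and from f x to f (x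
      -- + y). The test functions are the indicators of these endpoints, and a surplus stands on
      -- each side in place of a subtraction.
      count-preserved : ∀ {q} → Prime q → ∀ {x} → D x → ∀ y →
        ∃₂ λ c c′ → count X q y ℕ.+ q ℕ.* c ≡ count X′ q (f (x + y) ⊝ f x) ℕ.+ q ℕ.* c′
      count-preserved {q} pr {x} Dx y with walk-^ pr X | walk-^ pr X′
      ... | c , e | c′ , e′ = apply c φ x , apply c′ φ′ (f x) , (begin
        count X q y ℕ.+ q ℕ.* apply c φ x
          ≡⟨ cong (ℕ._+ q ℕ.* apply c φ x) (trans (count-def X q y) (∑-cong λ z → cong (pick (X z)) (δ-iff ((q ⋆ z) ≟ y) ((x + (q ⋆ z)) ≟ (x + y))
               (λ qz≡y → cong (x +_) qz≡y) (cancelˡ x)))) ⟩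
        ∑ (λ z → pick (X z) (φ (x + (q ⋆ z)))) ℕ.+ q ℕ.* apply c φ x
          ≡⟨ e φ x ⟨
        apply (walk X ^ q) φ x
          ≡⟨ walk-^-preserved (λ {z} _ → δ-iff (_ ≟ _) (_ ≟ _) (cong f) f-injective) q Dx ⟩
        apply (walk X′ ^ q) φ′ (f x)
          ≡⟨ e′ φ′ (f x) ⟩
        ∑ (λ z → pick (X′ z) (φ′ (f x + (q ⋆ z)))) ℕ.+ q ℕ.* apply c′ φ′ (f x)
          ≡⟨ cong (ℕ._+ q ℕ.* apply c′ φ′ (f x)) (trans (∑-cong λ z → cong (pick (X′ z)) (δ-iff ((f x + (q ⋆ z)) ≟ f (x + y)) ((q ⋆ z) ≟ (f (x + y) ⊝ f x))
               (λ fx+qz≡ → trans (sym ([x+y]-x≡y (f x) _)) (cong (_⊝ f x) fx+qz≡))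
               (λ qz≡ → trans (cong (f x +_) qz≡) (x+[y-x]≡y (f x) _)))) (sym (count-def X′ q _))) ⟩
        count X′ q (f (x + y) ⊝ f x) ℕ.+ q ℕ.* apply c′ φ′ (f x) ∎)
        where
        open ≡-Reasoning
        φ φ′ : G → ℕ
        φ z = δ (z ≟ (x + y))
        φ′ z = δ (z ≟ f (x + y))
        cancelˡ : ∀ x {y z} → x + y ≡ x + z → y ≡ z
        cancelˡ x {y} {z} e = trans (sym ([x+y]-x≡y x y)) (trans (cong (_⊝ x) e) ([x+y]-x≡y x z))
        δ-iff : ∀ {P Q} (p : Dec P) (q : Dec Q) → (P → Q) → (Q → P) → δ p ≡ δ q
        δ-iff (yes _) (yes _) _ _ = refl
        δ-iff (no _) (no _) _ _ = refl
        δ-iff (yes p) (no ¬q) pq qp = ⊥-elim (¬q (pq p))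
        δ-iff (no ¬p) (yes q) pq qp = ⊥-elim (¬p (qp q))

    opaque
      -- If multiplication by `q` is injective on the sets, the counts are 0 or 1, and such numbers
      -- are determined by their residues modulo `q`.
      scale-preserved : ∀ {q} → Prime q → InjectiveOn q X → InjectiveOn q X′ →
        Preserves f D (scale q X) (scale q X′)
      scale-preserved {q} pr inj inj′ = record
        { preserves = λ y Dx → bits-equal (scale q X y) _ (scaled y Dx)
        ; closed = λ y Dx qXy → let (a , Xa , qa≡y) = scale-elim q X y qXy in
                     subst D (cong (_ +_) qa≡y) (iterate a Xa q Dx) }
        where
        scaled : ∀ {x} y → D x → ∃₂ λ c c′ →
          pick (scale q X y) 1 ℕ.+ q ℕ.* c ≡ pick (scale q X′ (f (x + y) ⊝ f x)) 1 ℕ.+ q ℕ.* c′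
        scaled y Dx with count-preserved pr Dx y
        ... | c , c′ , e = c , c′ , subst₂ (λ m n → m ℕ.+ q ℕ.* c ≡ n ℕ.+ q ℕ.* c′)
                                      (count-injective q X _ inj) (count-injective q X′ _ inj′) e
        q∤1 : ∀ {c c′} → 1 ℕ.+ q ℕ.* c ≢ q ℕ.* c′
        q∤1 {c} {c′} e = nonTrivial⇒≢1 {{prime⇒nonTrivial pr}} (∣1⇒≡1 (∣m+n∣n⇒∣m (divides c′ (trans e (ℕₚ.*-comm q c′))) (m∣m*n c)))
          where
          open import Data.Nat.Divisibility using (divides; ∣1⇒≡1; m∣m*n; ∣m+n∣m⇒∣n; _∣_)
          open import Data.Nat using (nonTrivial⇒≢1)
          ∣m+n∣n⇒∣m : ∀ {i m n} → i ∣ m ℕ.+ n → i ∣ n → i ∣ m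
          ∣m+n∣n⇒∣m {i} {m} {n} h = ∣m+n∣m⇒∣n (subst (i ∣_) (ℕₚ.+-comm m n) h)
        bits-equal : ∀ a b → (∃₂ λ c c′ → pick a 1 ℕ.+ q ℕ.* c ≡ pick b 1 ℕ.+ q ℕ.* c′) → a ≡ b
        bits-equal true true _ = refl
        bits-equal false false _ = refl
        bits-equal true false (c , c′ , e) = ⊥-elim (q∤1 e)
        bits-equal false true (c , c′ , e) = ⊥-elim (q∤1 (sym e))
        iterate : ∀ a → X a ≡ true → ∀ n {x} → D x → D (x + (n ⋆ a))
        iterate a Xa zero Dx = subst D (sym (identityʳ _)) Dx
        iterate a Xa (suc n) Dx = subst D (assoc _ _ _) (iterate a Xa n (closed a Dx Xa))

  boolean-ext : ∀ {a b} → (a ≡ true → b ≡ true) → (b ≡ true → a ≡ true) → a ≡ b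
  boolean-ext {true}  ab ba = sym (ab refl)
  boolean-ext {false} {true}  ab ba = ba refl
  boolean-ext {false} {false} ab ba = refl

  scale-1 : ∀ X z → scale 1 X z ≡ X z
  scale-1 X z = boolean-ext
    (λ e → let (y , Xy , y≡z) = scale-elim 1 X z e in subst (λ w → X w ≡ true) (trans (sym (identityʳ y)) y≡z) Xy)
    (λ Xz → subst (λ w → scale 1 X w ≡ true) (identityʳ z) (scale-intro 1 X Xz))

  scale-* : ∀ k l X z → scale (k ℕ.* l) X z ≡ scale k (scale l X) z
  scale-* k l X z = boolean-ext forth back
    where
    open import Algebra.Properties.Monoid.Mult monoid using (×-assocˡ)
    forth : scale (k ℕ.* l) X z ≡ true → scale k (scale l X) z ≡ true
    forth e with scale-elim (k ℕ.* l) X z e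
    ... | y , Xy , kly≡z = subst (λ w → scale k (scale l X) w ≡ true) (trans (×-assocˡ y k l) kly≡z)
            (scale-intro k (scale l X) (scale-intro l X Xy))
    back : scale k (scale l X) z ≡ true → scale (k ℕ.* l) X z ≡ true
    back e with scale-elim k (scale l X) z e
    ... | y , lXy , ky≡z with scale-elim l X y lXy
    ...   | x , Xx , lx≡y = subst (λ w → scale (k ℕ.* l) X w ≡ true)
            (trans (sym (×-assocˡ x k l)) (trans (cong (k ⋆_) lx≡y) ky≡z)) (scale-intro (k ℕ.* l) X Xx)

  Preserves-cong : ∀ {f D X Y X′ Y′} → X ≗ Y → X′ ≗ Y′ → Preserves f D X X′ → Preserves f D Y Y′
  Preserves-cong X≗Y X′≗Y′ P = record
    { preserves = λ y Dx → trans (sym (X≗Y y)) (trans (Preserves.preserves P y Dx) (X′≗Y′ _))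
    ; closed = λ y Dx Yy → Preserves.closed P y Dx (trans (X≗Y y) Yy) }

  -- Every integer all of whose prime factors act injectively is a multiplier.
  module Multiplier (Q : ℕ → Set) (P : (G → Bool) → Set)
    (Q-factors : ∀ {k l} → Q (k ℕ.* l) → Q k × Q l)
    (P-injective : ∀ {q X} → Q q → P X → InjectiveOn q X)
    (P-scale : ∀ {X} k → P X → P (scale k X))
    {f f⁻¹ : G → G} (perm : Permutes f f⁻¹) {D : G → Set} where

    scale-multiplier : ∀ k .{{_ : ℕ.NonZero k}} → Q k → ∀ {X X′} → P X → P X′ →
      Preserves f D X X′ → Preserves f D (scale k X) (scale k X′)
    scale-multiplier k Qk {X} {X′} PX PX′ pres =
      subst (λ n → Preserves f D (scale n X) (scale n X′)) (sym k≡) (go qs prs (subst Q k≡ Qk))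
      where
      open import Data.Nat.Primality.Factorisation using (PrimeFactorisation; factorise)
      open import Data.List using (List; []; _∷_)
      open import Data.Nat.ListAction using (product)
      open import Data.List.Relation.Unary.All using (All; []; _∷_)
      open PrimeFactorisation (factorise k) renaming (factors to qs; isFactorisation to k≡; factorsPrime to prs)
      go : ∀ qs → All Prime qs → Q (product qs) → Preserves f D (scale (product qs) X) (scale (product qs) X′)
      go [] [] _ = Preserves-cong (sym ∘ scale-1 X) (sym ∘ scale-1 X′) pres
      go (q ∷ qs) (pr ∷ prs) Qqs with Q-factors {q} {product qs} Qqs
      ... | Qq , Qrest = Preserves-cong (sym ∘ scale-* q (product qs) X) (sym ∘ scale-* q (product qs) X′)
              (scale-preserved perm (go qs prs Qrest) pr (P-injective {q} Qq (P-scale (product qs) PX)) (P-injective {q} Qq (P-scale (product qs) PX′)))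

-- Arithmetic modulo prime powers.

module PrimePowers where
  open import Data.Nat
  open import Data.Nat.Properties
  open import Data.Nat.Divisibility
  open import Data.Nat.Coprimality using (Coprime; coprime-Bézout; coprime-divisor)
  open import Data.Nat.GCD using (module Bézout)
  open import Data.Nat.Solver using (module +-*-Solver)
  open +-*-Solver using (solve; _:=_; con) renaming (_:+_ to _⊹_; _:*_ to _⊛_)

  opaque
    coprime-^ : ∀ {p k} → Prime p → p ∤ k → ∀ e → Coprime k (p ^ e)
    coprime-^ pr p∤k zero (_ , d∣1) = ∣1⇒≡1 d∣1
    coprime-^ {p} {k} pr p∤k (suc e) {d} (d∣k , d∣p*p^e) =
      coprime-^ pr p∤k e (d∣k , coprime-divisor coprime-d-p d∣p*p^e)
      where
      coprime-d-p : Coprime d p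
      coprime-d-p (c∣d , c∣p) with prime⇒irreducible pr c∣p
      ... | inj₁ c≡1 = c≡1
      ... | inj₂ refl = ⊥-elim (p∤k (∣-trans c∣d d∣k))

  opaque
    inverse-mod : ∀ {k n} → Coprime k n → ∃ λ k′ → ∃₂ λ l l′ → k′ * k + l * n ≡ 1 + l′ * n
    inverse-mod {k} {n} c with coprime-Bézout c
    ... | Bézout.+- x y eq = x , 0 , y , trans (+-identityʳ _) (sym eq)
    -- Here x k is -1 modulo n; squaring removes the sign, so x k x inverts k without any
    -- subtraction.
    ... | Bézout.-+ x y eq = x * k * x , 2 * y , y * (y * n) , (begin
      x * k * x * k + 2 * y * n ≡⟨ solve 4 (λ x k y n → x ⊛ k ⊛ x ⊛ k ⊹ con 2 ⊛ y ⊛ n := (x ⊛ k) ⊛ (x ⊛ k) ⊹ con 2 ⊛ (y ⊛ n)) refl x k y n ⟩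
      (x * k) * (x * k) + 2 * (y * n) ≡⟨ cong (λ z → (x * k) * (x * k) + 2 * z) eq ⟨
      (x * k) * (x * k) + 2 * (1 + x * k) ≡⟨ solve 1 (λ a → a ⊛ a ⊹ con 2 ⊛ (con 1 ⊹ a) := con 1 ⊹ (con 1 ⊹ a) ⊛ (con 1 ⊹ a)) refl (x * k) ⟩
      1 + (1 + x * k) * (1 + x * k) ≡⟨ cong (λ z → 1 + z * z) eq ⟩
      1 + y * n * (y * n) ≡⟨ solve 2 (λ y n → con 1 ⊹ y ⊛ n ⊛ (y ⊛ n) := con 1 ⊹ y ⊛ (y ⊛ n) ⊛ n) refl y n ⟩
      1 + y * (y * n) * n ∎)
      where open ≡-Reasoning

  opaque
    [1+c]^n : ∀ n c → ∃ λ g → (1 + c) ^ n ≡ 1 + n * c + c * c * g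
    [1+c]^n zero c = 0 , cong (1 +_) (sym (*-zeroʳ (c * c)))
    [1+c]^n (suc n) c with [1+c]^n n c
    ... | g , eq = g + n + c * g , (begin
      (1 + c) * (1 + c) ^ n ≡⟨ cong ((1 + c) *_) eq ⟩
      (1 + c) * (1 + n * c + c * c * g) ≡⟨ solve 3 (λ c n g → (con 1 ⊹ c) ⊛ (con 1 ⊹ n ⊛ c ⊹ c ⊛ c ⊛ g)
                                                   := con 1 ⊹ (con 1 ⊹ n) ⊛ c ⊹ c ⊛ c ⊛ (g ⊹ n ⊹ c ⊛ g)) refl c n g ⟩
      1 + suc n * c + c * c * (g + n + c * g) ∎)
      where open ≡-Reasoning

  -- The binomial coefficient C(n, 2).
  triangle : ℕ → ℕ
  triangle zero = 0
  triangle (suc n) = triangle n + n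

  triangle-odd : ∀ h → triangle (suc (2 * h)) ≡ suc (2 * h) * h
  triangle-odd zero = refl
  triangle-odd (suc h) = begin
    triangle (suc (2 * suc h)) ≡⟨ cong (λ n → triangle (suc n)) (*-suc 2 h) ⟩
    triangle (suc (2 * h)) + suc (2 * h) + suc (suc (2 * h)) ≡⟨ cong (λ t → t + suc (2 * h) + suc (suc (2 * h))) (triangle-odd h) ⟩
    suc (2 * h) * h + suc (2 * h) + suc (suc (2 * h)) ≡⟨ solve 1 (λ h → (con 1 ⊹ con 2 ⊛ h) ⊛ h ⊹ (con 1 ⊹ con 2 ⊛ h) ⊹ (con 2 ⊹ con 2 ⊛ h)
                                                                 := (con 1 ⊹ con 2 ⊛ (con 1 ⊹ h)) ⊛ (con 1 ⊹ h)) refl h ⟩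
    suc (2 * suc h) * suc h ∎
    where open ≡-Reasoning

  opaque
    [1+c]^n-cubic : ∀ n c → ∃ λ g → (1 + c) ^ n ≡ 1 + n * c + triangle n * (c * c) + c * c * c * g
    [1+c]^n-cubic zero c = 0 , cong (1 +_) (sym (*-zeroʳ (c * c * c)))
    [1+c]^n-cubic (suc n) c with [1+c]^n-cubic n c
    ... | g , eq = g + triangle n + c * g , (begin
      (1 + c) * (1 + c) ^ n
        ≡⟨ cong ((1 + c) *_) eq ⟩
      (1 + c) * (1 + n * c + triangle n * (c * c) + c * c * c * g)
        ≡⟨ solve 4 (λ c n t g → (con 1 ⊹ c) ⊛ (con 1 ⊹ n ⊛ c ⊹ t ⊛ (c ⊛ c) ⊹ c ⊛ c ⊛ c ⊛ g)
             := con 1 ⊹ (con 1 ⊹ n) ⊛ c ⊹ (t ⊹ n) ⊛ (c ⊛ c) ⊹ c ⊛ c ⊛ c ⊛ (g ⊹ t ⊹ c ⊛ g)) refl c n (triangle n) g ⟩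
      1 + suc n * c + (triangle n + n) * (c * c) + c * c * c * (g + triangle n + c * g) ∎)
      where open ≡-Reasoning

  opaque
    -- For odd `p` the quadratic coefficient C(p, 2) is itself a multiple of `p`. Up to a factor
    -- congruent to 1 modulo `p`, taking the p-th power therefore replaces c by p c.
    [1+c]^p : ∀ {p} h → p ≡ suc (2 * h) → ∀ d → let c = p * d in
      ∃ λ w → (1 + c) ^ p ≡ 1 + p * c * (1 + c * w)
    [1+c]^p {p} h p≡ d with [1+c]^n-cubic p (p * d)
    ... | g , eq = h + d * g , (begin
      (1 + c) ^ p ≡⟨ eq ⟩
      1 + p * c + triangle p * (c * c) + c * c * c * g ≡⟨ cong (λ t → 1 + p * c + t * (c * c) + c * c * c * g)
                                                            (trans (cong triangle p≡) (trans (triangle-odd h) (cong (_* h) (sym p≡)))) ⟩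
      1 + p * c + p * h * (c * c) + c * c * c * g ≡⟨ solve 4 (λ p d h g → let c = p ⊛ d in
                                                            con 1 ⊹ p ⊛ c ⊹ p ⊛ h ⊛ (c ⊛ c) ⊹ c ⊛ c ⊛ c ⊛ g
                                                            := con 1 ⊹ p ⊛ c ⊛ (con 1 ⊹ c ⊛ (h ⊹ d ⊛ g))) refl p d h g ⟩
      1 + p * c * (1 + c * (h + d * g)) ∎)
      where
      open ≡-Reasoning
      c : ℕ
      c = p * d

  opaque
    even-or-odd : ∀ k → (∃ λ h → k ≡ 2 * h) ⊎ (∃ λ h → k ≡ suc (2 * h))
    even-or-odd zero = inj₁ (0 , refl)
    even-or-odd (suc k) with even-or-odd k
    ... | inj₁ (h , refl) = inj₂ (h , refl)
    ... | inj₂ (h , refl) = inj₁ (suc h , sym (*-suc 2 h))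

  opaque
    2∤⇒odd : ∀ {k} → 2 ∤ k → ∃ λ h → k ≡ suc (2 * h)
    2∤⇒odd {k} 2∤k with even-or-odd k
    ... | inj₁ (h , refl) = ⊥-elim (2∤k (m∣m*n h))
    ... | inj₂ odd = odd

  2∤odd : ∀ h → 2 ∤ suc (2 * h)
  2∤odd h 2∣ with ∣1⇒≡1 (∣m+n∣m⇒∣n (subst (2 ∣_) (+-comm 1 (2 * h)) 2∣) (m∣m*n h))
  ... | ()

-- Multiples, and the chain of subgroups of a cyclic p-group.

module Multiples {C : Set} {_+_ : C → C → C} {0# : C} { -_ : C → C}
  (isAbelianGroup : IsAbelianGroup _≡_ _+_ 0# -_) where

  abelianGroup : AbelianGroup _ _
  abelianGroup = record { isAbelianGroup = isAbelianGroup }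

  open AbelianGroup abelianGroup using (monoid; commutativeMonoid)
  open import Algebra.Properties.Monoid.Mult monoid public using (×-homo-+; ×-homo-1) renaming (_×_ to infixr 8 _⋆_)
  open import Algebra.Properties.CommutativeMonoid.Mult commutativeMonoid public using (×-distrib-+)
  open import Algebra.Properties.Monoid.Mult monoid using (×-assocˡ)
  open GroupSolver abelianGroup public using (solve; _⊜_; _:+_; _:-_; :-_; :0)
  open IsAbelianGroup isAbelianGroup using (identityˡ; identityʳ)

  ⋆-assoc : ∀ m n x → m ⋆ n ⋆ x ≡ (m ℕ.* n) ⋆ x
  ⋆-assoc m n x = ×-assocˡ x m n

  ⋆-swap : ∀ m n x → m ⋆ n ⋆ x ≡ n ⋆ m ⋆ x
  ⋆-swap m n x = trans (⋆-assoc m n x) (trans (cong (_⋆ x) (*-comm m n)) (sym (⋆-assoc n m x)))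
    where open import Data.Nat.Properties using (*-comm)

  ⋆-zero : ∀ n → n ⋆ 0# ≡ 0#
  ⋆-zero zero = refl
  ⋆-zero (suc n) = trans (identityˡ _) (⋆-zero n)

  ⋆-neg : ∀ n x → n ⋆ (- x) ≡ - (n ⋆ x)
  ⋆-neg zero x = solve 0 (:0 ⊜ :- :0) refl
  ⋆-neg (suc n) x = trans (cong ((- x) +_) (⋆-neg n x)) (solve 2 (λ x y → (:- x) :- y ⊜ :- (x :+ y)) refl x (n ⋆ x))

  ⋆-modulo : ∀ {a b m} l l′ {x} → m ⋆ x ≡ 0# → a ℕ.+ l ℕ.* m ≡ b ℕ.+ l′ ℕ.* m → a ⋆ x ≡ b ⋆ x
  ⋆-modulo {a} {b} {m} l l′ {x} mx≡0 eq = begin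
    a ⋆ x ≡⟨ identityʳ _ ⟨
    (a ⋆ x) + 0# ≡⟨ cong ((a ⋆ x) +_) (vanish l) ⟨
    (a ⋆ x) + ((l ℕ.* m) ⋆ x) ≡⟨ ×-homo-+ x a (l ℕ.* m) ⟨
    (a ℕ.+ l ℕ.* m) ⋆ x ≡⟨ cong (_⋆ x) eq ⟩
    (b ℕ.+ l′ ℕ.* m) ⋆ x ≡⟨ ×-homo-+ x b (l′ ℕ.* m) ⟩
    (b ⋆ x) + ((l′ ℕ.* m) ⋆ x) ≡⟨ cong ((b ⋆ x) +_) (vanish l′) ⟩
    (b ⋆ x) + 0# ≡⟨ identityʳ _ ⟩
    b ⋆ x ∎
    where
    open ≡-Reasoning
    vanish : ∀ l → (l ℕ.* m) ⋆ x ≡ 0#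
    vanish l = trans (sym (⋆-assoc l m x)) (trans (cong (l ⋆_) mx≡0) (⋆-zero l))

  -- Cyclicity is expressed without a generator: of any two elements one is a multiple of the other,
  -- so the subgroups form a chain.
  module CyclicPGroup {p e} (e>0 : 0 < e) (pr : Prime p) (p-odd : ∃ λ h → p ≡ suc (2 ℕ.* h))
    (torsion : ∀ x → (p ℕ.^ e) ⋆ x ≡ 0#)
    (cyclic : ∀ x y → (∃ λ k → x ≡ k ⋆ y) ⊎ (∃ λ k → y ≡ k ⋆ x)) where

    open import Data.Nat.Properties hiding (_≟_)
    open import Data.Nat.Divisibility
    open import Data.Nat.Solver using (module +-*-Solver)
    open PrimePowers

    m : ℕ
    m = p ℕ.^ e

    ⋆-mod : ∀ {a b} l l′ x → a ℕ.+ l ℕ.* m ≡ b ℕ.+ l′ ℕ.* m → a ⋆ x ≡ b ⋆ x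
    ⋆-mod l l′ x = ⋆-modulo l l′ (torsion x)

    opaque
      unit : ∀ {k} → p ∤ k → ∃ λ k′ → ∀ x → k′ ⋆ k ⋆ x ≡ x
      unit {k} p∤k with inverse-mod (coprime-^ pr p∤k e)
      ... | k′ , l , l′ , eq = k′ , λ x → trans (⋆-assoc k′ k x) (trans (⋆-mod l l′ x eq) (×-homo-1 x))

    p≢1 : p ≢ 1
    p≢1 = ℕ.nonTrivial⇒≢1 {{prime⇒nonTrivial pr}}

    opaque
      p∣m : p ∣ m
      p∣m = ∣-^ e>0
        where
        ∣-^ : ∀ {e} → 0 < e → p ∣ p ℕ.^ e
        ∣-^ {suc e} _ = m∣m*n (p ℕ.^ e)

    opaque
      m-odd : ∃ λ h → m ≡ suc (2 ℕ.* h)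
      m-odd = odd-^ e
        where
        odd-^ : ∀ e → ∃ λ h → p ℕ.^ e ≡ suc (2 ℕ.* h)
        odd-^ zero = 0 , refl
        odd-^ (suc e) with odd-^ e
        ... | h , eq = h ℕ.+ h′ ℕ.* suc (2 ℕ.* h) , trans (cong₂ ℕ._*_ (proj₂ p-odd) eq)
              (ℕ-solve 2 (λ h h′ → (con 1 ⊹ con 2 :* h′) :* (con 1 ⊹ con 2 :* h)
                := con 1 ⊹ con 2 :* (h ⊹ h′ :* (con 1 ⊹ con 2 :* h))) refl h h′)
          where
          open +-*-Solver using (_:=_; con; _:*_) renaming (solve to ℕ-solve; _:+_ to _⊹_)
          h′ : ℕ
          h′ = proj₁ p-odd

    p∤1+p* : ∀ c → p ∤ suc (p ℕ.* c)
    p∤1+p* c p∣ = p≢1 (∣1⇒≡1 (∣m+n∣m⇒∣n (subst (p ∣_) (sym (+-comm (p ℕ.* c) 1)) p∣) (m∣m*n c)))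

    p∤2 : p ∤ 2
    p∤2 p∣2 = go (proj₁ p-odd) (proj₂ p-odd)
      where
      go : ∀ h → p ≡ suc (2 ℕ.* h) → ⊥
      go zero p≡1 = p≢1 p≡1
      go (suc h) p≡ = <⇒≱ (subst (2 <_) (sym (trans p≡ (cong suc (*-suc 2 h)))) (s≤s (s≤s (s≤s z≤n)))) (∣⇒≤ p∣2)

    p∤* : ∀ {a b} → p ∤ a → p ∤ b → p ∤ a ℕ.* b
    p∤* p∤a p∤b p∣ab with euclidsLemma _ _ pr p∣ab
    ... | inj₁ p∣a = p∤a p∣a
    ... | inj₂ p∣b = p∤b p∣b

    p∤^ : ∀ {a} n → p ∤ a → p ∤ a ℕ.^ n
    p∤^ zero p∤a p∣1 = p≢1 (∣1⇒≡1 p∣1)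
    p∤^ (suc n) p∤a = p∤* p∤a (p∤^ n p∤a)

    -- In the cyclic group of order p^e this is the subgroup of order p^min(i, e). As a record it
    -- lets unification recover `i` and `x`.
    record J (i : ℕ) (x : C) : Set where
      constructor torsion-by
      field annihilated : (p ℕ.^ i) ⋆ x ≡ 0#
    open J

    J-0 : ∀ {x} → J 0 x → x ≡ 0#
    J-0 {x} Jx = trans (sym (×-homo-1 x)) (annihilated Jx)

    J-zero : ∀ {i} → J i 0#
    J-zero {i} = torsion-by (⋆-zero (p ℕ.^ i))

    J-+ : ∀ {i x y} → J i x → J i y → J i (x + y)
    J-+ {i} {x} {y} (torsion-by Jx) (torsion-by Jy) =
      torsion-by (trans (×-distrib-+ x y (p ℕ.^ i)) (trans (cong₂ _+_ Jx Jy) (identityˡ 0#)))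

    J-neg : ∀ {i x} → J i x → J i (- x)
    J-neg {i} {x} (torsion-by Jx) =
      torsion-by (trans (⋆-neg (p ℕ.^ i) x) (trans (cong -_ Jx) (solve 0 (:- :0 ⊜ :0) refl)))

    J-⋆ : ∀ {i} k {x} → J i x → J i (k ⋆ x)
    J-⋆ {i} k {x} (torsion-by Jx) = torsion-by (trans (⋆-swap (p ℕ.^ i) k x) (trans (cong (k ⋆_) Jx) (⋆-zero k)))

    J-≤ : ∀ {i j x} → i ≤ j → J i x → J j x
    J-≤ {i} {j} {x} i≤j (torsion-by Jx) = torsion-by (begin
      (p ℕ.^ j) ⋆ x ≡⟨ cong (λ j → (p ℕ.^ j) ⋆ x) (m∸n+n≡m i≤j) ⟨
      (p ℕ.^ (j ℕ.∸ i ℕ.+ i)) ⋆ x ≡⟨ cong (_⋆ x) (^-distribˡ-+-* p (j ℕ.∸ i) i) ⟩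
      (p ℕ.^ (j ℕ.∸ i) ℕ.* p ℕ.^ i) ⋆ x ≡⟨ ⋆-assoc (p ℕ.^ (j ℕ.∸ i)) (p ℕ.^ i) x ⟨
      (p ℕ.^ (j ℕ.∸ i)) ⋆ (p ℕ.^ i) ⋆ x ≡⟨ cong ((p ℕ.^ (j ℕ.∸ i)) ⋆_) Jx ⟩
      (p ℕ.^ (j ℕ.∸ i)) ⋆ 0# ≡⟨ ⋆-zero (p ℕ.^ (j ℕ.∸ i)) ⟩
      0# ∎)
      where open ≡-Reasoning

    J-top : ∀ {i x} → e ≤ i → J i x
    J-top e≤i = J-≤ e≤i (torsion-by (torsion _))

    J-p⋆ : ∀ {i x} → J (suc i) x → J i (p ⋆ x)
    J-p⋆ {i} {x} (torsion-by Jx) =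
      torsion-by (trans (⋆-assoc (p ℕ.^ i) p x) (trans (cong (_⋆ x) (*-comm (p ℕ.^ i) p)) Jx))

    p∣⇒J : ∀ {i x k} → p ∣ k → J (suc i) x → J i (k ⋆ x)
    p∣⇒J (divides d refl) Jx = subst (J _) (⋆-assoc d p _) (J-⋆ d (J-p⋆ Jx))

    opaque
      -- If instead y = k x, then k is prime to p, since otherwise y would fall into `J i`; so k can
      -- be inverted. In particular every element of `J (suc i)` outside `J i` generates
      -- `J (suc i)`.
      generates : ∀ {i x y} → J (suc i) x → ¬ J i y → ∃ λ k → x ≡ k ⋆ y
      generates {i} {x} {y} Jx ¬Jy with cyclic x y
      ... | inj₁ x∈⟨y⟩ = x∈⟨y⟩
      ... | inj₂ (k , refl) with p ∣? k
      ...   | yes p∣k = ⊥-elim (¬Jy (p∣⇒J p∣k Jx))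
      ...   | no p∤k with unit p∤k
      ...     | k′ , k′k = k′ , sym (k′k x)

    -- The even factor 2 lets 1 + p (2 d) act trivially on 2-torsion.
    opaque
      proper-multiple : ∀ {i x y} → ¬ J i x → J i y → ∃ λ d → y ≡ (p ℕ.* (2 ℕ.* d)) ⋆ x
      proper-multiple {i} {x} {y} ¬Jx Jy with unit p∤2
      ... | h , 2h with cyclic (h ⋆ y) x
      ...   | inj₂ (k , refl) = ⊥-elim (¬Jx (J-⋆ k (J-⋆ h Jy)))
      ...   | inj₁ (k , hy≡kx) with p ∣? k
      ...     | no p∤k with unit p∤k
      ...       | k′ , k′k = ⊥-elim (¬Jx (subst (J i) (trans (cong (k′ ⋆_) hy≡kx) (k′k x)) (J-⋆ k′ (J-⋆ h Jy))))
      proper-multiple {i} {x} {y} ¬Jx Jy | h , 2h | inj₁ (k , hy≡kx) | yes (divides d k≡dp) = d , (begin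
        y ≡⟨ 2h y ⟨
        h ⋆ 2 ⋆ y ≡⟨ ⋆-swap h 2 y ⟩
        2 ⋆ h ⋆ y ≡⟨ cong (2 ⋆_) hy≡kx ⟩
        2 ⋆ k ⋆ x ≡⟨ ⋆-assoc 2 k x ⟩
        (2 ℕ.* k) ⋆ x ≡⟨ cong (_⋆ x) (trans (cong (2 ℕ.*_) k≡dp) (rearrange d p)) ⟩
        (p ℕ.* (2 ℕ.* d)) ⋆ x ∎)
        where
        open ≡-Reasoning
        open +-*-Solver using (_:=_; con; _:*_)
        rearrange : ∀ d p → 2 ℕ.* (d ℕ.* p) ≡ p ℕ.* (2 ℕ.* d)
        rearrange = +-*-Solver.solve 2 (λ d p → con 2 :* (d :* p) := p :* (con 2 :* d)) refl

    module InvariantCosets (R : C → C → Set)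
      (R-refl : ∀ {x} → R x x) (R-sym : ∀ {x y} → R x y → R y x) (R-trans : ∀ {x y z} → R x y → R y z → R x z)
      (R-⋆ : ∀ d {x y} → R x y → R (suc (p ℕ.* (2 ℕ.* d)) ⋆ x) (suc (p ℕ.* (2 ℕ.* d)) ⋆ y)) where

      R-^⋆ : ∀ d n {x y} → R x y → let k = suc (p ℕ.* (2 ℕ.* d)) in R ((k ℕ.^ n) ⋆ x) ((k ℕ.^ n) ⋆ y)
      R-^⋆ d zero r = subst₂ R (sym (×-homo-1 _)) (sym (×-homo-1 _)) r
      R-^⋆ d (suc n) {x} {y} r = let k = suc (p ℕ.* (2 ℕ.* d)) in
        subst₂ R (⋆-assoc k (k ℕ.^ n) x) (⋆-assoc k (k ℕ.^ n) y) (R-⋆ d (R-^⋆ d n r))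

      R-orbit : ∀ d n {x} → let k = suc (p ℕ.* (2 ℕ.* d)) in R x (k ⋆ x) → R x ((k ℕ.^ n) ⋆ x)
      R-orbit d zero r = subst (R _) (sym (×-homo-1 _)) R-refl
      R-orbit d (suc n) {x} r = let k = suc (p ℕ.* (2 ℕ.* d)) in
        R-trans r (subst (R (k ⋆ x)) (⋆-assoc k (k ℕ.^ n) x) (R-⋆ d (R-orbit d n r)))

      -- The units 1 + p ℤ_p form a procyclic group, so the orbit of 1 + c contains
      -- every 1 + n c; this is proved one power of p at a time.
      coset : ∀ a x d → J a ((p ℕ.* (2 ℕ.* d)) ⋆ x) → R x (suc (p ℕ.* (2 ℕ.* d)) ⋆ x) →
        ∀ n → R x ((1 ℕ.+ n ℕ.* (p ℕ.* (2 ℕ.* d))) ⋆ x)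
      coset zero x d Jcx r n = subst (R x) (sym (begin
        x + ((n ℕ.* c) ⋆ x) ≡⟨ cong (x +_) (⋆-assoc n c x) ⟨
        x + (n ⋆ c ⋆ x) ≡⟨ cong (λ y → x + (n ⋆ y)) (J-0 Jcx) ⟩
        x + (n ⋆ 0#) ≡⟨ cong (x +_) (⋆-zero n) ⟩
        x + 0# ≡⟨ identityʳ x ⟩
        x ∎)) R-refl
        where
        open ≡-Reasoning
        c = p ℕ.* (2 ℕ.* d)
      coset (suc a) x d Jcx r n = R-trans (R-orbit d n r) (subst (R xₙ) reached (coset a xₙ d′ Jc′xₙ r′ n′))
        where
        open ≡-Reasoning
        open +-*-Solver using (_:=_; con; _:*_) renaming (solve to ℕ-solve; _:+_ to _⊹_)
        c k K : ℕ
        c = p ℕ.* (2 ℕ.* d)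
        k = suc c
        K = k ℕ.^ n
        xₙ = K ⋆ x
        step = [1+c]^p (proj₁ p-odd) (proj₂ p-odd) (2 ℕ.* d)
        w = proj₁ step
        -- Chosen so that k^p = 1 + p (2 d′) has again the shape of a permitted multiplier.
        d′ = d ℕ.* (p ℕ.* (1 ℕ.+ c ℕ.* w))
        c′ : ℕ
        c′ = p ℕ.* (2 ℕ.* d′)
        c′≡ : c′ ≡ p ℕ.* c ℕ.* (1 ℕ.+ c ℕ.* w)
        c′≡ = ℕ-solve 3 (λ p d v → p :* (con 2 :* (d :* (p :* v))) := p :* (p :* (con 2 :* d)) :* v) refl p d (1 ℕ.+ c ℕ.* w)
        k^p≡ : k ℕ.^ p ≡ suc c′
        k^p≡ = trans (proj₂ step) (cong suc (sym c′≡))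
        Jc′xₙ : J a (c′ ⋆ xₙ)
        Jc′xₙ = subst (J a) (trans (⋆-assoc ((1 ℕ.+ c ℕ.* w) ℕ.* K) p (c ⋆ x))
                  (trans (⋆-assoc ((1 ℕ.+ c ℕ.* w) ℕ.* K ℕ.* p) c x) (trans (cong (_⋆ x) (trans
                    (ℕ-solve 4 (λ v K p c → v :* K :* p :* c := p :* c :* v :* K) refl (1 ℕ.+ c ℕ.* w) K p c)
                    (cong (ℕ._* K) (sym c′≡)))) (sym (⋆-assoc c′ K x)))))
                  (J-⋆ ((1 ℕ.+ c ℕ.* w) ℕ.* K) (J-p⋆ Jcx))
        r′ : R xₙ (suc c′ ⋆ xₙ)
        r′ = subst (R xₙ) (⋆-swap K (suc c′) x)
               (R-^⋆ d n (subst (λ j → R x (j ⋆ x)) k^p≡ (R-orbit d p r)))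
        U : ℕ
        U = (1 ℕ.+ c ℕ.* w) ℕ.* K
        p∤U : p ∤ U
        p∤U = p∤* (subst (λ z → p ∤ suc z) (sym (*-assoc p (2 ℕ.* d) w)) (p∤1+p* (2 ℕ.* d ℕ.* w)))
                  (p∤^ n (p∤1+p* (2 ℕ.* d)))
        inv = inverse-mod (coprime-^ pr p∤U e)
        V = proj₁ inv
        l = proj₁ (proj₂ inv)
        l′ = proj₁ (proj₂ (proj₂ inv))
        VU≡ : V ℕ.* U ℕ.+ l ℕ.* m ≡ 1 ℕ.+ l′ ℕ.* m
        VU≡ = proj₂ (proj₂ (proj₂ inv))
        quadratic = [1+c]^n n c
        g = proj₁ quadratic
        instance
          m≢0 : ℕ.NonZero m
          m≢0 = m^n≢0 p e {{prime⇒nonZero pr}}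
        -- K = 1 + n c + c² g exceeds the target by c² g. Since c′ K = p c U, the factor 1 + n′ c′
        -- cancels this excess modulo m as soon as n′ U is -2 d g. Here `V` inverts `U`, and pred m
        -- serves as -1.
        s rest : ℕ
        s = (ℕ.pred m) ℕ.* (2 ℕ.* d ℕ.* g)
        n′ = V ℕ.* s
        rest = (ℕ.pred m) ℕ.* (c ℕ.* c ℕ.* g)
        key : (1 ℕ.+ n′ ℕ.* c′) ℕ.* K ℕ.+ (rest ℕ.* l) ℕ.* m ≡ (1 ℕ.+ n ℕ.* c) ℕ.+ (c ℕ.* c ℕ.* g ℕ.+ rest ℕ.* l′) ℕ.* m
        key = begin
          (1 ℕ.+ n′ ℕ.* c′) ℕ.* K ℕ.+ (rest ℕ.* l) ℕ.* m
            ≡⟨ cong (λ z → (1 ℕ.+ n′ ℕ.* z) ℕ.* K ℕ.+ (rest ℕ.* l) ℕ.* m) c′≡ ⟩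
          (1 ℕ.+ n′ ℕ.* (p ℕ.* c ℕ.* v)) ℕ.* K ℕ.+ (rest ℕ.* l) ℕ.* m
            ≡⟨ ℕ-solve 10 (λ p d v K V m-1 g l m w → let c = p :* (con 2 :* d) ; rest = m-1 :* (c :* c :* g) in
                 (con 1 ⊹ V :* (m-1 :* (con 2 :* d :* g)) :* (p :* c :* v)) :* K ⊹ rest :* l :* m
                 := K ⊹ rest :* (V :* (v :* K) ⊹ l :* m)) refl p d v K V (ℕ.pred m) g l m w ⟩
          K ℕ.+ rest ℕ.* (V ℕ.* U ℕ.+ l ℕ.* m)
            ≡⟨ cong₂ (λ a b → a ℕ.+ rest ℕ.* b) (proj₂ quadratic) VU≡ ⟩
          1 ℕ.+ n ℕ.* c ℕ.+ c ℕ.* c ℕ.* g ℕ.+ rest ℕ.* (1 ℕ.+ l′ ℕ.* m)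
            ≡⟨ ℕ-solve 6 (λ n c g m-1 l′ m → let rest = m-1 :* (c :* c :* g) in
                 con 1 ⊹ n :* c ⊹ c :* c :* g ⊹ rest :* (con 1 ⊹ l′ :* m)
                 := (con 1 ⊹ n :* c) ⊹ (c :* c :* g :* (con 1 ⊹ m-1) ⊹ rest :* l′ :* m)) refl n c g (ℕ.pred m) l′ m ⟩
          (1 ℕ.+ n ℕ.* c) ℕ.+ (c ℕ.* c ℕ.* g ℕ.* (1 ℕ.+ ℕ.pred m) ℕ.+ rest ℕ.* l′ ℕ.* m)
            ≡⟨ cong (λ z → (1 ℕ.+ n ℕ.* c) ℕ.+ (c ℕ.* c ℕ.* g ℕ.* z ℕ.+ rest ℕ.* l′ ℕ.* m)) (suc-pred m) ⟩
          (1 ℕ.+ n ℕ.* c) ℕ.+ (c ℕ.* c ℕ.* g ℕ.* m ℕ.+ rest ℕ.* l′ ℕ.* m)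
            ≡⟨ cong ((1 ℕ.+ n ℕ.* c) ℕ.+_) (*-distribʳ-+ m (c ℕ.* c ℕ.* g) (rest ℕ.* l′)) ⟨
          (1 ℕ.+ n ℕ.* c) ℕ.+ (c ℕ.* c ℕ.* g ℕ.+ rest ℕ.* l′) ℕ.* m ∎
          where
          v : ℕ
          v = 1 ℕ.+ c ℕ.* w
        reached : (1 ℕ.+ n′ ℕ.* c′) ⋆ xₙ ≡ (1 ℕ.+ n ℕ.* c) ⋆ x
        reached = trans (⋆-assoc (1 ℕ.+ n′ ℕ.* c′) K x) (⋆-mod (rest ℕ.* l) (c ℕ.* c ℕ.* g ℕ.+ rest ℕ.* l′) x key)

-- The double cover as a Cayley graph, with its orbit relation.

module DoubleCover {C : Set} {_+_ : C → C → C} {0# : C} { -_ : C → C}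
  (isAbelianGroup : IsAbelianGroup _≡_ _+_ 0# -_) {N} (enum : Fin N ↔ C)
  (S : Bool → C → Bool) where

  open IsAbelianGroup isAbelianGroup using (assoc; comm; identityˡ; identityʳ; inverseˡ; inverseʳ)

  -- (x , τ , ℓ) is the vertex x + τ b of ℤ_m × ⟨b⟩ in layer ℓ of the double cover;
  -- S false and S true are S₀ = S ∩ H₀ and S₁ = S b ∩ H₀.
  G : Set
  G = C × Bool × Bool

  infixl 6 _⊹_ _⊟_
  infix 8 ⊖_

  _⊹_ : G → G → G
  (x , τ , ℓ) ⊹ (x′ , τ′ , ℓ′) = x + x′ , τ xor τ′ , ℓ xor ℓ′

  𝟘 : G
  𝟘 = 0# , false , false

  ⊖_ : G → G
  ⊖ (x , v) = (- x) , v

  opaque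
    triple : ∀ {x y : C} {τ τ′ ℓ ℓ′ : Bool} → x ≡ y → τ ≡ τ′ → ℓ ≡ ℓ′ → (x , τ , ℓ) ≡ (y , τ′ , ℓ′)
    triple refl refl refl = refl

  opaque
    ⊹-isAbelianGroup : IsAbelianGroup _≡_ _⊹_ 𝟘 ⊖_
    ⊹-isAbelianGroup = record
      { isGroup = record
        { isMonoid = record
          { isSemigroup = record
            { isMagma = record { isEquivalence = isEquivalence ; ∙-cong = cong₂ _⊹_ }
            ; assoc = λ (x , τ , ℓ) (x′ , τ′ , ℓ′) (x″ , τ″ , ℓ″) →
                triple (assoc x x′ x″) (xor-assoc τ τ′ τ″) (xor-assoc ℓ ℓ′ ℓ″) }
          ; identity = (λ (x , _) → triple (identityˡ x) refl refl)
                     , (λ (x , τ , ℓ) → triple (identityʳ x) (xor-identityʳ τ) (xor-identityʳ ℓ)) }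
        ; inverse = (λ (x , τ , ℓ) → triple (inverseˡ x) (xor-same τ) (xor-same ℓ))
                  , (λ (x , τ , ℓ) → triple (inverseʳ x) (xor-same τ) (xor-same ℓ))
        ; ⁻¹-cong = cong ⊖_ }
      ; comm = λ (x , τ , ℓ) (x′ , τ′ , ℓ′) → triple (comm x x′) (xor-comm τ τ′) (xor-comm ℓ ℓ′) }
      where open import Data.Bool.Properties using (xor-assoc; xor-comm; xor-identityʳ; xor-same)

  opaque
    enumG : Fin (N ℕ.* (2 ℕ.* 2)) ↔ G
    enumG = ↔-trans *↔× (enum ×-↔ ↔-trans *↔× (2↔Bool ×-↔ 2↔Bool))
      where
      open import Data.Fin.Properties using (*↔×; 2↔Bool)
      open import Data.Product.Function.NonDependent.Propositional using (_×-↔_)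
      open import Function.Construct.Composition using (_↔-∘_)
      ↔-trans : ∀ {A B C : Set} → A ↔ B → B ↔ C → A ↔ C
      ↔-trans f g = g ↔-∘ f

  open IsAbelianGroup ⊹-isAbelianGroup public using () renaming (assoc to ⊹-assoc)
  open GroupWalks ⊹-isAbelianGroup enumG public
    using (Permutes; Preserves; scale; scale-intro; scale-elim; InjectiveOn; scale-preserved; boolean-ext; module Multiplier;
           count; count-def; count-preserved; ∑; ∑-cong; ∑-+; ∑-single; ∑-zero; pick; δ; δ-true; δ-false; does-true; true≢false)
  open Multiples ⊹-isAbelianGroup public using ()
    renaming (_⋆_ to infixr 8 _⋆ᴳ_; ×-homo-+ to ⋆ᴳ-homo-+; ×-homo-1 to ⋆ᴳ-homo-1; ⋆-assoc to ⋆ᴳ-assoc;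
              ⋆-zero to ⋆ᴳ-zero; ⋆-modulo to ⋆ᴳ-modulo; ×-distrib-+ to ⋆ᴳ-distrib;
              solve to solveᴳ; _⊜_ to _⊜ᴳ_; _:+_ to _∔_; _:-_ to _∸_; :-_ to ∸_; :0 to ∅)
  open Multiples isAbelianGroup public
  open Finite enumG public using () renaming (_≟_ to _≟ᴳ_; ∃? to ∃ᴳ?; ∀? to ∀ᴳ?; ∃?-function to ∃ᴳ?-function)
  open Finite enum public using (_≟_; ∃?; ∀?)

  _⊟_ : G → G → G
  z ⊟ w = z ⊹ (⊖ w)

  part : G → C
  part = proj₁

  twist layer : G → Bool
  twist (_ , τ , _) = τ
  layer (_ , _ , ℓ) = ℓ

  adj : G → Bool
  adj (x , τ , true) = S τ x
  adj (x , τ , false) = false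

  record Automorphism : Set where
    no-eta-equality
    field
      fun inv  : G → G
      fun-inv : ∀ x → fun (inv x) ≡ x
      inv-fun : ∀ x → inv (fun x) ≡ x
      adj-pres : ∀ x y → adj (fun y ⊟ fun x) ≡ adj (y ⊟ x)

    permutes : Permutes fun inv
    permutes = record { inverseˡ = fun-inv ; inverseʳ = inv-fun }
  open Automorphism public

  identity : Automorphism
  identity = record { fun = λ x → x ; inv = λ x → x ; fun-inv = λ _ → refl ; inv-fun = λ _ → refl ; adj-pres = λ _ _ → refl }

  inverse : Automorphism → Automorphism
  inverse f = record
    { fun = inv f ; inv = fun f ; fun-inv = inv-fun f ; inv-fun = fun-inv f
    ; adj-pres = λ x y → trans (sym (adj-pres f (inv f x) (inv f y)))
                           (cong₂ (λ a b → adj (a ⊟ b)) (fun-inv f y) (fun-inv f x)) }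

  infixr 9 _∘ᴬ_
  _∘ᴬ_ : Automorphism → Automorphism → Automorphism
  f ∘ᴬ g = record
    { fun = fun f ∘ fun g ; inv = inv g ∘ inv f
    ; fun-inv = λ x → trans (cong (fun f) (fun-inv g _)) (fun-inv f x)
    ; inv-fun = λ x → trans (cong (inv g) (inv-fun f _)) (inv-fun g x)
    ; adj-pres = λ x y → trans (adj-pres f _ _) (adj-pres g x y) }

  translation : G → Automorphism
  translation a = record
    { fun = λ x → x ⊹ a ; inv = λ x → x ⊟ a
    ; fun-inv = λ x → solveᴳ 2 (λ x a → (x ∸ a) ∔ a ⊜ᴳ x) refl x a
    ; inv-fun = λ x → solveᴳ 2 (λ x a → (x ∔ a) ∸ a ⊜ᴳ x) refl x a
    ; adj-pres = λ x y → cong adj (solveᴳ 3 (λ x y a → (y ∔ a) ∸ (x ∔ a) ⊜ᴳ y ∸ x) refl x y a) }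

  infix 4 _≈_
  -- The classes are the orbits of the stabiliser of 0. An arbitrary base point is allowed because
  -- translations are automorphisms, so none has to be normalised.
  record _≈_ (z w : G) : Set where
    no-eta-equality
    pattern
    constructor related
    field
      aut   : Automorphism
      base  : G
      moved : fun aut (base ⊹ z) ≡ fun aut base ⊹ w

  opaque
    difference : ∀ {x y z} → x ≡ y ⊹ z → z ≡ x ⊟ y
    difference {x} {y} {z} e = trans (solveᴳ 2 (λ y z → z ⊜ᴳ (y ∔ z) ∸ y) refl y z) (cong (_⊟ y) (sym e))

  move : Automorphism → G → G → G
  move f x z = fun f (x ⊹ z) ⊟ fun f x

  opaque
    move-spec : ∀ f x z → fun f (x ⊹ z) ≡ fun f x ⊹ move f x z
    move-spec f x z = solveᴳ 2 (λ a b → a ⊜ᴳ b ∔ (a ∸ b)) refl (fun f (x ⊹ z)) (fun f x)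

  opaque
    ≈-move : ∀ f x z → z ≈ move f x z
    ≈-move f x z = related f x (move-spec f x z)

  opaque
    ≈-difference : ∀ f x y → y ⊟ x ≈ fun f y ⊟ fun f x
    ≈-difference f x y = subst (λ y′ → y ⊟ x ≈ fun f y′ ⊟ fun f x)
      (solveᴳ 2 (λ x y → x ∔ (y ∸ x) ⊜ᴳ y) refl x y) (≈-move f x (y ⊟ x))

  opaque
    ≈-refl : ∀ {z} → z ≈ z
    ≈-refl = related identity 𝟘 refl

  ≈-reflexive : ∀ {z w} → z ≡ w → z ≈ w
  ≈-reflexive refl = ≈-refl

  opaque
    ≈-sym : ∀ {z w} → z ≈ w → w ≈ z
    ≈-sym {z} {w} (related f x e) = related (inverse f) (fun f x)
      (trans (cong (inv f) (sym e)) (trans (inv-fun f _) (cong (_⊹ z) (sym (inv-fun f x)))))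

  opaque
    ≈-trans : ∀ {z w v} → z ≈ w → w ≈ v → z ≈ v
    ≈-trans {z} {w} {v} (related f x e) (related g y e′) = related (g ∘ᴬ translation a ∘ᴬ f) x (begin
      fun g (fun f (x ⊹ z) ⊹ a) ≡⟨ cong (λ t → fun g (t ⊹ a)) e ⟩
      fun g (fun f x ⊹ w ⊹ a) ≡⟨ cong (fun g) (solveᴳ 3 (λ fx w y → (fx ∔ w) ∔ (y ∸ fx) ⊜ᴳ y ∔ w) refl (fun f x) w y) ⟩
      fun g (y ⊹ w) ≡⟨ e′ ⟩
      fun g y ⊹ v ≡⟨ cong (λ t → fun g t ⊹ v) (solveᴳ 2 (λ fx y → y ⊜ᴳ fx ∔ (y ∸ fx)) refl (fun f x) y) ⟩
      fun g (fun f x ⊹ a) ⊹ v ∎)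
      where
      open ≡-Reasoning
      a : G
      a = y ⊟ fun f x

  opaque
    -- One automorphism moves the displacement z₁ seen from x and then z₂ seen from x + z₁. This is
    -- the orbit form of the product in a Schur ring.
    ≈-split : ∀ z₁ z₂ {w} → z₁ ⊹ z₂ ≈ w → ∃₂ λ w₁ w₂ → w ≡ w₁ ⊹ w₂ × z₁ ≈ w₁ × z₂ ≈ w₂
    ≈-split z₁ z₂ {w} (related f x e) =
      move f x z₁ , move f (x ⊹ z₁) z₂ , (begin
        w ≡⟨ difference e ⟩
        fun f (x ⊹ (z₁ ⊹ z₂)) ⊟ fun f x ≡⟨ cong (λ t → fun f t ⊟ fun f x) (solveᴳ 3 (λ x a b → x ∔ (a ∔ b) ⊜ᴳ (x ∔ a) ∔ b) refl x z₁ z₂) ⟩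
        fun f (x ⊹ z₁ ⊹ z₂) ⊟ fun f x ≡⟨ solveᴳ 3 (λ a b c → a ∸ c ⊜ᴳ (b ∸ c) ∔ (a ∸ b)) refl (fun f (x ⊹ z₁ ⊹ z₂)) (fun f (x ⊹ z₁)) (fun f x) ⟩
        move f x z₁ ⊹ move f (x ⊹ z₁) z₂ ∎)
      , ≈-move f x z₁ , ≈-move f (x ⊹ z₁) z₂
      where open ≡-Reasoning

  opaque
    ≈-zero : ∀ {w} → 𝟘 ≈ w → w ≡ 𝟘
    ≈-zero {w} (related f x e) = trans (difference e) (trans (cong (λ t → fun f t ⊟ fun f x) (solveᴳ 1 (λ x → x ∔ ∅ ⊜ᴳ x) refl x))
      (solveᴳ 1 (λ a → a ∸ a ⊜ᴳ ∅) refl (fun f x)))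

  opaque
    adj-closed : ∀ {z w} → z ≈ w → adj z ≡ adj w
    adj-closed {z} {w} (related f x e) = begin
      adj z ≡⟨ cong adj (solveᴳ 2 (λ x z → z ⊜ᴳ (x ∔ z) ∸ x) refl x z) ⟩
      adj ((x ⊹ z) ⊟ x) ≡⟨ adj-pres f x (x ⊹ z) ⟨
      adj (fun f (x ⊹ z) ⊟ fun f x) ≡⟨ cong adj (difference e) ⟨
      adj w ∎
      where open ≡-Reasoning

  infix 4 _≈?_
  opaque
    -- All functions on the finite group are searched. Decidability turns orbits into Boolean sets,
    -- the form in which walks are counted.
    _≈?_ : ∀ z w → Dec (z ≈ w)
    z ≈? w = map′ found find (∃ᴳ?-function {P} P? respects)
      where
      open import Data.Bool.Properties renaming (_≟_ to _≟ᴮ_)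
      open import Relation.Nullary.Decidable using (map′; _×-dec_)
      Q : (G → G) → (G → G) → Set
      Q f g = (∀ x → f (g x) ≡ x) × (∀ x → g (f x) ≡ x)
      P : (G → G) → Set
      P f = ∃ (Q f) × (∀ x y → adj (f y ⊟ f x) ≡ adj (y ⊟ x)) × ∃ λ x → f (x ⊹ z) ≡ f x ⊹ w
      P? : ∀ f → Dec (P f)
      P? f = ∃ᴳ?-function (λ g → ∀ᴳ? (λ x → f (g x) ≟ᴳ x) ×-dec ∀ᴳ? (λ x → g (f x) ≟ᴳ x))
               (λ {g} {g′} e (l , r) → (λ x → trans (cong f (sym (e x))) (l x)) , λ x → trans (sym (e _)) (r x))
             ×-dec ∀ᴳ? (λ x → ∀ᴳ? λ y → adj (f y ⊟ f x) ≟ᴮ adj (y ⊟ x))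
             ×-dec ∃ᴳ? (λ x → f (x ⊹ z) ≟ᴳ f x ⊹ w)
      respects : ∀ {f f′} → f ≗ f′ → P f → P f′
      respects e ((g , l , r) , pres , x , eq) =
        (g , (λ x → trans (sym (e _)) (l x)) , λ x → trans (cong g (sym (e x))) (r x))
        , (λ x y → trans (cong₂ (λ a b → adj (a ⊟ b)) (sym (e y)) (sym (e x))) (pres x y))
        , x , trans (sym (e _)) (trans eq (cong (_⊹ w) (e x)))
      found : ∃ P → z ≈ w
      found (f , (g , l , r) , pres , x , eq) =
        related (record { fun = f ; inv = g ; fun-inv = l ; inv-fun = r ; adj-pres = pres }) x eq
      find : z ≈ w → ∃ P
      find (related f x eq) = fun f , (inv f , fun-inv f , inv-fun f) , adj-pres f , x , eq

  ClosedSet : (G → Bool) → Set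
  ClosedSet X = ∀ {z w} → z ≈ w → X z ≡ X w

  orbit : G → G → Bool
  orbit z w = does (z ≈? w)

  opaque
    orbit⇒≈ : ∀ {z w} → orbit z w ≡ true → z ≈ w
    orbit⇒≈ {z} {w} = does-true (z ≈? w)

  opaque
    ≈⇒orbit : ∀ {z w} → z ≈ w → orbit z w ≡ true
    ≈⇒orbit {z} {w} = dec-true (z ≈? w)
      where open import Relation.Nullary.Decidable using (dec-true)

  opaque
    orbit-closed : ∀ z → ClosedSet (orbit z)
    orbit-closed z {w} {v} w≈v with orbit z w in eq | orbit z v in eq′
    ... | true  | true  = refl
    ... | false | false = refl
    ... | true  | false = sym (trans (sym eq′) (≈⇒orbit (≈-trans (orbit⇒≈ eq) w≈v)))
    ... | false | true  = trans (sym eq) (≈⇒orbit (≈-trans (orbit⇒≈ eq′) (≈-sym w≈v)))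

  opaque
    closed⇒preserves : ∀ {X} → ClosedSet X → ∀ f → Preserves (fun f) (λ _ → ⊤) X X
    closed⇒preserves cl f = record { preserves = λ {x} y _ → cl (≈-move f x y) ; closed = λ _ _ _ → tt }

  -- Words without inverses suffice for the generated subgroup, G being finite. Their list form lets
  -- `≈-split` act letter by letter, so the span of a set closed under `≈` is closed as well.
  data Span (Q : G → Set) : G → Set where
    []  : Span Q 𝟘
    _∷_ : ∀ {q z} → Q q → Span Q z → Span Q (q ⊹ z)

  opaque
    Span-closed : ∀ {Q : G → Set} → (∀ {z w} → z ≈ w → Q z → Q w) → ∀ {z w} → z ≈ w → Span Q z → Span Q w
    Span-closed cl z≈w [] = subst (Span _) (sym (≈-zero z≈w)) []
    Span-closed cl z≈w (_∷_ {q} {z} Qq s) with ≈-split q z z≈w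
    ... | w₁ , w₂ , refl , q≈w₁ , z≈w₂ = cl q≈w₁ Qq ∷ Span-closed cl z≈w₂ s

  Span-⊆ : ∀ {Q P : G → Set} → P 𝟘 → (∀ {z w} → P z → P w → P (z ⊹ w)) → (∀ {z} → Q z → P z) → ∀ {z} → Span Q z → P z
  Span-⊆ P0 P+ Q⊆P [] = P0
  Span-⊆ P0 P+ Q⊆P (q ∷ s) = P+ (Q⊆P q) (Span-⊆ P0 P+ Q⊆P s)

  opaque
    Span-+ : ∀ {Q z w} → Span Q z → Span Q w → Span Q (z ⊹ w)
    Span-+ {Q} {w = w} [] t = subst (Span Q) (solveᴳ 1 (λ w → w ⊜ᴳ ∅ ∔ w) refl w) t
    Span-+ {Q} {w = w} (_∷_ {q} {z} Qq s) t =
      subst (Span Q) (solveᴳ 3 (λ q z w → q ∔ (z ∔ w) ⊜ᴳ (q ∔ z) ∔ w) refl q z w) (Qq ∷ Span-+ s t)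

  opaque
    Span-⋆ : ∀ {Q} n {z} → Span Q z → Span Q (n ⋆ᴳ z)
    Span-⋆ zero s = []
    Span-⋆ (suc n) s = Span-+ s (Span-⋆ n s)

  opaque
    Span-gen : ∀ {Q z} → Q z → Span Q z
    Span-gen {Q} {z} Qz = subst (Span Q) (solveᴳ 1 (λ z → z ∔ ∅ ⊜ᴳ z) refl z) (Qz ∷ [])

-- Multipliers and the parity argument for the cover.

module PrimePowerCover {C : Set} {_+_ : C → C → C} {0# : C} { -_ : C → C}
  (isAbelianGroup : IsAbelianGroup _≡_ _+_ 0# -_) {N} (enum : Fin N ↔ C) (S : Bool → C → Bool)
  {p e} (e>0 : 0 < e) (pr : Prime p) (p-odd : ∃ λ h → p ≡ suc (2 ℕ.* h))
  (torsion : ∀ x → DoubleCover._⋆_ isAbelianGroup enum S (p ℕ.^ e) x ≡ 0#)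
  (cyclic : ∀ x y → (∃ λ k → x ≡ DoubleCover._⋆_ isAbelianGroup enum S k y)
                  ⊎ (∃ λ k → y ≡ DoubleCover._⋆_ isAbelianGroup enum S k x)) where

  open DoubleCover isAbelianGroup enum S public
  open CyclicPGroup e>0 pr p-odd torsion cyclic public
  open PrimePowers using (even-or-odd; 2∤⇒odd; 2∤odd) public
  open import Data.Nat.Divisibility
  open import Data.Nat.Properties using (*-comm; *-assoc; *-suc; +-comm)

  opaque
    part-⋆ : ∀ n z → part (n ⋆ᴳ z) ≡ n ⋆ part z
    part-⋆ zero z = refl
    part-⋆ (suc n) z = cong (part z +_) (part-⋆ n z)

  opaque
    even-⋆ : ∀ h z → (2 ℕ.* h) ⋆ᴳ z ≡ ((2 ℕ.* h) ⋆ part z , false , false)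
    even-⋆ h z = trans (cong (_⋆ᴳ z) (*-comm 2 h)) (trans (go h) (cong (λ n → n ⋆ part z , false , false) (*-comm h 2)))
      where
      cancel : ∀ z → z ⊹ (z ⊹ 𝟘) ≡ (2 ⋆ part z , false , false)
      cancel (x , false , false) = refl
      cancel (x , false , true) = refl
      cancel (x , true , false) = refl
      cancel (x , true , true) = refl
      go : ∀ h → (h ℕ.* 2) ⋆ᴳ z ≡ ((h ℕ.* 2) ⋆ part z , false , false)
      go zero = refl
      go (suc h) = trans (cong (λ w → z ⊹ (z ⊹ w)) (go h))
        (trans (solveᴳ 2 (λ z w → z ∔ (z ∔ w) ⊜ᴳ (z ∔ (z ∔ ∅)) ∔ w) refl z _)
        (trans (cong (_⊹ ((h ℕ.* 2) ⋆ part z , false , false)) (cancel z))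
               (triple (solve 2 (λ x y → (x :+ (x :+ :0)) :+ y ⊜ x :+ (x :+ y)) refl (part z) _) refl refl)))

  opaque
    odd-⋆ : ∀ {k} h → k ≡ suc (2 ℕ.* h) → ∀ z → k ⋆ᴳ z ≡ (k ⋆ part z , proj₂ z)
    odd-⋆ h refl z@(x , τ , ℓ) = trans (cong (z ⊹_) (even-⋆ h z)) (triple refl (xor-identityʳ τ) (xor-identityʳ ℓ))
      where open import Data.Bool.Properties using (xor-identityʳ)

  opaque
    torsionᴳ : ∀ z → (2 ℕ.* m) ⋆ᴳ z ≡ 𝟘
    torsionᴳ z = trans (even-⋆ m z) (cong (λ x → x , false , false)
      (trans (sym (⋆-assoc 2 m (part z))) (trans (cong (2 ⋆_) (torsion (part z))) (⋆-zero 2))))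

  Unit : ℕ → Set
  Unit k = 2 ∤ k × p ∤ k

  opaque
    Unit-⋆ : ∀ {k} → Unit k → ∀ z → k ⋆ᴳ z ≡ (k ⋆ part z , proj₂ z)
    Unit-⋆ (2∤k , _) = let (h , k≡) = 2∤⇒odd 2∤k in odd-⋆ h k≡

  opaque
    Unit-inverse : ∀ {k} → Unit k → ∃ λ k′ → Unit k′ × ∀ z → k′ ⋆ᴳ k ⋆ᴳ z ≡ z
    Unit-inverse {k} (2∤k , p∤k) with PrimePowers.inverse-mod coprime
      where
      open import Data.Nat.Coprimality using (Coprime; coprime-divisor)
      open import Data.Nat.Primality using (prime[2])
      open PrimePowers
      coprime : Coprime k (2 ℕ.* m)
      coprime {d} (d∣k , d∣2m) = coprime-^ pr p∤k e (d∣k , coprime-divisor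
        (λ (c∣d , c∣2) → coprime-^ prime[2] 2∤k 1 (∣-trans c∣d d∣k , c∣2)) d∣2m)
    ... | k′ , l , l′ , eq = k′ , (∤k′ 1≢2 (m∣m*n m) , ∤k′ (p≢1 ∘ sym) (∣-trans p∣m (n∣m*n 2)))
      , λ z → trans (⋆ᴳ-assoc k′ k z) (trans (⋆ᴳ-modulo l l′ (torsionᴳ z) eq) (⋆ᴳ-homo-1 z))
      where
      1≢2 : 1 ≢ 2
      1≢2 ()
      ∤k′ : ∀ {d} → 1 ≢ d → d ∣ 2 ℕ.* m → d ∤ k′
      ∤k′ {d} 1≢d d∣2m d∣k′ = 1≢d (sym (∣1⇒≡1 (∣m+n∣m⇒∣n
        (subst (d ∣_) (trans eq (+-comm 1 (l′ ℕ.* (2 ℕ.* m)))) (∣m∣n⇒∣m+n (∣m⇒∣m*n k d∣k′) (∣n⇒∣m*n l d∣2m)))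
        (∣n⇒∣m*n l′ d∣2m))))

  opaque
    Unit-injective : ∀ {k} → Unit k → ∀ {y z} → k ⋆ᴳ y ≡ k ⋆ᴳ z → y ≡ z
    Unit-injective u {y} {z} e with Unit-inverse u
    ... | k′ , _ , k′k = trans (sym (k′k y)) (trans (cong (k′ ⋆ᴳ_) e) (k′k z))

  opaque
    -- Scaling the orbit of z by `k` gives a set that every automorphism preserves; it contains k z
    -- and hence also y.
    Unit-product : ∀ {k} → Unit k → ∀ z {y} → k ⋆ᴳ z ≈ y → ∃ λ x → z ≈ x × y ≡ k ⋆ᴳ x
    Unit-product {zero} (2∤0 , _) = ⊥-elim (2∤0 (2 ∣0))
    Unit-product {k@(suc _)} u z {y} (related f x moved) with scale-elim k (orbit z) y reached
      where
      open Multiplier Unit (λ _ → ⊤)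
        (λ {k} {l} (2∤ , p∤) → ((λ 2∣k → 2∤ (∣m⇒∣m*n l 2∣k)) , λ p∣k → p∤ (∣m⇒∣m*n l p∣k))
                             , ((λ 2∣l → 2∤ (∣n⇒∣m*n k 2∣l)) , λ p∣l → p∤ (∣n⇒∣m*n k p∣l)))
        (λ u _ _ _ → Unit-injective u) (λ _ _ → tt) (permutes f) {λ _ → ⊤}
      reached : scale k (orbit z) y ≡ true
      reached = begin
        scale k (orbit z) y ≡⟨ cong (scale k (orbit z)) (difference moved) ⟩
        scale k (orbit z) (fun f (x ⊹ k ⋆ᴳ z) ⊟ fun f x) ≡⟨ Preserves.preserves (scale-multiplier k u tt tt (closed⇒preserves (orbit-closed z) f)) (k ⋆ᴳ z) tt ⟨
        scale k (orbit z) (k ⋆ᴳ z) ≡⟨ scale-intro k (orbit z) (≈⇒orbit ≈-refl) ⟩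
        true ∎
        where open ≡-Reasoning
    ... | w , z≈w , kw≡y = w , orbit⇒≈ z≈w , sym kw≡y

  -- Schur's theorem on multipliers.
  opaque
    Unit-≈ : ∀ {k z w} → Unit k → z ≈ w → k ⋆ᴳ z ≈ k ⋆ᴳ w
    Unit-≈ {k} {z} {w} u z≈w with Unit-inverse u
    -- Used for the inverse multiplier: k′ (k z) = z ≈ w yields an x with k z ≈ x and w = k′ x, and
    -- this x is k w.
    ... | k′ , u′ , k′k with Unit-product u′ (k ⋆ᴳ z) (≈-trans (≈-reflexive (k′k z)) z≈w)
    ...   | x , kz≈x , w≡ = ≈-trans kz≈x (≈-reflexive (trans (sym (k′k x)) (trans (⋆ᴳ-swap k′ k x) (cong (k ⋆ᴳ_) (sym w≡)))))
      where open Multiples ⊹-isAbelianGroup using () renaming (⋆-swap to ⋆ᴳ-swap)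

  opaque
    Unit-≈′ : ∀ {k x v y w} → Unit k → (x , v) ≈ (y , w) → (k ⋆ x , v) ≈ (k ⋆ y , w)
    Unit-≈′ {k} u r = subst₂ _≈_ (Unit-⋆ u _) (Unit-⋆ u _) (Unit-≈ u r)

  opaque
    Unit-1+2p : ∀ d → Unit (suc (p ℕ.* (2 ℕ.* d)))
    Unit-1+2p d = subst (λ n → 2 ∤ suc n) (trans (sym (*-assoc 2 p d)) (trans (cong (ℕ._* d) (*-comm 2 p)) (*-assoc p 2 d))) (2∤odd (p ℕ.* d))
                , p∤1+p* (2 ℕ.* d)

  opaque
    -- As x lies outside `J i`, the element j is p (2 d) x for some d. So x + j is the image of x
    -- under a multiplier that fixes the bits v, and `coset` spreads the relation over all multiples
    -- of j.
    coset-⋆ : ∀ {i x j v} → ¬ J i x → J i j → (x , v) ≈ (x + j , v) → ∀ n → (x , v) ≈ (x + (n ⋆ j) , v)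
    coset-⋆ {i} {x} {j} {v} ¬Jx Jj r n with proper-multiple ¬Jx Jj
    ... | d , refl = ≈-trans (coset e x d (torsion-by (torsion _)) r n) (≈-reflexive (cong (λ y → x + y , v) (sym (⋆-assoc n c x))))
      where
      c : ℕ
      c = p ℕ.* (2 ℕ.* d)
      open InvariantCosets (λ x y → (x , v) ≈ (y , v)) ≈-refl ≈-sym ≈-trans (λ d → Unit-≈′ (Unit-1+2p d))

  opaque
    2⋆-injective : ∀ {x y} → 2 ⋆ x ≡ 2 ⋆ y → x ≡ y
    2⋆-injective {x} {y} e with unit p∤2
    ... | h , h2 = trans (sym (h2 x)) (trans (cong (h ⋆_) e) (h2 y))

  private
    bits : Bool → Bool → ℕ
    bits a b = pick a 1 ℕ.+ pick b 1

  opaque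
    -- Doubling forgets both bits and is injective on C, so 2 c has just two halves in a given
    -- layer.
    count-2 : ∀ X ℓ → (∀ {z} → X z ≡ true → layer z ≡ ℓ) → ∀ c →
      count X 2 (2 ⋆ c , false , false) ≡ bits (X (c , false , ℓ)) (X (c , true , ℓ))
    count-2 X ℓ in-layer c = begin
      count X 2 w ≡⟨ trans (count-def X 2 w) (∑-cong split) ⟩
      ∑ (λ z → at false z ℕ.+ at true z) ≡⟨ ∑-+ (at false) (at true) ⟩
      ∑ (at false) ℕ.+ ∑ (at true) ≡⟨ cong₂ ℕ._+_ (∑-at false) (∑-at true) ⟩
      bits (X (c , false , ℓ)) (X (c , true , ℓ)) ∎
      where
      open ≡-Reasoning
      w : G
      w = (2 ⋆ c , false , false)
      φ : G → ℕ
      φ z = pick (X z) (δ ((2 ⋆ᴳ z) ≟ᴳ w))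
      at : Bool → G → ℕ
      at τ z = pick (X z) (δ (z ≟ᴳ (c , τ , ℓ)))
      ∑-at : ∀ τ → ∑ (at τ) ≡ pick (X (c , τ , ℓ)) 1
      ∑-at τ = trans (∑-single (c , τ , ℓ) zeroes) (cong (pick (X (c , τ , ℓ))) (δ-true ((c , τ , ℓ) ≟ᴳ (c , τ , ℓ)) refl))
        where
        zeroes : ∀ z → z ≢ (c , τ , ℓ) → at τ z ≡ 0
        zeroes z z≢ with X z
        ... | true = δ-false (z ≟ᴳ (c , τ , ℓ)) z≢
        ... | false = refl
      split : ∀ z → φ z ≡ at false z ℕ.+ at true z
      split z@(x , τ , ℓ′) with X z in Xz
      ... | false = refl
      ... | true with x ≟ c | in-layer Xz
      ...   | no x≢c | refl = trans (δ-false ((2 ⋆ᴳ z) ≟ᴳ w) (λ e → x≢c (2⋆-injective (cong part (trans (sym (even-⋆ 1 z)) e)))))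
                (sym (cong₂ ℕ._+_ (δ-false (z ≟ᴳ (c , false , ℓ)) (x≢c ∘ cong part)) (δ-false (z ≟ᴳ (c , true , ℓ)) (x≢c ∘ cong part))))
      ...   | yes refl | refl = trans (δ-true ((2 ⋆ᴳ z) ≟ᴳ w) (even-⋆ 1 z)) (sym (one τ))
        where
        one : ∀ τ → δ ((x , τ , ℓ) ≟ᴳ (x , false , ℓ)) ℕ.+ δ ((x , τ , ℓ) ≟ᴳ (x , true , ℓ)) ≡ 1
        one false = cong₂ ℕ._+_ (δ-true (_ ≟ᴳ (x , false , ℓ)) refl) (δ-false ((x , false , ℓ) ≟ᴳ _) (λ ()))
        one true = cong₂ ℕ._+_ (δ-false ((x , true , ℓ) ≟ᴳ _) (λ ())) (δ-true (_ ≟ᴳ (x , true , ℓ)) refl)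

  opaque
    1+even≢even : ∀ {a b} → 1 ℕ.+ 2 ℕ.* a ≢ 2 ℕ.* b
    1+even≢even {a} {b} e = 2∤odd a (subst (2 ∣_) (sym e) (m∣m*n b))

  -- Two walks of length two differing by the order of their steps cancel modulo 2.
  opaque
    squares : ∀ {X ℓ} → ClosedSet X → (∀ {z} → X z ≡ true → layer z ≡ ℓ) → ∀ {c y} →
      X (c , false , ℓ) ≢ X (c , true , ℓ) → (2 ⋆ c , false , false) ≈ y →
      ∃ λ c′ → y ≡ (2 ⋆ c′ , false , false) × X (c′ , false , ℓ) ≢ X (c′ , true , ℓ)
    squares {X} {ℓ} cl in-layer {c} {y} differ (related f x moved) = found
      where
      open import Data.Nat.Primality using (prime[2])
      import Data.Bool.Properties as Boolₚ
      open import Relation.Nullary.Decidable using (_×-dec_)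
      w : G
      w = (2 ⋆ c , false , false)
      congruence : ∃₂ λ a b → bits (X (c , false , ℓ)) (X (c , true , ℓ)) ℕ.+ 2 ℕ.* a ≡ count X 2 y ℕ.+ 2 ℕ.* b
      congruence with count-preserved (permutes f) (closed⇒preserves cl f) prime[2] {x} tt w
      ... | a , b , eq = a , b , trans (cong (ℕ._+ 2 ℕ.* a) (sym (count-2 X ℓ in-layer c)))
            (trans eq (cong (λ v → count X 2 v ℕ.+ 2 ℕ.* b) (sym (difference moved))))
      odd-bits : ∀ {a b} → a ≢ b → bits a b ≡ 1
      odd-bits {true} {true} a≢b = ⊥-elim (a≢b refl)
      odd-bits {true} {false} _ = refl
      odd-bits {false} {true} _ = refl
      odd-bits {false} {false} a≢b = ⊥-elim (a≢b refl)
      odd⇒≢ : ∀ {a b c d} → 1 ℕ.+ 2 ℕ.* c ≡ bits a b ℕ.+ 2 ℕ.* d → a ≢ b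
      odd⇒≢ {true} {c = c} {d} e refl = 1+even≢even {c} {suc d} (trans e (sym (*-suc 2 d)))
      odd⇒≢ {false} {c = c} {d} e refl = 1+even≢even {c} {d} e
      odd-count : ∃₂ λ a b → 1 ℕ.+ 2 ℕ.* a ≡ count X 2 y ℕ.+ 2 ℕ.* b
      odd-count with congruence
      ... | a , b , eq = a , b , trans (cong (ℕ._+ 2 ℕ.* a) (sym (odd-bits differ))) eq
      found : ∃ λ c′ → y ≡ (2 ⋆ c′ , false , false) × X (c′ , false , ℓ) ≢ X (c′ , true , ℓ)
      found with ∃ᴳ? (λ z → (X z Boolₚ.≟ true) ×-dec ((2 ⋆ᴳ z) ≟ᴳ y)) | odd-count
      ... | no ∄ | a , b , eq = ⊥-elim (1+even≢even {a} {b} (trans eq (cong (ℕ._+ 2 ℕ.* b) (trans (count-def X 2 y) (∑-zero zeroes)))))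
        where
        zeroes : ∀ z → pick (X z) (δ ((2 ⋆ᴳ z) ≟ᴳ y)) ≡ 0
        zeroes z with X z in Xz
        ... | false = refl
        ... | true = δ-false ((2 ⋆ᴳ z) ≟ᴳ y) λ 2z≡y → ∄ (z , Xz , 2z≡y)
      ... | yes (z , _ , refl) | a , b , eq = part z , even-⋆ 1 z ,
            odd⇒≢ {c = a} {d = b} (trans eq (cong (ℕ._+ 2 ℕ.* b) (trans (cong (count X 2) (even-⋆ 1 z)) (count-2 X ℓ in-layer (part z)))))

  -- The multiplier m + 2 is a unit that doubles C and fixes the 2-torsion.
  opaque
    halves : ∀ {X ℓ} → ClosedSet X → (∀ {z} → X z ≡ true → layer z ≡ ℓ) → ∀ {c y} →
      X (c , false , ℓ) ≢ X (c , true , ℓ) → (c , false , false) ≈ y →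
      ∃ λ c′ → y ≡ (c′ , false , false) × X (c′ , false , ℓ) ≢ X (c′ , true , ℓ)
    halves {X} {ℓ} cl in-layer {c} {y} differ r
      with squares cl in-layer differ (subst₂ _≈_ (double (c , false , false)) (double y) (Unit-≈ Unit-m+2 r))
      where
      Unit-m+2 : Unit (m ℕ.+ 2)
      Unit-m+2 = subst (2 ∤_) (trans (cong (λ n → suc n) (trans (*-suc 2 (proj₁ m-odd)) (cong suc (sym (proj₂ m-odd))))) (+-comm 2 m)) (2∤odd (suc (proj₁ m-odd)))
               , λ p∣ → p∤2 (∣m+n∣m⇒∣n p∣ p∣m)
      double : ∀ z → (m ℕ.+ 2) ⋆ᴳ z ≡ (2 ⋆ part z , proj₂ z)
      double z = trans (Unit-⋆ Unit-m+2 z) (cong (_, proj₂ z)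
        (trans (×-homo-+ (part z) m 2) (trans (cong (_+ (2 ⋆ part z)) (torsion (part z))) (solve 1 (λ x → :0 :+ x ⊜ x) refl _))))
    ... | c′ , e , differ′ = c′ , cong₂ _,_ (2⋆-injective (cong part e)) (cong proj₂ e) , differ′

  -- Pure elements and the orbit of u.

  module Rigidity (S-0 : S false 0# ≡ false) (spanning : ∀ z → Span (λ w → adj w ≡ true) z) where

    open import Relation.Nullary.Decidable using (map′; _×-dec_; _→-dec_; ¬?)
    import Data.Bool.Properties as Boolₚ
    open import Data.Nat.Divisibility using (_∣?_; ∣m+n∣m⇒∣n; _∤_; ∣m⇒∣m*n; ∣n⇒∣m*n)
    open IsAbelianGroup isAbelianGroup using (identityˡ; identityʳ)

    b u : G
    b = 0# , true , false
    u = 0# , false , true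

    flat : C → G
    flat x = x , false , false

    flat-⋆ : ∀ n x → n ⋆ᴳ flat x ≡ flat (n ⋆ x)
    flat-⋆ zero x = refl
    flat-⋆ (suc n) x = cong (flat x ⊹_) (flat-⋆ n x)

    opaque
      -- The layer is the parity of the length of any word in the connection set, and `≈-split`
      -- turns such a word into one of the same length.
      layer-closed : ∀ {z w} → z ≈ w → layer z ≡ layer w
      layer-closed {z} = go (spanning z)
        where
        adj⇒layer : ∀ z → adj z ≡ true → layer z ≡ true
        adj⇒layer (x , τ , true) _ = refl
        go : ∀ {z w} → Span (λ w → adj w ≡ true) z → z ≈ w → layer z ≡ layer w
        go [] 0≈w = sym (cong layer (≈-zero 0≈w))
        go (_∷_ {q} {z} adj-q s) z≈w with ≈-split q z z≈w
        ... | w₁ , w₂ , w≡ , q≈w₁ , z≈w₂ = trans (cong₂ _xor_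
              (trans (adj⇒layer q adj-q) (sym (adj⇒layer w₁ (trans (sym (adj-closed q≈w₁)) adj-q)))) (go s z≈w₂))
              (sym (cong layer w≡))

    -- The pure elements form the largest ≈-invariant subgroup contained in H₀.
    Pure : C → Set
    Pure x = ∀ w → flat x ≈ w → proj₂ w ≡ (false , false)

    ⟨_⟩≟ : (v w : Bool × Bool) → Dec (v ≡ w)
    ⟨ v ⟩≟ w = ≡-dec Boolₚ._≟_ Boolₚ._≟_ v w
      where open import Data.Product.Properties using (≡-dec)

    opaque
      Pure? : ∀ x → Dec (Pure x)
      Pure? x = ∀ᴳ? λ w → (flat x ≈? w) →-dec (⟨ proj₂ w ⟩≟ (false , false))

    Pure-flat : ∀ {x w} → Pure x → flat x ≈ w → w ≡ flat (part w)
    Pure-flat {w = w} Px r = cong (part w ,_) (Px w r)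

    Pure-≈ : ∀ {x w} → Pure x → flat x ≈ w → Pure (part w)
    Pure-≈ Px r v s = Px v (≈-trans r (subst (_≈ v) (sym (Pure-flat Px r)) s))

    Pure-0 : Pure 0#
    Pure-0 w r = cong proj₂ (≈-zero r)

    Pure-+ : ∀ {x y} → Pure x → Pure y → Pure (x + y)
    Pure-+ {x} {y} Px Py w r with ≈-split (flat x) (flat y) r
    ... | w₁ , w₂ , w≡ , x≈w₁ , y≈w₂ = trans (cong proj₂ w≡) (cong₂ (λ v v′ → (proj₁ v xor proj₁ v′) , (proj₂ v xor proj₂ v′)) (Px w₁ x≈w₁) (Py w₂ y≈w₂))

    Pure-⋆ : ∀ n {x} → Pure x → Pure (n ⋆ x)
    Pure-⋆ zero Px = Pure-0
    Pure-⋆ (suc n) Px = Pure-+ Px (Pure-⋆ n Px)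

    Pure-neg : ∀ {x} → Pure x → Pure (- x)
    Pure-neg {x} Px = subst Pure neg≡ (Pure-⋆ (2 ℕ.* proj₁ m-odd) Px)
      where
      y : C
      y = (2 ℕ.* proj₁ m-odd) ⋆ x
      neg≡ : y ≡ - x
      neg≡ = trans (solve 2 (λ x y → y ⊜ (x :+ y) :- x) refl x y)
        (trans (cong (_+ (- x)) (trans (cong (_⋆ x) (sym (proj₂ m-odd))) (torsion x)))
               (solve 1 (λ x → :0 :- x ⊜ :- x) refl x))

    opaque
      -- Otherwise the orbit of (x, false, ℓ) contains one of the two points over x and not the
      -- other; then `halves` keeps the orbit of `flat x` untwisted in layer 0, which makes x pure.
      impure-twist : ∀ {x} → ¬ Pure x → ∀ τ ℓ → (x , τ , ℓ) ≈ (x , not τ , ℓ)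
      impure-twist {x} ¬Px true ℓ = ≈-sym (impure-twist ¬Px false ℓ)
      impure-twist {x} ¬Px false ℓ with (x , false , ℓ) ≈? (x , true , ℓ)
      ... | yes r = r
      ... | no ¬r = ⊥-elim (¬Px pure)
        where
        X : G → Bool
        X = orbit (x , false , ℓ)
        differ : X (x , false , ℓ) ≢ X (x , true , ℓ)
        differ e = ¬r (orbit⇒≈ (trans (sym e) (≈⇒orbit ≈-refl)))
        pure : Pure x
        pure w r with halves (orbit-closed (x , false , ℓ)) (λ {z} Xz → sym (layer-closed (orbit⇒≈ Xz))) differ r
        ... | _ , w≡ , _ = cong proj₂ w≡

    opaque
      J? : ∀ i x → Dec (J i x)
      J? i x = map′ torsion-by J.annihilated ((p ℕ.^ i) ⋆ x ≟ 0#)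

    -- The index of the least `J i` that contains the parts of `P`. For a positive index a member of
    -- `P` is stored whose part generates that subgroup.
    data Level (P : G → Set) : ℕ → Set where
      trivial : (∀ {z} → P z → J 0 (part z)) → Level P 0
      exact   : ∀ {i} → (∀ {z} → P z → J (suc i) (part z)) → ∀ z → P z → ¬ J i (part z) → Level P (suc i)

    Level-top : ∀ {P i} → Level P i → ∀ {z} → P z → J i (part z)
    Level-top (trivial top) = top
    Level-top (exact top _ _ _) = top

    opaque
      level : ∀ {P} → (∀ z → Dec (P z)) → ∃ (Level P)
      level {P} P? = go e λ _ → torsion-by (torsion _)
        where
        go : ∀ i → (∀ {z} → P z → J i (part z)) → ∃ (Level P)
        go zero top = 0 , trivial top
        go (suc i) top with ∃ᴳ? (λ z → P? z ×-dec ¬? (J? i (part z)))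
        ... | yes (z , Pz , ¬Jz) = suc i , exact top z Pz ¬Jz
        ... | no ∄ = go i λ {z} Pz → decidable-stable (J? i (part z)) λ ¬Jz → ∄ (z , Pz , ¬Jz)
          where open import Relation.Nullary.Decidable using (decidable-stable)

    opaque
      -- The odd number m annihilates C and is divisible by p, so adding it repairs the parity of k
      -- and changes nothing else.
      make-unit : ∀ {k} → p ∤ k → ∃ λ k′ → Unit k′ × ∀ x → k′ ⋆ x ≡ k ⋆ x
      make-unit {k} p∤k with even-or-odd k
      ... | inj₂ (h , refl) = k , (2∤odd h , p∤k) , λ _ → refl
      ... | inj₁ (h , refl) = k ℕ.+ m , (subst (2 ∤_) (sym odd≡) (2∤odd (h ℕ.+ proj₁ m-odd))
            , λ p∣ → p∤k (∣m+n∣m⇒∣n (subst (p ∣_) (+-comm k m) p∣) p∣m))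
            , λ x → trans (×-homo-+ x k m) (trans (cong ((k ⋆ x) +_) (torsion x)) (identityʳ _))
        where
        open import Data.Nat.Properties using (+-comm; +-suc; *-distribˡ-+)
        odd≡ : 2 ℕ.* h ℕ.+ m ≡ suc (2 ℕ.* (h ℕ.+ proj₁ m-odd))
        odd≡ = trans (cong (2 ℕ.* h ℕ.+_) (proj₂ m-odd)) (trans (+-suc (2 ℕ.* h) _) (cong suc (sym (*-distribˡ-+ 2 h _))))

    O : G → Set
    O = u ≈_

    O-layer : ∀ {o} → O o → layer o ≡ true
    O-layer r = sym (layer-closed r)

    O-closed : ∀ {z w} → z ≈ w → O z → O w
    O-closed r s = ≈-trans s r

    adj-u : ∀ {z} → O z → adj z ≡ false
    adj-u r = trans (sym (adj-closed r)) S-0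

    module Generated {i} (lvl : Level O i) where

      private
        even+1 : suc m ≡ 2 ℕ.* suc (proj₁ m-odd)
        even+1 = trans (cong suc (proj₂ m-odd)) (sym (*-suc 2 _))
          where open import Data.Nat.Properties using (*-suc)

      -- The multiple by m + 1 erases both bits, m + 1 being even, and fixes the part in C.
      Span-flat : ∀ {Q : G → Set} {z} → Span Q z → Span Q (flat (part z))
      Span-flat {Q} {z} s = subst (Span Q) (trans (cong (_⋆ᴳ z) even+1) (trans (even-⋆ (suc (proj₁ m-odd)) z) (cong flat
        (trans (cong (_⋆ part z) (sym even+1)) (trans (cong (part z +_) (torsion (part z))) (identityʳ _)))))) (Span-⋆ (suc m) s)

      in-Span : ∀ {x} ℓ → J i x → Span O (x , false , ℓ)
      in-Span {x} true Jx = subst (Span O) (triple (identityʳ x) refl refl) (Span-+ (in-Span false Jx) (Span-gen ≈-refl))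
      in-Span {x} false Jx = go lvl Jx
        where
        go : ∀ {i} → Level O i → J i x → Span O (flat x)
        go (trivial _) Jx = subst (Span O) (cong flat (sym (J-0 Jx))) []
        go (exact top o u≈o ¬Jo) Jx with generates Jx ¬Jo
        ... | n , x≡ = subst (Span O) (trans (flat-⋆ n (part o)) (cong flat (sym x≡))) (Span-⋆ n (Span-flat (Span-gen u≈o)))

      Span-J : ∀ {z} → Span O z → J i (part z)
      Span-J = Span-⊆ {P = λ z → J i (part z)} J-zero J-+ (Level-top lvl)

      Span-O : ∀ {x ℓ w} → J i x → (x , false , ℓ) ≈ w → Span O w
      Span-O {ℓ = ℓ} Jx r = Span-closed O-closed r (in-Span ℓ Jx)

    opaque
      -- For x ∈ J i the orbit of x + u spans u, hence o*; so it meets the generators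
      -- of J i, which all lie in the orbit of u. But x ∈ S₀ and 0 ∉ S₀.
      impure-level : ∀ {i o} → Level O i → O o → ¬ Pure (part o) → ∀ {x} → J i x → S false x ≢ true
      impure-level (trivial top) Oo ¬Po _ _ = ¬Po (subst Pure (sym (J-0 (top Oo))) Pure-0)
      impure-level {o = o} lvl@(exact {i} top o* u≈o* ¬Jo*) Oo ¬Po {x} Jx Sx
        with ∃ᴳ? (λ w → ((x , false , true) ≈? w) ×-dec ¬? (J? i (part w)))
      ... | yes ((y , τ , ℓ) , x≈w , ¬Jy) = true≢false (trans (sym Sx) (trans (adj-closed x≈w) (adj-u u≈w)))
        where
        open Generated lvl
        ¬Po* : ¬ Pure (part o*)
        ¬Po* Po* with generates (top Oo) ¬Jo*
        ... | k , o≡ = ¬Po (subst Pure (sym o≡) (Pure-⋆ k Po*))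
        u≈twisted : ∀ τ τ′ {v} → u ≈ (v , τ′ , true) → ¬ Pure v → u ≈ (v , τ , true)
        u≈twisted true true r _ = r
        u≈twisted false false r _ = r
        u≈twisted true false r ¬P = ≈-trans r (impure-twist ¬P false true)
        u≈twisted false true r ¬P = ≈-trans r (impure-twist ¬P true true)
        u≈o*τ : u ≈ (part o* , τ , true)
        u≈o*τ = u≈twisted τ (twist o*) (subst (u ≈_) (cong (λ ℓ → part o* , twist o* , ℓ) (O-layer u≈o*)) u≈o*) ¬Po*
        u≈w : u ≈ (y , τ , ℓ)
        -- The part y is a unit multiple of the part of `o*`. Units fix `u` and all bits, so this
        -- multiple of the copy of `o*` with twist τ remains in the orbit of `u`.
        u≈w with generates (Span-J (Span-O Jx x≈w)) ¬Jo*
        ... | k , y≡ with p ∣? k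
        ...   | yes p∣k = ⊥-elim (¬Jy (subst (J i) (sym y≡) (p∣⇒J p∣k (top u≈o*))))
        ...   | no p∤k with make-unit p∤k
        ...     | k′ , unit-k′ , k′≡ = subst₂ _≈_ (triple (⋆-zero k′) refl refl)
                    (triple (trans (k′≡ (part o*)) (sym y≡)) refl (layer-closed x≈w)) (Unit-≈′ unit-k′ u≈o*τ)
      ... | no ∄ = ¬Jo* (Span-⊆ {P = λ z → J i (part z)} J-zero J-+ in-J (Span-closed (λ r s → ≈-trans s r) u≈o* u-span))
        where
        open import Relation.Nullary.Decidable using (decidable-stable)
        in-J : ∀ {w} → (x , false , true) ≈ w → J i (part w)
        in-J {w} r = decidable-stable (J? i (part w)) λ ¬Jw → ∄ (w , r , ¬Jw)
        u-span : Span ((x , false , true) ≈_) u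
        u-span = subst (Span _) (trans (odd-⋆ (proj₁ m-odd) (proj₂ m-odd) (x , false , true)) (triple (torsion x) refl refl))
                   (Span-⋆ m (Span-gen ≈-refl))

    -- Morris's parity argument: modulo 2 the walks of length two see only the doubled
    -- connection set, and halving it recovers the connection set inside one layer.
    module PureBlocks where
      open import Data.Nat.Properties using (+-comm; *-comm; *-suc)

      -- The subgroup generated by the pure elements and (0, τ, true). On each of its cosets the
      -- cover induces the double cover belonging to the pure elements of `S τ`.
      Block : Bool → G → Set
      Block τ z = Pure (part z) × twist z ≡ τ ∧ layer z

      Block-+ : ∀ {τ z w} → Block τ z → Block τ w → Block τ (z ⊹ w)
      Block-+ {τ} {z} {w} (Pz , ez) (Pw , ew) = Pure-+ Pz Pw , trans (cong₂ _xor_ ez ew) (∧-distrib τ (layer z) (layer w))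
        where
        ∧-distrib : ∀ τ a b → (τ ∧ a) xor (τ ∧ b) ≡ τ ∧ (a xor b)
        ∧-distrib true a b = refl
        ∧-distrib false a b = refl

      Block-neg : ∀ {τ z} → Block τ z → Block τ (⊖ z)
      Block-neg (Pz , ez) = Pure-neg Pz , ez

      Block-⊟ : ∀ {τ z w} → Block τ z → Block τ w → Block τ (z ⊟ w)
      Block-⊟ {τ} {z} {w} Bz Bw = Block-+ {τ} {z} {⊖ w} Bz (Block-neg {τ} {w} Bw)

      opaque
        Block? : ∀ τ z → Dec (Block τ z)
        Block? τ z = Pure? (part z) ×-dec (twist z Boolₚ.≟ τ ∧ layer z)

      -- Pure displacements stay pure, so the image of this single displacement decides that f maps
      -- the coset x + `Block σ` onto f x + `Block τ`.
      record Carries (f : Automorphism) (x : G) (σ τ : Bool) : Set where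
        constructor carries
        field
          {offset} : C
          image    : fun f (x ⊹ (0# , σ , true)) ≡ fun f x ⊹ (offset , τ , true)
          pure     : Pure offset

      Carries-block : ∀ {f x σ τ} → Carries f x σ τ → ∀ {z} → Block σ z → Block τ (fun f (x ⊹ z) ⊟ fun f x)
      Carries-block {f} {x} {σ} {τ} _ {κ , _ , false} (Pκ , refl) =
        subst (λ s → Block τ (fun f (x ⊹ (κ , s , false)) ⊟ fun f x)) (sym (Boolₚ.∧-zeroʳ σ))
          (subst (Block τ) (sym (Pure-flat Pκ r)) (Pure-≈ Pκ r , sym (Boolₚ.∧-zeroʳ τ)))
        where
        r : flat κ ≈ move f x (flat κ)
        r = ≈-move f x (flat κ)
      Carries-block {f} {x} {σ} {τ} (carries {k} image Pk) {κ , _ , true} (Pκ , refl) =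
        subst (λ s → Block τ (fun f (x ⊹ (κ , s , true)) ⊟ fun f x)) (sym (Boolₚ.∧-identityʳ σ))
          (subst (Block τ) (sym moved) (Pure-+ Pk (Pure-≈ Pκ r) , trans (Boolₚ.xor-identityʳ τ) (sym (Boolₚ.∧-identityʳ τ))))
        where
        y : G
        y = x ⊹ (0# , σ , true)
        r : flat κ ≈ move f y (flat κ)
        r = ≈-move f y (flat κ)
        moved : fun f (x ⊹ (κ , σ , true)) ⊟ fun f x ≡ (k , τ , true) ⊹ flat (part (move f y (flat κ)))
        moved = begin
          fun f (x ⊹ (κ , σ , true)) ⊟ fun f x ≡⟨ cong (λ w → fun f (x ⊹ w) ⊟ fun f x) (triple (sym (identityˡ κ)) (sym (Boolₚ.xor-identityʳ σ)) refl) ⟩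
          fun f (x ⊹ ((0# , σ , true) ⊹ flat κ)) ⊟ fun f x ≡⟨ cong (λ w → fun f w ⊟ fun f x) (sym (⊹-assoc x (0# , σ , true) (flat κ))) ⟩
          fun f (y ⊹ flat κ) ⊟ fun f x ≡⟨ cong (_⊟ fun f x) (move-spec f y (flat κ)) ⟩
          (fun f y ⊹ move f y (flat κ)) ⊟ fun f x ≡⟨ cong₂ (λ a c → (a ⊹ c) ⊟ fun f x) image (Pure-flat Pκ r) ⟩
          (fun f x ⊹ (k , τ , true) ⊹ flat (part (move f y (flat κ)))) ⊟ fun f x
            ≡⟨ solveᴳ 3 (λ a b c → ((a ∔ b) ∔ c) ∸ a ⊜ᴳ b ∔ c) refl (fun f x) (k , τ , true) (flat _) ⟩
          (k , τ , true) ⊹ flat (part (move f y (flat κ))) ∎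
          where open ≡-Reasoning

      opaque
        Carries-inverse : ∀ {f x σ τ} → Carries f x σ τ → Carries (inverse f) (fun f x) τ σ
        Carries-inverse {f} {x} {σ} {τ} (carries {k} image Pk) = carries (begin
            inv f (fun f x ⊹ (0# , τ , true))
              ≡⟨ cong (inv f) (trans (cong (fun f x ⊹_) (triple (solve 1 (λ k → :0 ⊜ k :- k) refl k) (sym (Boolₚ.xor-identityʳ τ)) refl))
                   (trans (sym (⊹-assoc (fun f x) (k , τ , true) (flat (- k)))) (cong (_⊹ flat (- k)) (sym image)))) ⟩
            inv f (fun f y ⊹ flat (- k))
              ≡⟨ move-spec (inverse f) (fun f y) (flat (- k)) ⟩
            inv f (fun f y) ⊹ move (inverse f) (fun f y) (flat (- k))
              ≡⟨ cong₂ _⊹_ (inv-fun f y) (Pure-flat (Pure-neg Pk) r) ⟩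
            x ⊹ (0# , σ , true) ⊹ flat κ
              ≡⟨ ⊹-assoc x (0# , σ , true) (flat κ) ⟩
            x ⊹ ((0# , σ , true) ⊹ flat κ)
              ≡⟨ cong₂ _⊹_ (sym (inv-fun f x)) (triple (identityˡ κ) (Boolₚ.xor-identityʳ σ) refl) ⟩
            inv f (fun f x) ⊹ (κ , σ , true) ∎)
          (Pure-≈ (Pure-neg Pk) r)
          where
          open ≡-Reasoning
          y : G
          y = x ⊹ (0# , σ , true)
          r : flat (- k) ≈ move (inverse f) (fun f y) (flat (- k))
          r = ≈-move (inverse f) (fun f y) (flat (- k))
          κ : C
          κ = part (move (inverse f) (fun f y) (flat (- k)))

      Carries-block⁻¹ : ∀ {f x σ τ} → Carries f x σ τ → ∀ {z} → Block τ (fun f (x ⊹ z) ⊟ fun f x) → Block σ z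
      Carries-block⁻¹ {f} {x} {σ} {τ} c {z} B = subst (Block σ) restore (Carries-block (Carries-inverse c) B)
        where
        restore : inv f (fun f x ⊹ (fun f (x ⊹ z) ⊟ fun f x)) ⊟ inv f (fun f x) ≡ z
        restore = trans (cong₂ _⊟_ (trans (cong (inv f) (solveᴳ 2 (λ a b → a ∔ (b ∸ a) ⊜ᴳ b) refl (fun f x) (fun f (x ⊹ z)))) (inv-fun f (x ⊹ z))) (inv-fun f x))
                        (solveᴳ 2 (λ x z → (x ∔ z) ∸ x ⊜ᴳ z) refl x z)

      half : ℕ
      half = suc (proj₁ m-odd)

      2*half : 2 ℕ.* half ≡ 1 ℕ.+ m
      2*half = trans (*-suc 2 _) (cong suc (sym (proj₂ m-odd)))

      half-2 : ∀ x → half ⋆ 2 ⋆ x ≡ x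
      half-2 x = trans (⋆-assoc half 2 x) (trans (cong (_⋆ x) (trans (*-comm half 2) 2*half))
                   (trans (cong (x +_) (torsion x)) (identityʳ x)))

      p∤half : p ∤ half
      p∤half p∣ = p≢1 (∣1⇒≡1 (∣m+n∣m⇒∣n (subst (p ∣_) (trans 2*half (+-comm 1 m)) (∣n⇒∣m*n 2 p∣)) p∣m))
        where open import Data.Nat.Divisibility using (∣1⇒≡1)

      Flat : (G → Bool) → Set
      Flat X = ∀ {z} → X z ≡ true → z ≡ flat (part z)

      scale-flat : ∀ {X} k → Flat X → Flat (scale k X)
      scale-flat {X} k FX {z} kXz with scale-elim k X z kXz
      ... | y , Xy , ky≡z = trans (sym ky≡z) (trans k⋆y≡ (cong (λ w → flat (part w)) (trans (sym k⋆y≡) ky≡z) ))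
        where
        k⋆y≡ : k ⋆ᴳ y ≡ flat (k ⋆ part y)
        k⋆y≡ = trans (cong (k ⋆ᴳ_) (FX Xy)) (flat-⋆ k (part y))

      Flat-injective : ∀ {q X} → p ∤ q → Flat X → InjectiveOn q X
      Flat-injective {q} p∤q FX {y} {z} Xy Xz e with unit p∤q
      ... | q′ , q′q = trans (FX Xy) (trans (cong flat (trans (sym (q′q (part y)))
              (trans (cong (q′ ⋆_) (trans (sym (part-⋆ q y)) (trans (cong part e) (part-⋆ q z)))) (q′q (part z))))) (sym (FX Xz)))

      steps : Bool → G → Bool
      steps τ z = adj z ∧ does (Block? τ z)

      steps-elim : ∀ τ {z} → steps τ z ≡ true → ∃ λ κ → z ≡ (κ , τ , true) × Pure κ × S τ κ ≡ true
      steps-elim τ {κ , τ′ , true} e with Block? τ (κ , τ′ , true)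
      ... | yes (Pκ , τ′≡) = κ , cong (λ s → κ , s , true) τ′≡τ , Pκ , subst (λ s → S s κ ≡ true) τ′≡τ (trans (sym (Boolₚ.∧-identityʳ _)) e)
        where
        τ′≡τ : τ′ ≡ τ
        τ′≡τ = trans τ′≡ (Boolₚ.∧-identityʳ τ)
      ... | no _ = ⊥-elim (true≢false (trans (sym e) (Boolₚ.∧-zeroʳ _)))

      steps-intro : ∀ {τ κ} → Pure κ → S τ κ ≡ true → steps τ (κ , τ , true) ≡ true
      steps-intro {τ} {κ} Pκ Sκ = cong₂ _∧_ Sκ (dec-true (Block? τ (κ , τ , true)) (Pκ , sym (Boolₚ.∧-identityʳ τ)))
        where open import Relation.Nullary.Decidable using (dec-true)

      -- Doubling drops the steps into layer 0 without twist, and halving undoes the factor 2 on C.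
      -- The result is `S τ` on pure elements, now readable between vertices of the same layer.
      connection : Bool → G → Bool
      connection τ = scale half (scale 2 (steps τ))

      connection-flat : ∀ τ κ → Pure κ → connection τ (flat κ) ≡ S τ κ
      connection-flat τ κ Pκ = boolean-ext forth back
        where
        back : S τ κ ≡ true → connection τ (flat κ) ≡ true
        back Sκ = subst (λ z → connection τ z ≡ true)
          (trans (cong (half ⋆ᴳ_) (even-⋆ 1 (κ , τ , true))) (trans (flat-⋆ half (2 ⋆ κ)) (cong flat (half-2 κ))))
          (scale-intro half (scale 2 (steps τ)) (scale-intro 2 (steps τ) (steps-intro Pκ Sκ)))
        forth : connection τ (flat κ) ≡ true → S τ κ ≡ true
        forth e with scale-elim half (scale 2 (steps τ)) (flat κ) e
        ... | y , 2Xy , hy≡ with scale-elim 2 (steps τ) y 2Xy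
        ...   | z , Xz , 2z≡y with steps-elim τ Xz
        ...     | κ′ , z≡ , Pκ′ , Sκ′ = subst (λ k → S τ k ≡ true) κ′≡κ Sκ′
          where
          κ′≡κ : κ′ ≡ κ
          κ′≡κ = begin
            κ′ ≡⟨ half-2 κ′ ⟨
            half ⋆ 2 ⋆ κ′ ≡⟨ cong (λ w → half ⋆ 2 ⋆ part w) z≡ ⟨
            half ⋆ 2 ⋆ part z ≡⟨ cong (half ⋆_) (part-⋆ 2 z) ⟨
            half ⋆ part (2 ⋆ᴳ z) ≡⟨ part-⋆ half (2 ⋆ᴳ z) ⟨
            part (half ⋆ᴳ 2 ⋆ᴳ z) ≡⟨ cong (λ w → part (half ⋆ᴳ w)) 2z≡y ⟩
            part (half ⋆ᴳ y) ≡⟨ cong part hy≡ ⟩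
            κ ∎
            where open ≡-Reasoning

      module _ {f x σ τ} (c : Carries f x σ τ) where

        D : G → Set
        D y = Block σ (y ⊟ x)

        D⇒ : ∀ {y} → D y → Block τ (fun f y ⊟ fun f x)
        D⇒ {y} Dy = subst (λ w → Block τ (fun f w ⊟ fun f x)) (solveᴳ 2 (λ x y → x ∔ (y ∸ x) ⊜ᴳ y) refl x y) (Carries-block c Dy)

        D⇐ : ∀ {y} → Block τ (fun f y ⊟ fun f x) → D y
        D⇐ {y} B = Carries-block⁻¹ c (subst (λ w → Block τ (fun f w ⊟ fun f x)) (solveᴳ 2 (λ x y → y ⊜ᴳ x ∔ (y ∸ x)) refl x y) B)

        opaque
          steps-preserved : Preserves (fun f) D (steps σ) (steps τ)
          steps-preserved = record
            { preserves = λ {y} z Dy → cong₂ _∧_ (adj-closed (≈-move f y z)) (does-⇔ (mk⇔ (forth Dy) (back Dy)) (Block? σ z) (Block? τ (move f y z)))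
            ; closed = λ {y} z Dy Xz → subst (Block σ) (solveᴳ 3 (λ x y z → (y ∸ x) ∔ z ⊜ᴳ (y ∔ z) ∸ x) refl x y z)
                (Block-+ {σ} {y ⊟ x} {z} Dy (does-true (Block? σ z) (∧-true (adj z) Xz))) }
            where
            open import Relation.Nullary.Decidable using (does-⇔)
            ∧-true : ∀ a {c} → a ∧ c ≡ true → c ≡ true
            ∧-true true e = e
            module _ {y} (Dy : D y) {z : G} where
              forth : Block σ z → Block τ (move f y z)
              forth Bz = subst (Block τ) (solveᴳ 3 (λ a b c → (a ∸ c) ∸ (b ∸ c) ⊜ᴳ a ∸ b) refl (fun f (y ⊹ z)) (fun f y) (fun f x))
                (Block-⊟ {τ} {fun f (y ⊹ z) ⊟ fun f x} {fun f y ⊟ fun f x}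
                  (D⇒ (subst (Block σ) (solveᴳ 3 (λ x y z → (y ∸ x) ∔ z ⊜ᴳ (y ∔ z) ∸ x) refl x y z) (Block-+ {σ} {y ⊟ x} {z} Dy Bz))) (D⇒ Dy))
              back : Block τ (move f y z) → Block σ z
              back B = subst (Block σ) (solveᴳ 3 (λ x y z → ((y ∔ z) ∸ x) ∸ (y ∸ x) ⊜ᴳ z) refl x y z)
                (Block-⊟ {σ} {(y ⊹ z) ⊟ x} {y ⊟ x}
                  (D⇐ (subst (Block τ) (solveᴳ 3 (λ a b c → (b ∸ c) ∔ (a ∸ b) ⊜ᴳ a ∸ c) refl (fun f (y ⊹ z)) (fun f y) (fun f x))
                    (Block-+ {τ} {fun f y ⊟ fun f x} {move f y z} (D⇒ Dy) B))) Dy)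

          -- Doubling is injective on steps with fixed bits, so the prime 2 transports them. The
          -- factor `half` may be even and hence no `Unit`; on flat sets, however, all multipliers
          -- prime to p are injective.
          connection-preserved : Preserves (fun f) D (connection σ) (connection τ)
          connection-preserved = scale-multiplier half p∤half
              (doubled-flat σ) (doubled-flat τ) (scale-preserved (permutes f) steps-preserved prime[2] (injective σ) (injective τ))
            where
            open import Data.Nat.Primality using (prime[2])
            open Multiplier (p ∤_) Flat (λ {k} {l} p∤ → (λ p∣k → p∤ (∣m⇒∣m*n l p∣k)) , λ p∣l → p∤ (∣n⇒∣m*n k p∣l))
              (λ {q} {X} → Flat-injective {q} {X}) (λ {X} → scale-flat {X}) (permutes f) {D}
            doubled-flat : ∀ τ → Flat (scale 2 (steps τ))
            doubled-flat τ {z} e with scale-elim 2 (steps τ) z e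
            ... | y , _ , 2y≡z = trans (sym 2y≡z) (trans (even-⋆ 1 y) (cong flat (trans (sym (part-⋆ 2 y)) (cong part 2y≡z))))
            injective : ∀ τ → InjectiveOn 2 (steps τ)
            injective τ {y} {z} Xy Xz e with steps-elim τ Xy | steps-elim τ Xz
            ... | κ , y≡ , _ | κ′ , z≡ , _ = trans y≡ (trans (cong (λ k → k , τ , true) (2⋆-injective (begin
                2 ⋆ κ ≡⟨ cong (λ w → 2 ⋆ part w) y≡ ⟨
                2 ⋆ part y ≡⟨ part-⋆ 2 y ⟨
                part (2 ⋆ᴳ y) ≡⟨ cong part e ⟩
                part (2 ⋆ᴳ z) ≡⟨ part-⋆ 2 z ⟩
                2 ⋆ part z ≡⟨ cong (λ w → 2 ⋆ part w) z≡ ⟩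
                2 ⋆ κ′ ∎))) (sym z≡))
              where open ≡-Reasoning

          -- Let f y = f x - κ, and let k₁ be the displacement from y to x. Then `S σ k₁` is read
          -- off twice: from y to x through `connection`, with image κ, and from y to x + (0, σ,
          -- true) as adjacency in the cover, with image κ plus the offset.
          carried-period : ∀ κ → Pure κ → S τ κ ≡ S τ (κ + Carries.offset c)
          carried-period κ Pκ = trans (sym S-k≡) S-k′≡
            where
            open Carries c renaming (offset to k)
            y : G
            y = inv f (fun f x ⊟ flat κ)
            fy+κ : fun f y ⊹ flat κ ≡ fun f x
            fy+κ = trans (cong (_⊹ flat κ) (fun-inv f _)) (solveᴳ 2 (λ a b → (a ∸ b) ∔ b ⊜ᴳ a) refl (fun f x) (flat κ))
            r : flat κ ≈ x ⊟ y
            r = ≈-sym (subst (x ⊟ y ≈_) (trans (cong (_⊟ fun f y) (sym fy+κ)) (solveᴳ 2 (λ a b → (a ∔ b) ∸ a ⊜ᴳ b) refl (fun f y) (flat κ)))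
                  (≈-difference f y x))
            k₁ : C
            k₁ = part (x ⊟ y)
            x-y≡ : x ⊟ y ≡ flat k₁
            x-y≡ = Pure-flat Pκ r
            x≡ : y ⊹ flat k₁ ≡ x
            x≡ = trans (cong (y ⊹_) (sym x-y≡)) (solveᴳ 2 (λ x y → y ∔ (x ∸ y) ⊜ᴳ x) refl x y)
            Pk₁ : Pure k₁
            Pk₁ = Pure-≈ Pκ r
            Dy : D y
            Dy = subst (Block σ) (trans (cong ⊖_ (sym x-y≡)) (solveᴳ 2 (λ x y → ∸ (x ∸ y) ⊜ᴳ y ∸ x) refl x y)) (Pure-neg Pk₁ , sym (Boolₚ.∧-zeroʳ σ))
            S-k≡ : S σ k₁ ≡ S τ κ
            S-k≡ = begin
              S σ k₁ ≡⟨ connection-flat σ k₁ Pk₁ ⟨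
              connection σ (flat k₁) ≡⟨ Preserves.preserves connection-preserved (flat k₁) Dy ⟩
              connection τ (fun f (y ⊹ flat k₁) ⊟ fun f y) ≡⟨ cong (λ w → connection τ (fun f w ⊟ fun f y)) x≡ ⟩
              connection τ (fun f x ⊟ fun f y) ≡⟨ cong (connection τ) (difference (sym fy+κ)) ⟨
              connection τ (flat κ) ≡⟨ connection-flat τ κ Pκ ⟩
              S τ κ ∎
              where open ≡-Reasoning
            S-k′≡ : S σ k₁ ≡ S τ (κ + k)
            S-k′≡ = begin
              adj (k₁ , σ , true) ≡⟨ adj-closed (≈-move f y (k₁ , σ , true)) ⟩
              adj (fun f (y ⊹ (k₁ , σ , true)) ⊟ fun f y) ≡⟨ cong (λ w → adj (fun f w ⊟ fun f y)) reach ⟩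
              adj (fun f (x ⊹ (0# , σ , true)) ⊟ fun f y) ≡⟨ cong (λ w → adj (w ⊟ fun f y)) (trans image (cong (_⊹ (k , τ , true)) (sym fy+κ))) ⟩
              adj ((fun f y ⊹ flat κ ⊹ (k , τ , true)) ⊟ fun f y)
                ≡⟨ cong adj (solveᴳ 3 (λ a b c → ((a ∔ b) ∔ c) ∸ a ⊜ᴳ b ∔ c) refl (fun f y) (flat κ) (k , τ , true)) ⟩
              adj (κ + k , τ , true) ∎
              where
              open ≡-Reasoning
              reach : y ⊹ (k₁ , σ , true) ≡ x ⊹ (0# , σ , true)
              reach = trans (cong (y ⊹_) (triple (sym (identityʳ k₁)) refl refl))
                (trans (sym (⊹-assoc y (flat k₁) (0# , σ , true))) (cong (_⊹ (0# , σ , true)) x≡))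

    -- When S₀ is not J 1-periodic, the orbit of u stays in {u, u + b}.

    module Aperiodic {s t} (Ss : S false s ≡ true) (Jt : J 1 t) (¬Sst : S false (s + t) ≢ true) where

      private
        i : ℕ
        i = proj₁ (level (u ≈?_))
        lvl : Level O i
        lvl = proj₂ (level (u ≈?_))
      open Generated lvl

      -- `J 1` lies in every nontrivial subgroup, so any nonzero period would pass its effect on to
      -- `t`.
      nonzero⇒∌t : ∀ {j} → j ≢ 0# → ∃ λ n → t ≡ n ⋆ j
      nonzero⇒∌t j≢0 = generates Jt (j≢0 ∘ J-0)

      module PureCase (Ps : Pure s) where
        open PureBlocks

        -- By cyclicity either the part of o is a multiple of the pure `s`, or `s` lies in the `J i`
        -- belonging to the orbit of `u`; for an impure o, `impure-level` excludes members of S₀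
        -- there.
        O-pure : ∀ {o} → O o → Pure (part o)
        O-pure {o} Oo with Pure? (part o)
        ... | yes Po = Po
        ... | no ¬Po with cyclic s (part o)
        ...   | inj₁ (k , s≡) = ⊥-elim (impure-level lvl Oo ¬Po (subst (J i) (sym s≡) (J-⋆ k (Level-top lvl Oo))) Ss)
        ...   | inj₂ (k , o≡) = ⊥-elim (¬Po (subst Pure (sym o≡) (Pure-⋆ k Ps)))

        aperiodic : ∀ {k} → Pure k → (∀ κ → Pure κ → S false κ ≡ S false (κ + k)) → k ≡ 0#
        aperiodic {k} Pk period with k ≟ 0#
        ... | yes k≡0 = k≡0
        ... | no k≢0 with nonzero⇒∌t k≢0
        ...   | n , t≡ = ⊥-elim (¬Sst (trans (cong (λ y → S false (s + y)) t≡) (trans (sym (multiples n)) Ss)))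
          where
          multiples : ∀ n → S false s ≡ S false (s + (n ⋆ k))
          multiples zero = cong (S false) (sym (identityʳ s))
          multiples (suc n) = trans (multiples n) (trans (period (s + (n ⋆ k)) (Pure-+ Ps (Pure-⋆ n Pk)))
            (cong (S false) (solve 3 (λ s k y → (s :+ y) :+ k ⊜ s :+ (k :+ y)) refl s k (n ⋆ k))))

        O-central : ∀ {o} → O o → part o ≡ 0#
        O-central {k , τ , ℓ} Oo@(related f x moved) = begin
          k ≡⟨ solve 2 (λ a k → k ⊜ (a :+ k) :- a) refl (part (fun f x)) k ⟩
          part (fun f x ⊹ (k , τ , ℓ)) + (- part (fun f x)) ≡⟨ cong (λ w → part w + (- part (fun f x))) same ⟩
          part (fun f x ⊹ (0# , τ , true)) + (- part (fun f x)) ≡⟨ solve 1 (λ a → (a :+ :0) :- a ⊜ :0) refl (part (fun f x)) ⟩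
          0# ∎
          where
          open ≡-Reasoning
          c : Carries f x false τ
          c = carries (trans moved (cong (λ ℓ → fun f x ⊹ (k , τ , ℓ)) (O-layer Oo))) (O-pure Oo)
          -- The inverse leads back into the untwisted block, whose connection set is S₀, so its
          -- offset is a period of S₀ on pure elements and vanishes.
          open Carries (Carries-inverse c)
          same : fun f x ⊹ (k , τ , ℓ) ≡ fun f x ⊹ (0# , τ , true)
          same = begin
            fun f x ⊹ (k , τ , ℓ) ≡⟨ moved ⟨
            fun f (x ⊹ u) ≡⟨ cong (λ k → fun f (x ⊹ (k , false , true))) (aperiodic pure (carried-period (Carries-inverse c))) ⟨
            fun f (x ⊹ (offset , false , true)) ≡⟨ cong (λ y → fun f (y ⊹ (offset , false , true))) (inv-fun f x) ⟨
            fun f (inv f (fun f x) ⊹ (offset , false , true)) ≡⟨ cong (fun f) image ⟨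
            fun f (inv f (fun f x ⊹ (0# , τ , true))) ≡⟨ fun-inv f _ ⟩
            fun f x ⊹ (0# , τ , true) ∎

      -- The drift between the layers changes sign along each edge x → x + s;
      -- since s has odd order it vanishes.
      module ImpureCase (¬Ps : ¬ Pure s) where

        s′ : G
        s′ = s , false , true

        X : G → Set
        X = s′ ≈_

        ¬Js : ¬ J i s
        ¬Js = go lvl
          where
          go : ∀ {i} → Level O i → ¬ J i s
          go (trivial _) Js = true≢false (trans (sym Ss) (trans (cong (S false) (J-0 Js)) S-0))
          go lvl@(exact top o Oo ¬Jo) Js with Pure? (part o)
          ... | no ¬Po = impure-level lvl Oo ¬Po Js Ss
          ... | yes Po with generates Js ¬Jo
          ...   | n , s≡ = ¬Ps (subst Pure (sym s≡) (Pure-⋆ n Po))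

        -- For nonzero j the orbit of `s′` would contain all s + n j, and one of these is s + t,
        -- which is missing from S₀.
        untwisted-rigid : ∀ {j} → J i j → X (s + j , false , true) → j ≡ 0#
        untwisted-rigid {j} Jj r with j ≟ 0#
        ... | yes j≡0 = j≡0
        ... | no j≢0 with nonzero⇒∌t j≢0
        ...   | n , t≡ = ⊥-elim (¬Sst (trans (cong (λ y → S false (s + y)) t≡) (trans (sym (adj-closed (coset-⋆ ¬Js Jj r n))) Ss)))

        -- s + j is the multiple of s by some 1 + p (2 d), so it is impure along with s and its
        -- twist can be removed.
        rigid : ∀ {j τ} → J i j → X (s + j , τ , true) → j ≡ 0#
        rigid {τ = false} Jj r = untwisted-rigid Jj r
        rigid {j} {true} Jj r = untwisted-rigid Jj (≈-trans r (impure-twist ¬Psj true true))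
          where
          ¬Psj : ¬ Pure (s + j)
          ¬Psj Psj with proper-multiple ¬Js Jj
          ... | d , j≡ with unit (p∤1+p* (2 ℕ.* d))
          ...   | k′ , k′k = ¬Ps (subst Pure (k′k s) (Pure-⋆ k′ (subst (λ j → Pure (s + j)) j≡ Psj)))

        module _ (h : Automorphism) (z : G) {a′ : G} (at : fun h (z ⊹ s′) ≡ fun h z ⊹ a′) where

          -- The preimage of h z + a′ + d has the form z + s′ + w with w in the span of the orbit of
          -- `u`. By `rigid` only the twist of w is free, which leaves two candidates.
          pull : ∀ {d} → X (a′ ⊹ d) → Span O d → layer d ≡ false →
            ∃ λ ε → fun h (z ⊹ s′ ⊹ (0# , ε , false)) ≡ fun h z ⊹ a′ ⊹ d
          pull {d} Xa′d Od flat-d = twist w , trans (cong (λ w → fun h (z ⊹ s′ ⊹ w)) (sym w≡)) h-w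
            where
            w : G
            w = move (inverse h) (fun h (z ⊹ s′)) d
            h-w : fun h (z ⊹ s′ ⊹ w) ≡ fun h z ⊹ a′ ⊹ d
            h-w = trans (cong (fun h) (trans (cong (_⊹ w) (sym (inv-fun h (z ⊹ s′)))) (sym (move-spec (inverse h) _ d))))
                        (trans (fun-inv h _) (cong (_⊹ d) at))
            d≈w : d ≈ w
            d≈w = ≈-move (inverse h) _ d
            layer-w : layer w ≡ false
            layer-w = trans (sym (layer-closed d≈w)) flat-d
            X-w : X (s + part w , twist w , true)
            X-w = ≈-trans Xa′d (≈-sym (≈-trans (≈-reflexive (triple refl refl (cong not (sym layer-w))))
              (related h z (trans (cong (fun h) (sym (⊹-assoc z s′ w)))
                (trans h-w (⊹-assoc (fun h z) a′ d))))))
            w≡ : w ≡ (0# , twist w , false)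
            w≡ = triple (rigid (Span-J (Span-closed O-closed d≈w Od)) X-w) refl layer-w

          cancel : ∀ {d d′} → fun h z ⊹ a′ ⊹ d ≡ fun h z ⊹ a′ ⊹ d′ → d ≡ d′
          cancel {d} {d′} e = trans (solveᴳ 2 (λ c d → d ⊜ᴳ (c ∔ d) ∸ c) refl (fun h z ⊹ a′) d)
            (trans (cong (_⊟ (fun h z ⊹ a′)) e) (solveᴳ 2 (λ c d → (c ∔ d) ∸ c ⊜ᴳ d) refl (fun h z ⊹ a′) d′))

          s′+0 : fun h (z ⊹ s′ ⊹ 𝟘) ≡ fun h z ⊹ a′ ⊹ 𝟘
          s′+0 = trans (cong (fun h) (solveᴳ 1 (λ a → a ∔ ∅ ⊜ᴳ a) refl (z ⊹ s′))) (trans at (solveᴳ 1 (λ a → a ⊜ᴳ a ∔ ∅) refl (fun h z ⊹ a′)))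

          -- Split s′ along a′ into its flat part and its bits. Comparing the two resulting summands
          -- by cyclicity either puts s into `J i` or makes it pure. That `b` is in the span covers
          -- the twisted case of the second summand.
          impure-part : Span O b → ¬ Pure (part a′)
          impure-part Ob Pa′ with ≈-split (flat (part a′)) (0# , twist a′ , true) (≈-trans (≈-reflexive split) (≈-sym (related h z at)))
            where
            split : flat (part a′) ⊹ (0# , twist a′ , true) ≡ a′
            split = triple (identityʳ _) refl (layer-closed (related h z at))
          ... | w₁ , w₂ , s′≡ , r₁ , r₂ with cyclic (part w₁) (part w₂)
          ...   | inj₁ (n , w₁≡) = ¬Js (subst (J i) (sym (cong part s′≡)) (J-+ (subst (J i) (sym w₁≡) (J-⋆ n Jw₂)) Jw₂))
            where
            u-twist : ∀ τ → Span O (0# , τ , true)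
            u-twist false = Span-gen ≈-refl
            u-twist true = subst (Span O) (triple (identityʳ 0#) refl refl) (Span-+ Ob (Span-gen ≈-refl))
            Jw₂ : J i (part w₂)
            Jw₂ = Span-J (Span-closed O-closed r₂ (u-twist (twist a′)))
          ...   | inj₂ (n , w₂≡) = ¬Ps (subst Pure (sym (cong part s′≡)) (Pure-+ Pw₁ (subst Pure (sym w₂≡) (Pure-⋆ n Pw₁))))
            where
            Pw₁ : Pure (part w₁)
            Pw₁ = Pure-≈ Pa′ r₁

          -- If the preimage is z + s′ then d = 0. If it is z + s′ + b, then b ≈ d puts b into the
          -- span, and a′ + b also lies in the orbit of `s′` because a′ is impure. Its preimage must
          -- again be z + s′ + b, whence d = b.
          separated : ∀ {d} → X (a′ ⊹ d) → Span O d → layer d ≡ false → part d ≡ 0#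
          separated {d} Xa′d Od flat-d with pull Xa′d Od flat-d
          ... | false , e = cong part (cancel (trans (sym e) s′+0))
          ... | true , e with pull {b} Xa′b Ob refl
            where
            b≈d : b ≈ d
            b≈d = related h (z ⊹ s′) (trans e (cong (_⊹ d) (sym at)))
            Ob : Span O b
            Ob = Span-closed O-closed (≈-sym b≈d) Od
            Xa′b : X (a′ ⊹ b)
            Xa′b = ≈-trans (related h z at) (≈-trans (≈-reflexive (triple refl refl (sym (layer-closed (related h z at)))))
              (≈-trans (impure-twist (impure-part Ob) (twist a′) true) (≈-reflexive (triple (sym (identityʳ _))
                (trans (cong not (sym (Boolₚ.xor-identityʳ _))) (flip (twist a′))) (trans (layer-closed (related h z at)) (sym (Boolₚ.xor-identityʳ _)))))))
              where
              flip : ∀ τ → not (τ xor false) ≡ τ xor true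
              flip true = refl
              flip false = refl
          ...   | true , e′ = cong part (cancel (trans (sym e) e′))
          ...   | false , e′ = ⊥-elim (true≢false (cong twist (cancel (trans (sym e′) s′+0))))

        drift : Automorphism → G → C
        drift f x = part (move f x u)

        -- From x + u to x + s and from x to x + s + u the displacement is the same `s′`. Their
        -- images differ by the sum d of the two moves of `u`, so `separated` makes its part vanish.
        drift-alternates : ∀ f x → drift f (x ⊹ flat s) + drift f x ≡ 0#
        drift-alternates f x with ≈-difference f (x ⊹ u) (x ⊹ flat s)
        ... | r = go (subst (_≈ a′) y-x≡ r)
          where
          y a a′ d : G
          y = x ⊹ flat s
          a = fun f (y ⊹ u) ⊟ fun f x
          a′ = fun f y ⊟ fun f (x ⊹ u)
          d = move f y u ⊹ move f x u
          y-x≡ : y ⊟ (x ⊹ u) ≡ s′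
          y-x≡ = trans (solveᴳ 3 (λ x s u → (x ∔ s) ∸ (x ∔ u) ⊜ᴳ s ∸ u) refl x (flat s) u)
            (triple (solve 1 (λ s → s :- :0 ⊜ s) refl s) refl refl)
          a≡ : a ≡ a′ ⊹ d
          a≡ = solveᴳ 4 (λ p q r w → p ∸ r ⊜ᴳ (q ∸ w) ∔ ((p ∸ q) ∔ (w ∸ r))) refl (fun f (y ⊹ u)) (fun f y) (fun f x) (fun f (x ⊹ u))
          Xa : X a
          Xa = subst₂ (λ v w → v ≈ fun f w ⊟ fun f x) (triple (identityʳ s) refl refl)
            (solveᴳ 3 (λ x s u → x ∔ (s ∔ u) ⊜ᴳ (x ∔ s) ∔ u) refl x (flat s) u) (≈-move f x (flat s ⊹ u))
          layer-d : layer d ≡ false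
          layer-d = cong₂ _xor_ (O-layer (≈-move f y u)) (O-layer (≈-move f x u))
          go : X a′ → part d ≡ 0#
          go (related h z at) = separated h z at (subst X a≡ Xa) (Span-+ (Span-gen (≈-move f y u)) (Span-gen (≈-move f x u))) layer-d

        drift-zero : ∀ f x → drift f x ≡ 0#
        drift-zero f x = 2⋆-injective (begin
          drift f x + (drift f x + 0#) ≡⟨ cong (drift f x +_) (identityʳ _) ⟩
          drift f x + drift f x ≡⟨ cong₂ (λ y c → drift f y + c) around (even (proj₁ m-odd)) ⟨
          drift f (walk (suc (2 ℕ.* h))) + drift f (walk (2 ℕ.* h)) ≡⟨ cong (λ y → drift f y + drift f (walk (2 ℕ.* h))) (step (2 ℕ.* h)) ⟩
          drift f (walk (2 ℕ.* h) ⊹ flat s) + drift f (walk (2 ℕ.* h)) ≡⟨ drift-alternates f _ ⟩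
          0# ≡⟨ ⋆-zero 2 ⟨
          2 ⋆ 0# ∎)
          where
          open ≡-Reasoning
          open import Data.Nat.Properties using (*-suc)
          h : ℕ
          h = proj₁ m-odd
          walk : ℕ → G
          walk n = x ⊹ n ⋆ᴳ flat s
          step : ∀ n → walk (suc n) ≡ walk n ⊹ flat s
          step n = solveᴳ 3 (λ x s y → x ∔ (s ∔ y) ⊜ᴳ (x ∔ y) ∔ s) refl x (flat s) (n ⋆ᴳ flat s)
          around : walk (suc (2 ℕ.* h)) ≡ x
          around = trans (cong (λ n → walk n) (sym (proj₂ m-odd))) (trans (cong (x ⊹_) (trans (flat-⋆ m s) (cong flat (torsion s))))
            (solveᴳ 1 (λ x → x ∔ ∅ ⊜ᴳ x) refl x))
          opposite : ∀ {a c c′} → a + c ≡ 0# → c′ + a ≡ 0# → c′ ≡ c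
          opposite {a} {c} {c′} e e′ = trans (solve 3 (λ a c c′ → c′ ⊜ (c′ :+ a) :+ (c :- (a :+ c))) refl a c c′)
            (trans (cong₂ (λ v w → v + (c + (- w))) e′ e) (solve 1 (λ c → :0 :+ (c :- :0) ⊜ c) refl c))
          even : ∀ h → drift f (walk (2 ℕ.* h)) ≡ drift f x
          even zero = cong (drift f) (solveᴳ 1 (λ x → x ∔ ∅ ⊜ᴳ x) refl x)
          even (suc h) = trans (cong (λ n → drift f (walk n)) (*-suc 2 h)) (trans (cong (drift f) (step (suc (2 ℕ.* h))))
            (trans (opposite (trans (cong (λ y → drift f y + drift f (walk (2 ℕ.* h))) (step (2 ℕ.* h))) (drift-alternates f (walk (2 ℕ.* h)))) (drift-alternates f (walk (suc (2 ℕ.* h)))))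
                   (even h)))

      opaque
        O-central : ∀ {o} → O o → part o ≡ 0#
        O-central {o} Oo with Pure? s
        ... | yes Ps = PureCase.O-central Ps Oo
        ... | no ¬Ps with Oo
        ...   | related f x moved = trans (cong part (difference {fun f (x ⊹ u)} {fun f x} {o} moved)) (ImpureCase.drift-zero ¬Ps f x)

    -- On layer 0, γ is an isomorphism from Cay(H, S) to Cay(H, S b).
    record Twist : Set where
      field
        γ γ⁻¹     : G → G
        γ-γ⁻¹     : ∀ z → γ (γ⁻¹ z) ≡ z
        γ⁻¹-γ     : ∀ z → γ⁻¹ (γ z) ≡ z
        γ-layer   : ∀ z → layer (γ z) ≡ layer z
        γ-adj     : ∀ z w → layer z ≡ layer w → adj ((w ⊟ z) ⊹ u) ≡ adj ((γ w ⊟ γ z) ⊹ (u ⊹ b))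

    -- Signs of automorphisms when u and u + b share an orbit.

    module Central (O-central : ∀ {o} → O o → part o ≡ 0#) (u≈v : u ≈ (0# , true , true)) where

      v : G
      v = 0# , true , true

      bit : Bool → G
      bit τ = 0# , τ , false

      u-τ : ∀ τ {w} → (0# , τ , true) ≈ w → O w
      u-τ false r = r
      u-τ true r = ≈-trans u≈v r

      opaque
        -- b = u + v, and each summand moves within {u, v}. So b can move only to 0 or to b, and 0
        -- is its own orbit.
        b-fixed : ∀ f x → fun f (x ⊹ b) ≡ fun f x ⊹ b
        b-fixed f x with ≈-split u v {move f x b} (≈-trans (≈-reflexive (triple (identityˡ 0#) refl refl)) (≈-move f x b))
        ... | w₁ , w₂ , w≡ , u≈w₁ , v≈w₂ = trans (move-spec f x b) (cong (fun f x ⊹_) (triple part≡ (twist≡ (twist w) refl) layer≡))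
          where
          w : G
          w = move f x b
          part≡ : part w ≡ 0#
          part≡ = trans (cong part w≡) (trans (cong₂ _+_ (O-central u≈w₁) (O-central (u-τ true v≈w₂))) (identityˡ 0#))
          layer≡ : layer w ≡ false
          layer≡ = trans (cong layer w≡) (cong₂ _xor_ (O-layer u≈w₁) (O-layer (u-τ true v≈w₂)))
          b≢0 : b ≢ 𝟘
          b≢0 e = true≢false (cong twist e)
          twist≡ : ∀ τ → twist w ≡ τ → twist w ≡ true
          twist≡ true e = e
          twist≡ false e = ⊥-elim (b≢0 (≈-zero (≈-sym (subst (b ≈_) (triple part≡ e layer≡) (≈-move f x b)))))

        bit-fixed : ∀ τ f x → fun f (x ⊹ bit τ) ≡ fun f x ⊹ bit τ
        bit-fixed true f x = b-fixed f x
        bit-fixed false f x = trans (cong (fun f) (x+0 x)) (sym (x+0 (fun f x)))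
          where
          x+0 : ∀ x → x ⊹ 𝟘 ≡ x
          x+0 = solveᴳ 1 (λ x → x ∔ ∅ ⊜ᴳ x) refl

      sign : Automorphism → G → Bool
      sign f x = twist (move f x u)

      sign-spec : ∀ f x → fun f (x ⊹ u) ≡ fun f x ⊹ (0# , sign f x , true)
      sign-spec f x = trans (move-spec f x u) (cong (fun f x ⊹_) (triple (O-central (≈-move f x u)) refl (O-layer (≈-move f x u))))

      sign-unique : ∀ f x {τ} → fun f (x ⊹ u) ≡ fun f x ⊹ (0# , τ , true) → sign f x ≡ τ
      sign-unique f x {τ} e = cong twist (sym (difference {fun f (x ⊹ u)} {fun f x} {0# , τ , true} e))

      sign-bit : ∀ τ f x → sign f (x ⊹ bit τ) ≡ sign f x
      sign-bit τ f x = sign-unique f (x ⊹ bit τ) (begin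
        fun f (x ⊹ bit τ ⊹ u) ≡⟨ cong (fun f) (swap x (bit τ) u) ⟩
        fun f (x ⊹ u ⊹ bit τ) ≡⟨ bit-fixed τ f (x ⊹ u) ⟩
        fun f (x ⊹ u) ⊹ bit τ ≡⟨ cong (_⊹ bit τ) (sign-spec f x) ⟩
        fun f x ⊹ (0# , sign f x , true) ⊹ bit τ ≡⟨ swap (fun f x) _ (bit τ) ⟩
        fun f x ⊹ bit τ ⊹ (0# , sign f x , true) ≡⟨ cong (_⊹ (0# , sign f x , true)) (bit-fixed τ f x) ⟨
        fun f (x ⊹ bit τ) ⊹ (0# , sign f x , true) ∎)
        where
        open ≡-Reasoning
        swap : ∀ a c d → a ⊹ c ⊹ d ≡ a ⊹ d ⊹ c
        swap = solveᴳ 3 (λ a c d → (a ∔ c) ∔ d ⊜ᴳ (a ∔ d) ∔ c) refl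

      opaque
        sign-inverse : ∀ f x → sign (inverse f) (fun f x) ≡ sign f x
        sign-inverse f x = sign-unique (inverse f) (fun f x) (begin
          inv f (fun f x ⊹ u) ≡⟨ cong (inv f) (trans (cong (fun f x ⊹_) (triple (sym (identityˡ 0#)) (sym (Boolₚ.xor-same s)) refl))
                                                             (sym (⊹-assoc (fun f x) (0# , s , true) (bit s)))) ⟩
          inv f (fun f x ⊹ (0# , s , true) ⊹ bit s) ≡⟨ cong (λ w → inv f (w ⊹ bit s)) (sign-spec f x) ⟨
          inv f (fun f (x ⊹ u) ⊹ bit s) ≡⟨ cong (inv f) (bit-fixed s f (x ⊹ u)) ⟨
          inv f (fun f (x ⊹ u ⊹ bit s)) ≡⟨ inv-fun f _ ⟩
          x ⊹ u ⊹ bit s ≡⟨ ⊹-assoc x u (bit s) ⟩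
          x ⊹ (u ⊹ bit s) ≡⟨ cong₂ _⊹_ (sym (inv-fun f x)) (triple (identityˡ 0#) refl refl) ⟩
          inv f (fun f x) ⊹ (0# , s , true) ∎)
          where
          open ≡-Reasoning
          s : Bool
          s = sign f x

        ≈-bit : ∀ τ {z w} → z ≈ w → z ⊹ bit τ ≈ w ⊹ bit τ
        ≈-bit τ {z} {w} (related f x e) = related f x (begin
          fun f (x ⊹ (z ⊹ bit τ)) ≡⟨ cong (fun f) (⊹-assoc x z (bit τ)) ⟨
          fun f (x ⊹ z ⊹ bit τ) ≡⟨ bit-fixed τ f (x ⊹ z) ⟩
          fun f (x ⊹ z) ⊹ bit τ ≡⟨ cong (_⊹ bit τ) e ⟩
          fun f x ⊹ w ⊹ bit τ ≡⟨ ⊹-assoc (fun f x) w (bit τ) ⟩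
          fun f x ⊹ (w ⊹ bit τ) ∎)
          where
          open ≡-Reasoning

        twist-both : ∀ {x y τ σ ℓ ℓ′} → (x , τ , ℓ) ≈ (y , σ , ℓ′) → (x , not τ , ℓ) ≈ (y , not σ , ℓ′)
        twist-both {x} {y} {τ} {σ} {ℓ} {ℓ′} r = subst₂ _≈_ (flip x τ ℓ) (flip y σ ℓ′) (≈-bit true r)
          where
          flip : ∀ x τ ℓ → (x , τ , ℓ) ⊹ bit true ≡ (x , not τ , ℓ)
          flip x τ ℓ = triple (identityʳ x) (xor-true τ) (Boolₚ.xor-identityʳ ℓ)
            where
            xor-true : ∀ τ → τ xor true ≡ not τ
            xor-true true = refl
            xor-true false = refl

        retwist : ∀ ε {x y τ σ ℓ ℓ′} → (x , τ , ℓ) ≈ (y , σ , ℓ′) → (x , τ xor ε , ℓ) ≈ (y , σ xor ε , ℓ′)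
        retwist ε {x} {y} {τ} {σ} {ℓ} {ℓ′} r = subst₂ _≈_ (add x τ ℓ) (add y σ ℓ′) (≈-bit ε r)
          where
          add : ∀ x τ ℓ → (x , τ , ℓ) ⊹ bit ε ≡ (x , τ xor ε , ℓ)
          add x τ ℓ = triple (identityʳ x) refl (Boolₚ.xor-identityʳ ℓ)

        -- The far end of the displacement is lifted by `u`, at the price of the unknown sign there.
        raise : ∀ {x w} → flat x ≈ w → ∃ λ ε → (x , false , true) ≈ (part w , ε , true)
        raise {x} {w} r@(related f z e) = twist w xor sign f (z ⊹ flat x) , related f z (begin
          fun f (z ⊹ (x , false , true)) ≡⟨ cong (λ y → fun f (z ⊹ y)) (triple (sym (identityʳ x)) refl refl) ⟩
          fun f (z ⊹ (flat x ⊹ u)) ≡⟨ cong (fun f) (⊹-assoc z (flat x) u) ⟨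
          fun f (z ⊹ flat x ⊹ u) ≡⟨ sign-spec f (z ⊹ flat x) ⟩
          fun f (z ⊹ flat x) ⊹ (0# , sign f (z ⊹ flat x) , true) ≡⟨ cong (_⊹ (0# , sign f (z ⊹ flat x) , true)) e ⟩
          fun f z ⊹ w ⊹ (0# , sign f (z ⊹ flat x) , true) ≡⟨ ⊹-assoc (fun f z) w _ ⟩
          fun f z ⊹ (w ⊹ (0# , sign f (z ⊹ flat x) , true)) ≡⟨ cong (fun f z ⊹_) (triple (identityʳ (part w)) refl (cong (_xor true) (sym (layer-closed r)))) ⟩
          fun f z ⊹ (part w , twist w xor sign f (z ⊹ flat x) , true) ∎)
          where
          open ≡-Reasoning

        -- If k = 1 + c maps x to its twisted translate, then k² maps x to an untwisted one;
        -- since 2 + c is a unit this untwisted translate generates the same coset.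
        untwist : ∀ {i x j τ ℓ} → ¬ J i x → J i j → (x , τ , ℓ) ≈ (x + j , not τ , ℓ) → (x , τ , ℓ) ≈ (x + j , τ , ℓ)
        untwist {i} {x} {j} {τ} {ℓ} ¬Jx Jj r with proper-multiple ¬Jx Jj
        ... | d , j≡ with unit p∤2+c
          where
          p∤2+c : p ∤ p ℕ.* (2 ℕ.* d) ℕ.+ 2
          p∤2+c p∣ = p∤2 (∣m+n∣m⇒∣n p∣ (∣m⇒∣m*n (2 ℕ.* d) ∣-refl))
            where open import Data.Nat.Divisibility using (∣-refl)
        ...   | n , n[2+c] = subst (λ y → (x , τ , ℓ) ≈ (x + y , τ , ℓ)) (n[2+c] j)
                (coset-⋆ ¬Jx (J-⋆ (c ℕ.+ 2) Jj) squared n)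
          where
          open ≡-Reasoning
          c k : ℕ
          c = p ℕ.* (2 ℕ.* d)
          k = suc c
          kx≡ : k ⋆ x ≡ x + j
          kx≡ = cong (x +_) (sym j≡)
          kkx≡ : k ⋆ k ⋆ x ≡ x + ((c ℕ.+ 2) ⋆ j)
          kkx≡ = begin
            (k ⋆ x) + (c ⋆ k ⋆ x) ≡⟨ cong₂ _+_ kx≡ (trans (cong (c ⋆_) kx≡) (×-distrib-+ x j c)) ⟩
            (x + j) + ((c ⋆ x) + (c ⋆ j)) ≡⟨ cong (λ y → (x + j) + (y + (c ⋆ j))) (sym j≡) ⟩
            (x + j) + (j + (c ⋆ j)) ≡⟨ solve 3 (λ x j y → (x :+ j) :+ (j :+ y) ⊜ x :+ (y :+ (j :+ (j :+ :0)))) refl x j (c ⋆ j) ⟩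
            x + ((c ⋆ j) + (2 ⋆ j)) ≡⟨ cong (x +_) (×-homo-+ j c 2) ⟨
            x + ((c ℕ.+ 2) ⋆ j) ∎
          squared : (x , τ , ℓ) ≈ (x + ((c ℕ.+ 2) ⋆ j) , τ , ℓ)
          squared = ≈-trans r (≈-trans (≈-reflexive (triple (sym kx≡) refl refl))
            (≈-trans (Unit-≈′ (Unit-1+2p d) (≈-trans (twist-both r) (≈-reflexive (triple (sym kx≡) (Boolₚ.not-involutive τ) refl))))
                     (≈-reflexive (triple kkx≡ refl refl))))

      -- Stages: signs constant on larger and larger J i.

      D : C → Set
      D x = S false x ≢ S true x

      D? : ∀ x → Dec (D x)
      D? x = ¬? (S false x Boolₚ.≟ S true x)

      ¬D⇒≡ : ∀ {x} → ¬ D x → S false x ≡ S true x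
      ¬D⇒≡ {x} ¬Dx with S false x Boolₚ.≟ S true x
      ... | yes e = e
      ... | no ¬e = ⊥-elim (¬Dx ¬e)

      opaque
        -- `D` is the set of points over which the connection set itself distinguishes the twists,
        -- so `halves` applies to `adj`.
        D-closed : ∀ {x w} → D x → flat x ≈ w → w ≡ flat (part w) × D (part w)
        D-closed Dx r with halves {adj} {true} adj-closed (λ {z} → in-layer z) Dx r
          where
          in-layer : ∀ z → adj z ≡ true → layer z ≡ true
          in-layer (_ , _ , true) _ = refl
        ... | y , refl , Dy = refl , Dy

        ¬D-0 : ¬ D 0#
        ¬D-0 D0 = D0 (adj-closed u≈v)

      Δ : Automorphism → G → C → C
      Δ f x j = part (move f x (flat j))

      -- tight: the sign of an automorphism is visible on J (suc i) modulo J i.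
      record Stage (i : ℕ) : Set where
        field
          closed : ∀ {x w} → J (suc i) x → flat x ≈ w → J (suc i) (part w)
          const  : ∀ f x {j} → J (suc i) j → sign f (x ⊹ flat j) ≡ sign f x
          tight  : ∀ f f′ x x′ → (∀ {j} → J (suc i) j → J i (Δ f x j + (- Δ f′ x′ j))) → sign f x ≡ sign f′ x′
          agree  : ∀ {x} → ¬ J (suc i) x → S false x ≡ S true x

      module Base {i} (top : ∀ {z} → D (part z) → J (suc i) (part z)) (d : C) (Dd : D d) (¬Jd : ¬ J i d) where

        private
          Q : G → Set
          Q z = z ≡ flat (part z) × D (part z)

        -- The element d generates `J (suc i)`, so x is a word in `D`; an automorphism moves it to
        -- another word in `D`, again without twist.
        flat-closed : ∀ {x w} → J (suc i) x → flat x ≈ w → J (suc i) (part w) × w ≡ flat (part w)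
        flat-closed {x} Jx r with generates Jx ¬Jd
        ... | n , x≡ = Span-⊆ {P = λ z → J (suc i) (part z) × z ≡ flat (part z)} (J-zero , refl)
              (λ (Jz , z≡) (Jw , w≡) → J-+ Jz Jw , cong₂ _⊹_ z≡ w≡) (λ {z} (z≡ , Dz) → top {z} Dz , z≡)
              (Span-closed (λ {z} {w} z≈w (z≡ , Dz) → D-closed Dz (subst (_≈ w) z≡ z≈w)) r
                (subst (Span Q) (trans (flat-⋆ n d) (cong flat (sym x≡))) (Span-⋆ n (Span-gen (refl , Dd)))))

        -- In the square x, x + u, x + u + j, x + j the two sides in direction j move without twist,
        -- so the two sides in direction u acquire the same twist.
        const : ∀ f x {j} → J (suc i) j → sign f (x ⊹ flat j) ≡ sign f x
        const f x {j} Jj = sign-unique f (x ⊹ flat j) (begin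
          fun f (x ⊹ flat j ⊹ u) ≡⟨ cong (fun f) (swap x (flat j) u) ⟩
          fun f (x ⊹ u ⊹ flat j) ≡⟨ move-spec f (x ⊹ u) (flat j) ⟩
          fun f (x ⊹ u) ⊹ j₂ ≡⟨ cong (_⊹ j₂) (sign-spec f x) ⟩
          fun f x ⊹ (0# , sign f x , true) ⊹ j₂ ≡⟨ difference-sum ⟩
          fun f (x ⊹ flat j) ⊹ ((0# , sign f x , true) ⊹ (j₂ ⊟ j₁)) ≡⟨ cong (fun f (x ⊹ flat j) ⊹_) (triple O-part twist-part layer≡) ⟩
          fun f (x ⊹ flat j) ⊹ (0# , sign f x , true) ∎)
          where
          open ≡-Reasoning
          swap : ∀ a c d → a ⊹ c ⊹ d ≡ a ⊹ d ⊹ c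
          swap = solveᴳ 3 (λ a c d → (a ∔ c) ∔ d ⊜ᴳ (a ∔ d) ∔ c) refl
          j₁ j₂ : G
          j₁ = move f x (flat j)
          j₂ = move f (x ⊹ u) (flat j)
          j₁-flat : j₁ ≡ flat (part j₁)
          j₁-flat = proj₂ (flat-closed Jj (≈-move f x (flat j)))
          j₂-flat : j₂ ≡ flat (part j₂)
          j₂-flat = proj₂ (flat-closed Jj (≈-move f (x ⊹ u) (flat j)))
          difference-sum : fun f x ⊹ (0# , sign f x , true) ⊹ j₂ ≡ fun f (x ⊹ flat j) ⊹ ((0# , sign f x , true) ⊹ (j₂ ⊟ j₁))
          difference-sum = trans (solveᴳ 4 (λ a c j₁ j₂ → (a ∔ c) ∔ j₂ ⊜ᴳ (a ∔ j₁) ∔ (c ∔ (j₂ ∸ j₁))) refl (fun f x) (0# , sign f x , true) j₁ j₂)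
            (cong (_⊹ ((0# , sign f x , true) ⊹ (j₂ ⊟ j₁))) (sym (move-spec f x (flat j))))
          total : (0# , sign f x , true) ⊹ (j₂ ⊟ j₁) ≡ move f (x ⊹ flat j) u
          total = difference (trans (trans (cong (fun f) (swap x (flat j) u)) (trans (move-spec f (x ⊹ u) (flat j)) (cong (_⊹ j₂) (sign-spec f x)))) difference-sum)
          O-part : 0# + part (j₂ ⊟ j₁) ≡ 0#
          O-part = trans (cong part total) (O-central (≈-move f (x ⊹ flat j) u))
          twist-part : sign f x xor twist (j₂ ⊟ j₁) ≡ sign f x
          twist-part = trans (cong (sign f x xor_) (cong₂ _xor_ (cong twist j₂-flat) (cong twist j₁-flat))) (Boolₚ.xor-identityʳ _)
          layer≡ : true xor layer (j₂ ⊟ j₁) ≡ true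
          layer≡ = trans (cong layer total) (O-layer (≈-move f (x ⊹ flat j) u))

        lift : ∀ f x {j d} → J (suc i) j → fun f (x ⊹ flat j) ≡ fun f x ⊹ flat d → (j , false , true) ≈ (d , sign f x , true)
        lift f x {j} {d} Jj e = related f x (begin
          fun f (x ⊹ (j , false , true)) ≡⟨ cong (λ y → fun f (x ⊹ y)) (triple (sym (identityʳ j)) refl refl) ⟩
          fun f (x ⊹ (flat j ⊹ u)) ≡⟨ cong (fun f) (sym (⊹-assoc x (flat j) u)) ⟩
          fun f (x ⊹ flat j ⊹ u) ≡⟨ sign-spec f (x ⊹ flat j) ⟩
          fun f (x ⊹ flat j) ⊹ (0# , sign f (x ⊹ flat j) , true) ≡⟨ cong₂ (λ w s → w ⊹ (0# , s , true)) e (const f x Jj) ⟩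
          fun f x ⊹ flat d ⊹ (0# , sign f x , true) ≡⟨ ⊹-assoc (fun f x) (flat d) _ ⟩
          fun f x ⊹ (flat d ⊹ (0# , sign f x , true)) ≡⟨ cong (fun f x ⊹_) (triple (identityʳ d) refl refl) ⟩
          fun f x ⊹ (d , sign f x , true) ∎)
          where open ≡-Reasoning

        -- Pull d back along f to j and push j forward along f′ to d′, which differs from d by an
        -- element of `J i`. Different signs would relate d and d′ in layer 1 with different twists;
        -- by `untwist` both twists of d′ would share an orbit, although d′ is in `D`.
        tight : ∀ f f′ x x′ → (∀ {j} → J (suc i) j → J i (Δ f x j + (- Δ f′ x′ j))) → sign f x ≡ sign f′ x′
        tight f f′ x x′ close with sign f x Boolₚ.≟ sign f′ x′
        ... | yes e = e
        ... | no e = ⊥-elim (Dd′ (agree-d′ (sign f x) (sign f′ x′) e twisted))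
          where
          w : G
          w = move (inverse f) (fun f x) (flat d)
          j : C
          j = part w
          w-flat : w ≡ flat j × D j
          w-flat = D-closed Dd (≈-move (inverse f) (fun f x) (flat d))
          Jj : J (suc i) j
          Jj = top {w} (proj₂ w-flat)
          f-j : fun f (x ⊹ flat j) ≡ fun f x ⊹ flat d
          f-j = trans (cong (fun f) (trans (cong₂ _⊹_ (sym (inv-fun f x)) (sym (proj₁ w-flat))) (sym (move-spec (inverse f) (fun f x) (flat d))))) (fun-inv f _)
          d′ : C
          d′ = Δ f′ x′ j
          d′-flat : move f′ x′ (flat j) ≡ flat d′ × D d′
          d′-flat = D-closed (proj₂ w-flat) (≈-move f′ x′ (flat j))
          Dd′ : D d′
          Dd′ = proj₂ d′-flat
          r : C
          r = d′ + (- d)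
          Jr : J i r
          Jr = subst (J i) (trans (cong (λ y → - (y + (- d′))) (cong part (sym (difference {fun f (x ⊹ flat j)} {fun f x} {flat d} f-j))))
                 (solve 2 (λ d d′ → :- (d :- d′) ⊜ d′ :- d) refl d d′)) (J-neg (close Jj))
          d+r : d + r ≡ d′
          d+r = solve 2 (λ d d′ → d :+ (d′ :- d) ⊜ d′) refl d d′
          twisted : (d , sign f x , true) ≈ (d + r , sign f′ x′ , true)
          twisted = ≈-trans (≈-sym (lift f x Jj f-j)) (≈-trans (lift f′ x′ Jj (trans (move-spec f′ x′ (flat j)) (cong (fun f′ x′ ⊹_) (proj₁ d′-flat))))
                      (≈-reflexive (triple (sym d+r) refl refl)))
          agree-d′ : ∀ τ σ → τ ≢ σ → (d , τ , true) ≈ (d + r , σ , true) → S false d′ ≡ S true d′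
          agree-d′ true true τ≢σ _ = ⊥-elim (τ≢σ refl)
          agree-d′ false false τ≢σ _ = ⊥-elim (τ≢σ refl)
          agree-d′ true false _ q = subst (λ y → S false y ≡ S true y) d+r (sym (adj-closed (≈-trans (≈-sym (untwist ¬Jd Jr q)) q)))
          agree-d′ false true _ q = subst (λ y → S false y ≡ S true y) d+r (adj-closed (≈-trans (≈-sym (untwist ¬Jd Jr q)) q))

        base : Stage i
        base = record
          { closed = λ Jx r → proj₁ (flat-closed Jx r)
          ; const = const
          ; tight = tight
          ; agree = λ {x} ¬Jx → ¬D⇒≡ λ Dx → ¬Jx (top {flat x} Dx) }

      module Step {i} (stage : Stage i) {x₁ j₁} (¬Jx₁ : ¬ J (suc i) x₁) (Jj₁ : J (suc i) j₁)
        (Sx₁ : S false x₁ ≡ true) (¬Sx₁j₁ : S false (x₁ + j₁) ≢ true) where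
        open Stage stage
        open import Data.Nat.Properties using (≤-trans; n≤1+n; ≰⇒>; _≤?_)

        x₁′ : G
        x₁′ = x₁ , false , true

        module Raised {i′} (top : ∀ {z} → x₁′ ≈ z → J (suc i′) (part z)) (a : G) (x₁≈a : x₁′ ≈ a) (¬Ja : ¬ J i′ (part a)) where

          x₀ : C
          x₀ = part a

          σ : Bool
          σ = twist a

          a≡ : a ≡ (x₀ , σ , true)
          a≡ = triple refl refl (sym (layer-closed x₁≈a))

          i<i′ : suc i ≤ i′
          i<i′ with suc i′ ≤? suc i
          ... | yes i′≤i = ⊥-elim (¬Jx₁ (J-≤ i′≤i (top ≈-refl)))
          ... | no i′≰i = s≤s⁻¹ (≰⇒> i′≰i)
            where open import Data.Nat using (s≤s⁻¹)

          ¬Jx₀ : ¬ J (suc i) x₀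
          ¬Jx₀ Jx₀ = ¬Ja (J-≤ i<i′ Jx₀)

          Sx₀ : S σ x₀ ≡ true
          Sx₀ = trans (sym (trans (adj-closed x₁≈a) (cong adj a≡))) Sx₁

          -- The missing point x₁ + j₁ is transported along with x₁. Outside `J (suc i)` the sets
          -- `S false` and `S true` agree, so its image is missing for both twists, whatever twist
          -- the transport adds.
          gap : ∃ λ j₀ → J (suc i) j₀ × ∀ τ → S τ (x₀ + j₀) ≢ true
          gap = part w , Jj₀ , missing
            where
            open _≈_ x₁≈a renaming (aut to h; base to z; moved to h-moved)
            w : G
            w = move h (z ⊹ x₁′) (flat j₁)
            Jj₀ : J (suc i) (part w)
            Jj₀ = closed Jj₁ (≈-move h (z ⊹ x₁′) (flat j₁))
            r : (x₁ + j₁ , false , true) ≈ (x₀ + part w , σ xor twist w , true)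
            r = related h z (begin
              fun h (z ⊹ (x₁′ ⊹ flat j₁)) ≡⟨ cong (fun h) (⊹-assoc z x₁′ (flat j₁)) ⟨
              fun h (z ⊹ x₁′ ⊹ flat j₁) ≡⟨ move-spec h (z ⊹ x₁′) (flat j₁) ⟩
              fun h (z ⊹ x₁′) ⊹ w ≡⟨ cong (_⊹ w) h-moved ⟩
              fun h z ⊹ a ⊹ w ≡⟨ ⊹-assoc (fun h z) a w ⟩
              fun h z ⊹ (a ⊹ w) ≡⟨ cong (fun h z ⊹_) (triple refl refl (cong₂ _xor_ (cong layer a≡) (sym (layer-closed (≈-move h (z ⊹ x₁′) (flat j₁)))))) ⟩
              fun h z ⊹ (x₀ + part w , σ xor twist w , true) ∎)
              where
              open ≡-Reasoning
            same : S false (x₀ + part w) ≡ S true (x₀ + part w)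
            same = agree λ Jsum → ¬Jx₀ (subst (J (suc i)) (solve 2 (λ x j → (x :+ j) :- j ⊜ x) refl x₀ (part w)) (J-+ Jsum (J-neg Jj₀)))
            pick-twist : ∀ {τ τ′} → S τ (x₀ + part w) ≡ true → S τ′ (x₀ + part w) ≡ true
            pick-twist {true} {true} e = e
            pick-twist {false} {false} e = e
            pick-twist {true} {false} e = trans same e
            pick-twist {false} {true} e = trans (sym same) e
            missing : ∀ τ → S τ (x₀ + part w) ≢ true
            missing τ Sτ = ¬Sx₁j₁ (trans (adj-closed r) (pick-twist Sτ))

          j₀ : C
          j₀ = proj₁ gap

          -- A ρ outside `J i` would have j₀ as a multiple. After a lift to layer 1 and `untwist`,
          -- the orbit of (x₀, σ, true) would contain all x₀ + n ρ, among them x₀ + j₀, which is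
          -- missing.
          confined : ∀ {ρ w} → J i′ ρ → flat x₀ ≈ w → part w ≡ x₀ + ρ → J i ρ
          confined {ρ} {w} Jρ r w≡ with J? i ρ
          ... | yes Jiρ = Jiρ
          ... | no ¬Jiρ with generates (proj₁ (proj₂ gap)) ¬Jiρ | raise r
          ...   | n , j₀≡ | ε , r′ = ⊥-elim (proj₂ (proj₂ gap) σ (trans (sym (adj-closed (at-σ (coset-⋆ ¬Ja Jρ (untwisted ε (subst (λ y → (x₀ , false , true) ≈ (y , ε , true)) w≡ r′)) n)))) Sx₀))
            where
            untwisted : ∀ ε → (x₀ , false , true) ≈ (x₀ + ρ , ε , true) → (x₀ , false , true) ≈ (x₀ + ρ , false , true)
            untwisted false q = q
            untwisted true q = untwist ¬Ja Jρ q
            at-σ : (x₀ , false , true) ≈ (x₀ + (n ⋆ ρ) , false , true) → (x₀ , σ , true) ≈ (x₀ + j₀ , σ , true)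
            at-σ q = ≈-trans (retwist σ q) (≈-reflexive (triple (cong (x₀ +_) (sym j₀≡)) refl refl))

          -- Moving out by g, shifting both ends by j and returning by the inverse of g takes x₀ to
          -- x₀ plus the difference of the two `Δ`. So `confined` puts this difference into `J i`,
          -- and `tight` equates the signs of the inverse at the two ends.
          const-x₀ : ∀ g w → sign g (w ⊹ flat x₀) ≡ sign g w
          const-x₀ g w = trans (sym (sign-inverse g (w ⊹ flat x₀))) (trans (tight f f x′ x close) (sign-inverse g w))
            where
            f : Automorphism
            f = inverse g
            x x′ : G
            x = fun g w
            x′ = fun g (w ⊹ flat x₀)
            close : ∀ {j} → J (suc i) j → J i (Δ f x′ j + (- Δ f x j))
            close {j} Jj = confined (J-≤ i<i′ (J-+ (closed Jj (≈-move f x′ (flat j))) (J-neg (closed Jj (≈-move f x (flat j)))))) r part-r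
              where
              y : G
              y = fun f (x′ ⊹ flat j) ⊟ fun f (x ⊹ flat j)
              r : flat x₀ ≈ y
              r = ≈-trans (subst (_≈ x′ ⊟ x) (solveᴳ 2 (λ w z → (w ∔ z) ∸ w ⊜ᴳ z) refl w (flat x₀)) (≈-difference g w (w ⊹ flat x₀)))
                (subst (_≈ y) (solveᴳ 3 (λ x′ x j → (x′ ∔ j) ∸ (x ∔ j) ⊜ᴳ x′ ∸ x) refl x′ x (flat j)) (≈-difference f (x ⊹ flat j) (x′ ⊹ flat j)))
              part-r : part y ≡ x₀ + (Δ f x′ j + (- Δ f x j))
              part-r = trans (solve 4 (λ p′ p q′ q → p′ :- p ⊜ (q′ :- q) :+ ((p′ :- q′) :- (p :- q))) refl
                  (part (fun f (x′ ⊹ flat j))) (part (fun f (x ⊹ flat j))) (part (fun f x′)) (part (fun f x)))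
                (cong (_+ (Δ f x′ j + (- Δ f x j))) (trans (cong₂ (λ c d → part c + (- part d)) (inv-fun g (w ⊹ flat x₀)) (inv-fun g w))
                  (solve 2 (λ w z → (w :+ z) :- w ⊜ z) refl (part w) x₀)))

          multiple : ∀ {x} → J (suc i′) x → ∃ λ n → x ≡ n ⋆ x₀
          multiple Jx = generates Jx ¬Ja

          const′ : ∀ f x {j} → J (suc i′) j → sign f (x ⊹ flat j) ≡ sign f x
          const′ f x Jj with multiple Jj
          ... | n , j≡ = trans (cong (λ j → sign f (x ⊹ flat j)) j≡) (go n)
            where
            go : ∀ n → sign f (x ⊹ flat (n ⋆ x₀)) ≡ sign f x
            go zero = sign-bit false f x
            go (suc n) = trans (cong (sign f) (solveᴳ 3 (λ x c d → x ∔ (c ∔ d) ⊜ᴳ (x ∔ d) ∔ c) refl x (flat x₀) (flat (n ⋆ x₀))))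
                           (trans (const-x₀ f (x ⊹ flat (n ⋆ x₀))) (go n))

          flat-x₀-top : ∀ {w} → flat x₀ ≈ w → J (suc i′) (part w)
          flat-x₀-top r with ≈-split a (0# , σ , true) (≈-trans (≈-reflexive split) r)
            where
            split : a ⊹ (0# , σ , true) ≡ flat x₀
            split = trans (cong (_⊹ (0# , σ , true)) a≡) (triple (identityʳ x₀) (Boolₚ.xor-same σ) refl)
          ... | w₁ , w₂ , w≡ , a≈w₁ , r₂ = subst (J (suc i′)) (sym (trans (cong part w≡) (trans (cong (part w₁ +_) (O-central (u-τ σ r₂))) (identityʳ _))))
                  (top (≈-trans x₁≈a a≈w₁))

          closed′ : ∀ {x w} → J (suc i′) x → flat x ≈ w → J (suc i′) (part w)
          closed′ Jx r with multiple Jx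
          ... | n , x≡ = Span-⊆ {Q = flat x₀ ≈_} {P = λ z → J (suc i′) (part z)} J-zero J-+ flat-x₀-top
                  (Span-closed (λ r s → ≈-trans s r) r (subst (Span (flat x₀ ≈_)) (trans (flat-⋆ n x₀) (cong flat (sym x≡))) (Span-⋆ n (Span-gen ≈-refl))))

          tight′ : ∀ f f′ x x′ → (∀ {j} → J (suc i′) j → J i′ (Δ f x j + (- Δ f′ x′ j))) → sign f x ≡ sign f′ x′
          tight′ f f′ x x′ close = tight f f′ x x′ close-below
            where
            -- Along the f-preimages of the progression f x + n x₀ the maps f and f′ differ by steps confined to J i.
            y : ℕ → G
            y n = inv f (fun f x ⊹ flat (n ⋆ x₀)) ⊟ x
            x+y : ∀ n → x ⊹ y n ≡ inv f (fun f x ⊹ flat (n ⋆ x₀))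
            x+y n = solveᴳ 2 (λ x w → x ∔ (w ∸ x) ⊜ᴳ w) refl x (inv f (fun f x ⊹ flat (n ⋆ x₀)))
            f-y : ∀ n → fun f (x ⊹ y n) ≡ fun f x ⊹ flat (n ⋆ x₀)
            f-y n = trans (cong (fun f) (x+y n)) (fun-inv f _)
            flat≈y : ∀ n → flat (n ⋆ x₀) ≈ y n
            flat≈y n = ≈-sym (related f x (f-y n))
            J-multiple : ∀ n → J (suc i′) (n ⋆ x₀)
            J-multiple n = J-⋆ n (top x₁≈a)
            Jy : ∀ n → J (suc i′) (part (y n))
            Jy n = closed′ (J-multiple n) (flat≈y n)
            y≡ : ∀ n → y n ≡ flat (part (y n)) ⊹ bit (twist (y n))
            y≡ n = triple (sym (identityʳ _)) refl (sym (layer-closed (flat≈y n)))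
            f-part : ∀ f x n → part (fun f (x ⊹ y n)) ≡ part (fun f (x ⊹ flat (part (y n))))
            f-part f x n = begin
              part (fun f (x ⊹ y n)) ≡⟨ cong (λ w → part (fun f (x ⊹ w))) (y≡ n) ⟩
              part (fun f (x ⊹ (flat (part (y n)) ⊹ bit (twist (y n))))) ≡⟨ cong (part ∘ fun f) (sym (⊹-assoc x (flat (part (y n))) (bit (twist (y n))))) ⟩
              part (fun f (x ⊹ flat (part (y n)) ⊹ bit (twist (y n)))) ≡⟨ cong part (bit-fixed (twist (y n)) f (x ⊹ flat (part (y n)))) ⟩
              part (fun f (x ⊹ flat (part (y n)))) + 0# ≡⟨ identityʳ _ ⟩
              part (fun f (x ⊹ flat (part (y n)))) ∎
              where open ≡-Reasoning
            -- How far f′ deviates from f at `y n`, where f moves by exactly n x₀.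
            E : ℕ → C
            E n = (part (fun f′ (x′ ⊹ y n)) + (- part (fun f′ x′))) + (- (n ⋆ x₀))
            E≡ : ∀ n → E n ≡ - (Δ f x (part (y n)) + (- Δ f′ x′ (part (y n))))
            E≡ n = trans (cong₂ (λ c d → (c + (- part (fun f′ x′))) + (- d)) (f-part f′ x′ n)
                (trans (solve 2 (λ c d → d ⊜ (c :+ d) :- c) refl (part (fun f x)) (n ⋆ x₀)) (cong (_+ (- part (fun f x))) (trans (sym (cong part (f-y n))) (f-part f x n)))))
              (solve 4 (λ q′ p′ q p → (q′ :- p′) :- (q :- p) ⊜ :- ((q :- p) :- (q′ :- p′))) refl
                (part (fun f′ (x′ ⊹ flat (part (y n))))) (part (fun f′ x′)) (part (fun f (x ⊹ flat (part (y n))))) (part (fun f x)))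
            E-J′ : ∀ n → J i′ (E n)
            E-J′ n = subst (J i′) (sym (E≡ n)) (J-neg (close (Jy n)))
            E-J : ∀ n → J i (E n)
            E-J zero = subst (J i) (sym E-0) J-zero
              where
              y0≡ : x′ ⊹ y 0 ≡ x′
              y0≡ = trans (cong (λ w → x′ ⊹ (w ⊟ x)) (trans (cong (inv f) (solveᴳ 1 (λ a → a ∔ ∅ ⊜ᴳ a) refl (fun f x))) (inv-fun f x)))
                      (solveᴳ 2 (λ x′ x → x′ ∔ (x ∸ x) ⊜ᴳ x′) refl x′ x)
              E-0 : E 0 ≡ 0#
              E-0 = trans (cong (λ w → (part (fun f′ w) + (- part (fun f′ x′))) + (- 0#)) y0≡)
                      (solve 1 (λ c → (c :- c) :- :0 ⊜ :0) refl (part (fun f′ x′)))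
            E-J (suc n) = subst (J i) (solve 2 (λ c d → c :+ (d :- c) ⊜ d) refl (E n) (E (suc n))) (J-+ (E-J n) (confined Jρ r part-r))
              where
              ρ : C
              ρ = E (suc n) + (- E n)
              Jρ : J i′ ρ
              Jρ = J-+ (E-J′ (suc n)) (J-neg (E-J′ n))
              w : G
              w = fun f′ (x′ ⊹ y (suc n)) ⊟ fun f′ (x′ ⊹ y n)
              r : flat x₀ ≈ w
              r = ≈-trans (≈-sym (subst₂ _≈_ (solveᴳ 3 (λ x y y′ → (x ∔ y′) ∸ (x ∔ y) ⊜ᴳ y′ ∸ y) refl x (y n) (y (suc n)))
                    (trans (cong₂ _⊟_ (f-y (suc n)) (f-y n)) (solveᴳ 3 (λ c d d′ → (c ∔ (d ∔ d′)) ∸ (c ∔ d′) ⊜ᴳ d) refl (fun f x) (flat x₀) (flat (n ⋆ x₀))))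
                    (≈-difference f (x ⊹ y n) (x ⊹ y (suc n)))))
                  (subst (_≈ w) (solveᴳ 3 (λ x y y′ → (x ∔ y′) ∸ (x ∔ y) ⊜ᴳ y′ ∸ y) refl x′ (y n) (y (suc n))) (≈-difference f′ (x′ ⊹ y n) (x′ ⊹ y (suc n))))
              part-r : part w ≡ x₀ + ρ
              part-r = solve 5 (λ q′ q c s t → q′ :- q ⊜ s :+ (((q′ :- c) :- (s :+ t)) :- ((q :- c) :- t))) refl
                (part (fun f′ (x′ ⊹ y (suc n)))) (part (fun f′ (x′ ⊹ y n))) (part (fun f′ x′)) x₀ (n ⋆ x₀)
            close-below : ∀ {j} → J (suc i) j → J i (Δ f x j + (- Δ f′ x′ j))
            -- `Δ f x j` is some n x₀, so j is `y n` up to a bit, which does not affect parts; hence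
            -- the wanted difference is -E n.
            close-below {j} Jj with multiple (J-≤ (≤-trans i<i′ (n≤1+n i′)) (closed Jj (≈-move f x (flat j))))
            ... | n , Δ≡ = subst (J i) E≡Δ (J-neg (E-J n))
              where
              open ≡-Reasoning
              ε : Bool
              ε = twist (move f x (flat j))
              moved : move f x (flat j) ≡ flat (n ⋆ x₀) ⊹ bit ε
              moved = triple (trans Δ≡ (sym (identityʳ _))) refl (sym (layer-closed (≈-move f x (flat j))))
              y-n : y n ≡ flat j ⊹ bit ε
              y-n = trans (cong (_⊟ x) (trans (cong (inv f) (begin
                  fun f x ⊹ flat (n ⋆ x₀) ≡⟨ solveᴳ 3 (λ c d e → c ∔ d ⊜ᴳ (c ∔ (d ∔ e)) ∸ e) refl (fun f x) (flat (n ⋆ x₀)) (bit ε) ⟩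
                  (fun f x ⊹ (flat (n ⋆ x₀) ⊹ bit ε)) ⊟ bit ε ≡⟨ cong (λ w → (fun f x ⊹ w) ⊟ bit ε) moved ⟨
                  (fun f x ⊹ move f x (flat j)) ⊟ bit ε ≡⟨ cong (_⊟ bit ε) (move-spec f x (flat j)) ⟨
                  fun f (x ⊹ flat j) ⊟ bit ε ≡⟨ cong (fun f (x ⊹ flat j) ⊹_) (triple (solve 0 (:- :0 ⊜ :0) refl) refl refl) ⟩
                  fun f (x ⊹ flat j) ⊹ bit ε ≡⟨ bit-fixed ε f (x ⊹ flat j) ⟨
                  fun f (x ⊹ flat j ⊹ bit ε) ∎)) (inv-fun f _)))
                (solveᴳ 3 (λ x j e → ((x ∔ j) ∔ e) ∸ x ⊜ᴳ j ∔ e) refl x (flat j) (bit ε))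
              E≡Δ : - E n ≡ Δ f x j + (- Δ f′ x′ j)
              E≡Δ = begin
                - E n ≡⟨ cong -_ (E≡ n) ⟩
                - (- (Δ f x (part (y n)) + (- Δ f′ x′ (part (y n))))) ≡⟨ solve 1 (λ c → :- (:- c) ⊜ c) refl _ ⟩
                Δ f x (part (y n)) + (- Δ f′ x′ (part (y n))) ≡⟨ cong (λ k → Δ f x k + (- Δ f′ x′ k)) (trans (cong part y-n) (identityʳ j)) ⟩
                Δ f x j + (- Δ f′ x′ j) ∎

          raised : Stage i′
          raised = record
            { closed = closed′
            ; const = const′
            ; tight = tight′
            ; agree = λ ¬Jx → agree (¬Jx ∘ J-≤ (≤-trans i<i′ (n≤1+n i′))) }

        step : ∃ λ i′ → suc i ≤ i′ × Stage i′
        step with level (x₁′ ≈?_)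
        ... | 0 , trivial top = ⊥-elim (¬Jx₁ (J-≤ z≤n (top ≈-refl)))
        ... | suc i′ , exact top a x₁≈a ¬Ja = i′ , Raised.i<i′ top a x₁≈a ¬Ja , Raised.raised top a x₁≈a ¬Ja

      -- Stated for `S false`, with which `S true` coincides outside `J (suc i)` by `agree`.
      Periodic : ℕ → Set
      Periodic i = ∀ {x j} → ¬ J (suc i) x → J (suc i) j → S false x ≡ true → S false (x + j) ≡ true

      opaque
        -- Each failure of periodicity raises the index. Once it reaches e there is nothing outside
        -- `J (suc i)`, so e rounds suffice.
        ascend : ∀ {i} → Stage i → ∃ λ i′ → Stage i′ × Periodic i′
        ascend {i} stage = go e (m≤m+n e i) stage
          where
          open import Data.Nat.Properties using (m≤m+n; ≤-trans; +-monoʳ-≤; +-suc; ≤-reflexive)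
          witness? : ∀ i → Dec (∃₂ λ x j → ¬ J (suc i) x × J (suc i) j × S false x ≡ true × S false (x + j) ≢ true)
          witness? i = ∃? λ x → ∃? λ j → ¬? (J? (suc i) x) ×-dec J? (suc i) j ×-dec (S false x Boolₚ.≟ true) ×-dec ¬? (S false (x + j) Boolₚ.≟ true)
          go : ∀ n {i} → e ≤ n ℕ.+ i → Stage i → ∃ λ i′ → Stage i′ × Periodic i′
          go zero {i} e≤i stage = i , stage , λ ¬Jx _ _ → ⊥-elim (¬Jx (J-top (≤-trans e≤i (n≤1+n i))))
            where open import Data.Nat.Properties using (n≤1+n)
          go (suc n) {i} e≤ stage with witness? i
          ... | no ∄ = i , stage , λ {x} {j} ¬Jx Jj Sx → decidable-stable (S false (x + j) Boolₚ.≟ true) λ ¬Sxj → ∄ (x , j , ¬Jx , Jj , Sx , ¬Sxj)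
            where open import Relation.Nullary.Decidable using (decidable-stable)
          ... | yes (x , j , ¬Jx , Jj , Sx , ¬Sxj) with Step.step stage ¬Jx Jj Sx ¬Sxj
          ...   | i′ , i<i′ , stage′ = go n (≤-trans e≤ (≤-trans (≤-reflexive (sym (+-suc n i))) (+-monoʳ-≤ n i<i′))) stage′

      -- Gluing the isomorphism from Cay(H, S) to Cay(H, S b).

      module Switch {i} (stage : Stage i) (periodic : Periodic i) where
        open Stage stage

        opaque
          -- The witness of `u ≈ v`, normalised by translations to fix 0. Its sign is twisted at 0,
          -- hence by `const` on all of `J (suc i)`.
          centre : Automorphism
          centre = translation (⊖ fun aut base) ∘ᴬ aut ∘ᴬ translation base
            where open _≈_ u≈v

          centre-spec : fun centre 𝟘 ≡ 𝟘 × fun centre u ≡ v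
          centre-spec = trans (cong (λ w → fun f w ⊟ fun f x) (solveᴳ 1 (λ x → ∅ ∔ x ⊜ᴳ x) refl x)) (solveᴳ 1 (λ c → c ∸ c ⊜ᴳ ∅) refl (fun f x))
            , trans (cong (λ w → fun f w ⊟ fun f x) (solveᴳ 2 (λ u x → u ∔ x ⊜ᴳ x ∔ u) refl u x)) (trans (cong (_⊟ fun f x) h-moved)
                (solveᴳ 2 (λ c v → (c ∔ v) ∸ c ⊜ᴳ v) refl (fun f x) v))
            where open _≈_ u≈v renaming (aut to f; base to x; moved to h-moved)

        f : G → G
        f = fun centre

        f⁻¹ : G → G
        f⁻¹ = inv centre

        ≈-f : ∀ z → z ≈ f z
        ≈-f z = subst₂ _≈_ (solveᴳ 1 (λ z → z ∸ ∅ ⊜ᴳ z) refl z)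
          (trans (cong (f z ⊟_) (proj₁ centre-spec)) (solveᴳ 1 (λ z → z ∸ ∅ ⊜ᴳ z) refl (f z))) (≈-difference centre 𝟘 z)

        Local : G → Set
        Local z = J (suc i) (part z) × layer z ≡ false

        Local≡ : ∀ {z} → Local z → z ≡ flat (part z) ⊹ bit (twist z)
        Local≡ (_ , flat-z) = triple (sym (identityʳ _)) refl flat-z

        Local-≈ : ∀ {z w} → Local z → z ≈ w → Local w
        Local-≈ {z} {w} Lz@(Jz , flat-z) r with ≈-split (flat (part z)) (bit (twist z)) (≈-trans (≈-reflexive (sym (Local≡ Lz))) r)
        ... | w₁ , w₂ , w≡ , r₁ , r₂ = subst (J (suc i)) (sym (trans (cong part w≡) (trans (cong (part w₁ +_) (bit-part (twist z) r₂)) (identityʳ _)))) (closed Jz r₁)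
            , trans (sym (layer-closed r)) flat-z
          where
          bit-part : ∀ τ {w} → bit τ ≈ w → part w ≡ 0#
          bit-part τ {w} (related f x e) = trans (cong part (difference {fun f (x ⊹ bit τ)} {fun f x} {w} e)) (trans (cong (λ w → part (w ⊟ fun f x)) (bit-fixed τ f x))
            (solve 1 (λ c → (c :+ :0) :- c ⊜ :0) refl (part (fun f x))))

        f-twisted : ∀ {z} → Local z → f (z ⊹ u) ≡ f z ⊹ v
        f-twisted {z} Lz = trans (sign-spec centre z) (cong (λ s → f z ⊹ (0# , s , true)) sign≡)
          where
          open ≡-Reasoning
          sign≡ : sign centre z ≡ true
          sign≡ = begin
            sign centre z ≡⟨ cong (sign centre) (trans (Local≡ Lz) (cong (_⊹ bit (twist z)) (solveᴳ 1 (λ z → z ⊜ᴳ ∅ ∔ z) refl (flat (part z))))) ⟩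
            sign centre (𝟘 ⊹ flat (part z) ⊹ bit (twist z)) ≡⟨ sign-bit (twist z) centre (𝟘 ⊹ flat (part z)) ⟩
            sign centre (𝟘 ⊹ flat (part z)) ≡⟨ const centre 𝟘 (proj₁ Lz) ⟩
            sign centre 𝟘 ≡⟨ sign-unique centre 𝟘 (trans (cong f (solveᴳ 1 (λ u → ∅ ∔ u ⊜ᴳ u) refl u))
                                                                       (trans (proj₂ centre-spec) (trans (solveᴳ 1 (λ v → v ⊜ᴳ ∅ ∔ v) refl v) (cong (_⊹ v) (sym (proj₁ centre-spec)))))) ⟩
            true ∎

        q : ℕ
        q = p ℕ.^ suc i

        -- q ⋆ x determines the coset of x modulo J (suc i), so choosing a root of it picks a transversal.
        root : C → C
        root κ with ∃? (λ y → (q ⋆ y) ≟ κ)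
        ... | yes (y , _) = y
        ... | no _ = 0#

        root-spec : ∀ x → q ⋆ root (q ⋆ x) ≡ q ⋆ x
        root-spec x with ∃? (λ y → (q ⋆ y) ≟ (q ⋆ x))
        ... | yes (y , e) = e
        ... | no ∄ = ⊥-elim (∄ (x , refl))

        rep : G → G
        rep z = root (q ⋆ part z) , false , layer z

        offset : G → G
        offset z = z ⊟ rep z

        Local-offset : ∀ z → Local (offset z)
        Local-offset z = torsion-by (trans (×-distrib-+ (part z) _ q) (trans (cong ((q ⋆ part z) +_) (trans (⋆-neg q _) (cong -_ (root-spec (part z)))))
            (solve 1 (λ c → c :- c ⊜ :0) refl (q ⋆ part z)))) , Boolₚ.xor-same (layer z)

        rep-offset : ∀ z → rep z ⊹ offset z ≡ z
        rep-offset z = solveᴳ 2 (λ r z → r ∔ (z ∸ r) ⊜ᴳ z) refl (rep z) z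

        rep-coset : ∀ {z w} → J (suc i) (part z + (- part w)) → layer z ≡ layer w → rep z ≡ rep w
        rep-coset {z} {w} (torsion-by qd) ℓ≡ = triple (cong root (begin
            q ⋆ part z ≡⟨ cong (q ⋆_) (solve 2 (λ a c → a ⊜ (a :- c) :+ c) refl (part z) (part w)) ⟩
            q ⋆ ((part z + (- part w)) + part w) ≡⟨ ×-distrib-+ _ (part w) q ⟩
            (q ⋆ (part z + (- part w))) + (q ⋆ part w) ≡⟨ cong (_+ (q ⋆ part w)) qd ⟩
            0# + (q ⋆ part w) ≡⟨ identityˡ _ ⟩
            q ⋆ part w ∎)) refl ℓ≡
          where open ≡-Reasoning

        along : (G → G) → G → G
        along g z = rep z ⊹ g (offset z)

        along-rep : ∀ {g} → (∀ {z} → Local z → Local (g z)) → ∀ z → rep (along g z) ≡ rep z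
        along-rep {g} Lg z = rep-coset {along g z} {z} (subst (J (suc i)) (solve 3 (λ r a c → a :- (c :- r) ⊜ (r :+ a) :- c) refl (part (rep z)) (part (g (offset z))) (part z))
            (J-+ (proj₁ (Lg (Local-offset z))) (J-neg (proj₁ (Local-offset z)))))
          (trans (cong (layer z xor_) (proj₂ (Lg (Local-offset z)))) (Boolₚ.xor-identityʳ _))

        along-inverse : ∀ {g g⁻¹} → (∀ {z} → Local z → Local (g z)) → (∀ z → g⁻¹ (g z) ≡ z) → ∀ z → along g⁻¹ (along g z) ≡ z
        along-inverse {g} {g⁻¹} Lg inverse z = begin
          rep (along g z) ⊹ g⁻¹ (along g z ⊟ rep (along g z)) ≡⟨ cong (λ r → r ⊹ g⁻¹ (along g z ⊟ r)) (along-rep {g} (λ {y} → Lg {y}) z) ⟩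
          rep z ⊹ g⁻¹ (along g z ⊟ rep z) ≡⟨ cong (λ w → rep z ⊹ g⁻¹ w) (solveᴳ 2 (λ r w → (r ∔ w) ∸ r ⊜ᴳ w) refl (rep z) (g (offset z))) ⟩
          rep z ⊹ g⁻¹ (g (offset z)) ≡⟨ cong (rep z ⊹_) (inverse (offset z)) ⟩
          rep z ⊹ offset z ≡⟨ rep-offset z ⟩
          z ∎
          where open ≡-Reasoning

        Local-f : ∀ {z} → Local z → Local (f z)
        Local-f {z} Lz = Local-≈ Lz (≈-f z)

        Local-f⁻¹ : ∀ {z} → Local z → Local (f⁻¹ z)
        Local-f⁻¹ {z} Lz = Local-≈ Lz (≈-sym (subst (f⁻¹ z ≈_) (fun-inv centre z) (≈-f (f⁻¹ z))))

        γ : G → G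
        γ = along f

        -- Both points have the same representative, so this concerns `centre` on `J (suc i)` only;
        -- being twisted there, it turns a step by `u` into a step by u + b.
        near : ∀ z w → J (suc i) (part w + (- part z)) → layer z ≡ layer w → adj ((w ⊟ z) ⊹ u) ≡ adj ((γ w ⊟ γ z) ⊹ (u ⊹ b))
        near z w Jd ℓ≡ = begin
          adj ((w ⊟ z) ⊹ u) ≡⟨ cong adj (trans (cong₂ (λ z w → (w ⊟ z) ⊹ u) (sym (rep-offset z)) (sym (trans (cong (_⊹ offset w) same) (rep-offset w))))
                                                                          (solveᴳ 4 (λ r z w u → ((r ∔ w) ∸ (r ∔ z)) ∔ u ⊜ᴳ (w ∔ u) ∸ z) refl (rep z) (offset z) (offset w) u)) ⟩
          adj ((offset w ⊹ u) ⊟ offset z) ≡⟨ adj-pres centre (offset z) (offset w ⊹ u) ⟨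
          adj (f (offset w ⊹ u) ⊟ f (offset z)) ≡⟨ cong (λ y → adj (y ⊟ f (offset z))) (f-twisted (Local-offset w)) ⟩
          adj ((f (offset w) ⊹ v) ⊟ f (offset z)) ≡⟨ cong adj (solveᴳ 4 (λ r z w v → (w ∔ v) ∸ z ⊜ᴳ ((r ∔ w) ∸ (r ∔ z)) ∔ v) refl (rep z) (f (offset z)) (f (offset w)) v) ⟩
          adj (((rep z ⊹ f (offset w)) ⊟ γ z) ⊹ v) ≡⟨ cong₂ (λ r y → adj (((r ⊹ f (offset w)) ⊟ γ z) ⊹ y)) same (triple (sym (identityʳ 0#)) refl refl) ⟩
          adj ((γ w ⊟ γ z) ⊹ (u ⊹ b)) ∎
          where
          open ≡-Reasoning
          same : rep z ≡ rep w
          same = rep-coset {z} {w} (subst (J (suc i)) (solve 2 (λ a c → :- (a :- c) ⊜ c :- a) refl (part w) (part z)) (J-neg Jd)) ℓ≡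

        -- Outside `J (suc i)` the two twists have the same connection set, a union of cosets of
        -- `J (suc i)`, and `γ` changes displacements only within such a coset.
        far : ∀ z w → ¬ J (suc i) (part w + (- part z)) → layer z ≡ layer w → adj ((w ⊟ z) ⊹ u) ≡ adj ((γ w ⊟ γ z) ⊹ (u ⊹ b))
        far z w ¬Jd ℓ≡ = trans (adj-untwisted ((w ⊟ z) ⊹ u) ¬J₁ layer₁) (trans (boolean-ext forth back) (sym (adj-untwisted ((γ w ⊟ γ z) ⊹ (u ⊹ b)) ¬J₂ layer₂)))
          where
          d d′ j : C
          d = part w + (- part z)
          d′ = part (γ w) + (- part (γ z))
          j = d′ + (- d)
          adj-untwisted : ∀ y → ¬ J (suc i) (part y) → layer y ≡ true → adj y ≡ S false (part y)
          adj-untwisted (x , false , true) _ refl = refl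
          adj-untwisted (x , true , true) ¬J refl = sym (agree ¬J)
          displacement : ∀ z → J (suc i) (part (γ z) + (- part z))
          displacement z = subst (J (suc i)) (solve 3 (λ r a c → a :- (c :- r) ⊜ (r :+ a) :- c) refl (part (rep z)) (part (f (offset z))) (part z))
            (J-+ (proj₁ (Local-f (Local-offset z))) (J-neg (proj₁ (Local-offset z))))
          Jj : J (suc i) j
          Jj = subst (J (suc i)) (solve 4 (λ w′ w z′ z → (w′ :- w) :- (z′ :- z) ⊜ (w′ :- z′) :- (w :- z)) refl (part (γ w)) (part w) (part (γ z)) (part z))
            (J-+ (displacement w) (J-neg (displacement z)))
          part₁ : part ((w ⊟ z) ⊹ u) ≡ d
          part₁ = identityʳ d
          part₂ : part ((γ w ⊟ γ z) ⊹ (u ⊹ b)) ≡ d′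
          part₂ = trans (cong (d′ +_) (identityˡ 0#)) (identityʳ d′)
          d+j : d + j ≡ d′
          d+j = solve 2 (λ d d′ → d :+ (d′ :- d) ⊜ d′) refl d d′
          ¬Jd′ : ¬ J (suc i) d′
          ¬Jd′ Jd′ = ¬Jd (subst (J (suc i)) (solve 2 (λ d d′ → d′ :- (d′ :- d) ⊜ d) refl d d′) (J-+ Jd′ (J-neg Jj)))
          ¬J₁ : ¬ J (suc i) (part ((w ⊟ z) ⊹ u))
          ¬J₁ = ¬Jd ∘ subst (J (suc i)) part₁
          ¬J₂ : ¬ J (suc i) (part ((γ w ⊟ γ z) ⊹ (u ⊹ b)))
          ¬J₂ = ¬Jd′ ∘ subst (J (suc i)) part₂
          layer₁ : (layer w xor layer z) xor true ≡ true
          layer₁ = cong (_xor true) (trans (cong (layer w xor_) ℓ≡) (Boolₚ.xor-same (layer w)))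
          layer₂ : layer ((γ w ⊟ γ z) ⊹ (u ⊹ b)) ≡ true
          layer₂ = cong (_xor true) (trans (cong₂ _xor_ (cong layer (along-rep {f} (λ {y} → Local-f {y}) w)) (trans (cong layer (along-rep {f} (λ {y} → Local-f {y}) z)) ℓ≡)) (Boolₚ.xor-same (layer w)))
          forth : S false (part ((w ⊟ z) ⊹ u)) ≡ true → S false (part ((γ w ⊟ γ z) ⊹ (u ⊹ b))) ≡ true
          forth e = subst (λ y → S false y ≡ true) (trans d+j (sym part₂)) (periodic ¬Jd Jj (subst (λ y → S false y ≡ true) part₁ e))
          back : S false (part ((γ w ⊟ γ z) ⊹ (u ⊹ b))) ≡ true → S false (part ((w ⊟ z) ⊹ u)) ≡ true
          back e = subst (λ y → S false y ≡ true) (trans (solve 2 (λ d d′ → d′ :- (d′ :- d) ⊜ d) refl d d′) (sym part₁))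
            (periodic ¬Jd′ (J-neg Jj) (subst (λ y → S false y ≡ true) part₂ e))

        twist-iso : Twist
        twist-iso = record
          { γ = γ ; γ⁻¹ = along f⁻¹
          ; γ-γ⁻¹ = along-inverse {f⁻¹} {f} (λ {z} → Local-f⁻¹ {z}) (fun-inv centre)
          ; γ⁻¹-γ = along-inverse {f} {f⁻¹} (λ {z} → Local-f {z}) (inv-fun centre)
          ; γ-layer = λ z → cong layer (along-rep {f} (λ {y} → Local-f {y}) z)
          ; γ-adj = γ-adj }
          where
          γ-adj : ∀ z w → layer z ≡ layer w → adj ((w ⊟ z) ⊹ u) ≡ adj ((γ w ⊟ γ z) ⊹ (u ⊹ b))
          γ-adj z w ℓ≡ with J? (suc i) (part w + (- part z))
          ... | yes Jd = near z w Jd ℓ≡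
          ... | no ¬Jd = far z w ¬Jd ℓ≡

      opaque
        twisting : Twist
        twisting with level {λ z → D (part z)} (λ z → D? (part z))
        -- `D` is contained in {0} and misses 0, so S b = S and the identity will do.
        ... | 0 , trivial top = record
          { γ = λ z → z ; γ⁻¹ = λ z → z ; γ-γ⁻¹ = λ _ → refl ; γ⁻¹-γ = λ _ → refl ; γ-layer = λ _ → refl
          ; γ-adj = λ z w _ → untwisted (w ⊟ z) }
          where
          S-equal : ∀ x → S false x ≡ S true x
          S-equal x = ¬D⇒≡ λ Dx → ¬D-0 (subst D (J-0 (top {flat x} Dx)) Dx)
          untwisted : ∀ y → adj (y ⊹ u) ≡ adj (y ⊹ (u ⊹ b))
          untwisted (x , τ , ℓ) = go τ ℓ
            where
            go : ∀ τ ℓ → adj ((x , τ , ℓ) ⊹ u) ≡ adj ((x , τ , ℓ) ⊹ (u ⊹ b))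
            go τ true = refl
            go false false = trans (S-equal _) (cong (λ y → S true (x + y)) (sym (identityˡ 0#)))
            go true false = trans (sym (S-equal _)) (cong (λ y → S false (x + y)) (sym (identityˡ 0#)))
        ... | suc i , exact top d Dd ¬Jd with ascend (Base.base (λ {z} → top {z}) (part d) Dd ¬Jd)
        ...   | i′ , stage , periodic = Switch.twist-iso stage periodic

open import Defs

-- Stability and abstract isomorphism of the groups.

module Stability {k} (Adj : Fin (suc k) → Fin (suc k) → Set) where
  open import Data.Bool.Properties using (xor-assoc; xor-comm; xor-same; xor-identityʳ)

  Γ : Graph
  Γ = record { V = Fin (suc k) ; E = Adj }

  Δ : Graph
  Δ = Γ ×K₂

  xor-injectiveʳ : ∀ c {a b} → a xor c ≡ b xor c → a ≡ b
  xor-injectiveʳ true {true} {true} _ = refl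
  xor-injectiveʳ true {false} {false} _ = refl
  xor-injectiveʳ false {a} {b} e = trans (sym (xor-identityʳ a)) (trans e (xor-identityʳ b))

  xor-cancel : ∀ i c → (i xor c) xor c ≡ i
  xor-cancel i c = trans (xor-assoc i c c) (trans (cong (i xor_) (xor-same c)) (xor-identityʳ i))

  standard : AutZ₂ Γ → Aut Δ
  standard (α , c) = record
    { to = λ (x , i) → to α x , i xor c
    ; from = λ (x , i) → from α x , i xor c
    ; from-to = λ (x , i) → cong₂ _,_ (from-to α x) (xor-cancel i c)
    ; to-from = λ (x , i) → cong₂ _,_ (to-from α x) (xor-cancel i c)
    ; pres = λ x y (e , i≢j) → pres α _ _ e , λ q → i≢j (xor-injectiveʳ c q)
    ; refl' = λ x y (e , i≢j) → refl' α _ _ e , λ q → i≢j (cong (_xor c) q) }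

  module Rigid (AI : AutIso Γ) where
    open AutIso AI

    _≃_ : AutZ₂ Γ → AutZ₂ Γ → Set
    _≃_ = _≈P_ {Γ}

    ρ : AutZ₂ Γ → AutZ₂ Γ
    ρ a = φ (standard a)

    ρ-injective : ∀ {a b} → ρ a ≃ ρ b → a ≃ b
    ρ-injective {a} {b} r = (λ x → cong proj₁ (same (x , false))) , cong proj₂ (same (Fin.zero , false))
      where
      same : ∀ x → to (standard a) x ≡ to (standard b) x
      same = inj (standard a) (standard b) r

    power : ℕ → AutZ₂ Γ → AutZ₂ Γ
    power zero a = a
    power (suc n) a = ρ (power n a)

    power-cancel : ∀ i j {a} → power i a ≃ power (i ℕ.+ suc j) a → a ≃ ρ (power j a)
    power-cancel zero j r = r
    power-cancel (suc i) j r = power-cancel i j (ρ-injective r)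

    states : ℕ
    states = (suc k ℕ.^ suc k) ℕ.* 2

    code : AutZ₂ Γ → Fin states
    code (α , c) = Fin.combine (Fin.funToFin (to α)) (if c then Fin.suc Fin.zero else Fin.zero)
      where open import Data.Bool using (if_then_else_)

    code-injective : ∀ {a b} → code a ≡ code b → a ≃ b
    code-injective {α , c} {β , d} e with combine-injective (Fin.funToFin (to α)) _ (Fin.funToFin (to β)) _ e
      where open import Data.Fin.Properties using (combine-injective)
    ... | e₁ , e₂ = (λ x → trans (sym (finToFun-funToFin (to α) x)) (trans (cong (λ f → Fin.finToFun f x) e₁) (finToFun-funToFin (to β) x))) , bits c d e₂
      where
      open import Data.Fin.Properties using (finToFun-funToFin)
      open import Data.Bool using (if_then_else_)
      bits : ∀ c d → (if c then Fin.suc {n = 1} Fin.zero else Fin.zero) ≡ (if d then Fin.suc Fin.zero else Fin.zero) → c ≡ d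
      bits true true _ = refl
      bits false false _ = refl
      bits true false ()
      bits false true ()

    -- ρ is an injective self-map of a finite set, so every orbit of ρ returns to its start.
    recurrent : ∀ a → ∃ λ j → a ≃ ρ (power j a)
    recurrent a with pigeonhole {states} {suc states} (s≤s ≤-refl) (λ i → code (power (Fin.toℕ i) a))
      where
      open import Data.Fin.Properties using (pigeonhole)
      open import Data.Nat.Properties using (≤-refl)
    ... | i , j , i<j , e = d , power-cancel (Fin.toℕ i) d (subst (λ n → power (Fin.toℕ i) a ≃ power n a) (sym i+d≡j) (code-injective {power (Fin.toℕ i) a} {power (Fin.toℕ j) a} e))
      where
      open import Data.Nat.Properties using (m+[n∸m]≡n; +-suc)
      d : ℕ
      d = Fin.toℕ j ℕ.∸ suc (Fin.toℕ i)
      i+d≡j : Fin.toℕ i ℕ.+ suc d ≡ Fin.toℕ j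
      i+d≡j = trans (+-suc _ d) (m+[n∸m]≡n i<j)

    -- An abstract `φ` need not send standard automorphisms to the evident pairs. But φ g lies on a
    -- cycle of `ρ`, so it is φ of a standard automorphism, and injectivity makes g itself standard.
    all-standard : ∀ (g : Aut Δ) x → proj₁ (to g (x , false)) ≡ proj₁ (to g (x , true))
    all-standard g x with recurrent (φ g)
    ... | j , r = trans (cong proj₁ (same (x , false))) (sym (cong proj₁ (same (x , true))))
      where
      same : ∀ y → to g y ≡ to (standard (power j (φ g))) y
      same = inj g (standard (power j (φ g))) r

  module _ (paired : ∀ (g : Aut Δ) x i → to g (x , not i) ≡ (proj₁ (to g (x , i)) , not (proj₂ (to g (x , i)))))
           (layered : ∀ (g : Aut Δ) x → proj₂ (to g (x , false)) ≡ proj₂ (to g (Fin.zero , false))) where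

    α : Aut Δ → Fin (suc k) → Fin (suc k)
    α g x = proj₁ (to g (x , false))

    flips : Aut Δ → Bool
    flips g = proj₂ (to g (Fin.zero , false))

    form : ∀ g x i → to g (x , i) ≡ (α g x , i xor flips g)
    form g x false = cong (α g x ,_) (layered g x)
    form g x true = trans (paired g x false) (cong (λ c → α g x , not c) (layered g x))

    component : Aut Δ → Aut Γ
    component g = record
      { to = α g
      ; from = λ y → proj₁ (from g (y , false))
      ; from-to = λ x → cong proj₁ (trans (cong (from g) (sym (trans (form g x (flips g)) (cong (α g x ,_) (xor-same (flips g)))))) (from-to g (x , flips g)))
      ; to-from = λ y → cong proj₁ (trans (cong₂ _,_ (first y) refl) (to-from g (y , false)))
      ; pres = λ x y e → proj₁ (subst₂ (E Δ) (form g x false) (form g y true) (pres g (x , false) (y , true) (e , λ ())))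
      ; refl' = λ x y e → proj₁ (refl' g (x , false) (y , true) (subst₂ (E Δ) (sym (form g x false)) (sym (form g y true)) (e , not-fixed (flips g)))) }
      where
      not-fixed : ∀ c → c ≢ not c
      not-fixed true ()
      not-fixed false ()
      first : ∀ y → α g (proj₁ (from g (y , false))) ≡ proj₁ (to g (from g (y , false)))
      first y = sym (cong proj₁ (form g (proj₁ (from g (y , false))) (proj₂ (from g (y , false)))))

    stable : Stable Γ
    stable = record
      { φ = λ g → component g , flips g
      ; φ-cong = λ f g e → (λ x → cong proj₁ (e (x , false))) , cong proj₂ (e (Fin.zero , false))
      ; hom = λ f g → (λ x → cong proj₁ (trans (cong (to f) (form g x false)) (form f (α g x) (flips g))))
                    , trans (cong proj₂ (trans (cong (to f) (form g Fin.zero false)) (form f (α g Fin.zero) (flips g)))) (xor-comm (flips g) (flips f))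
      ; inj = λ f g (e , e′) (x , i) → trans (form f x i) (trans (cong₂ (λ y c → y , i xor c) (e x) e′) (sym (form g x i)))
      ; surj = λ a → standard a , (λ _ → refl) , refl }

-- Residues, and the splitting of the cyclic group of order 2m.

module Residue (k : ℕ) where
  open import Data.Nat.DivMod
  open import Data.Nat.Properties
  open import Data.Fin.Properties using (toℕ-fromℕ<; toℕ<n; toℕ-injective)

  n : ℕ
  n = suc k

  residue : ℕ → Fin n
  residue a = a mod n

  toℕ-residue : ∀ a → toℕ (residue a) ≡ a % n
  toℕ-residue a = toℕ-fromℕ< (m%n<n a n)

  toℕ-% : ∀ (x : Fin n) → toℕ x % n ≡ toℕ x
  toℕ-% x = m<n⇒m%n≡m (toℕ<n x)

  residue-toℕ : ∀ x → residue (toℕ x) ≡ x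
  residue-toℕ x = toℕ-injective (trans (toℕ-residue (toℕ x)) (toℕ-% x))

  residue-cong : ∀ {a b} → a % n ≡ b % n → residue a ≡ residue b
  residue-cong {a} {b} e = toℕ-injective (trans (toℕ-residue a) (trans e (sym (toℕ-residue b))))

  residue-+ : ∀ a b → residue a ⊕ residue b ≡ residue (a ℕ.+ b)
  residue-+ a b = residue-cong {toℕ (residue a) ℕ.+ toℕ (residue b)} {a ℕ.+ b} (trans (cong₂ (λ c d → (c ℕ.+ d) % n) (toℕ-residue a) (toℕ-residue b)) (sym (%-distribˡ-+ a b n)))

  0ᶠ : Fin n
  0ᶠ = Fin.zero

  neg : Fin n → Fin n
  neg x = residue (n ℕ.∸ toℕ x)

  opaque
    ⊕-isAbelianGroup : IsAbelianGroup _≡_ _⊕_ 0ᶠ neg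
    ⊕-isAbelianGroup = record
      { isGroup = record
        { isMonoid = record
          { isSemigroup = record
            { isMagma = record { isEquivalence = isEquivalence ; ∙-cong = cong₂ _⊕_ }
            ; assoc = assoc }
          ; identity = identityˡ , λ x → trans (comm x 0ᶠ) (identityˡ x) }
        ; inverse = inverseˡ , λ x → trans (comm x (neg x)) (inverseˡ x)
        ; ⁻¹-cong = cong neg }
      ; comm = comm }
      where
      comm : ∀ (x y : Fin n) → x ⊕ y ≡ y ⊕ x
      comm x y = cong residue (+-comm (toℕ x) (toℕ y))
      assoc : ∀ (x y z : Fin n) → (x ⊕ y) ⊕ z ≡ x ⊕ (y ⊕ z)
      assoc x y z = begin
        residue (toℕ x ℕ.+ toℕ y) ⊕ z ≡⟨ cong (residue (toℕ x ℕ.+ toℕ y) ⊕_) (residue-toℕ z) ⟨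
        residue (toℕ x ℕ.+ toℕ y) ⊕ residue (toℕ z) ≡⟨ residue-+ (toℕ x ℕ.+ toℕ y) (toℕ z) ⟩
        residue (toℕ x ℕ.+ toℕ y ℕ.+ toℕ z) ≡⟨ cong residue (+-assoc (toℕ x) (toℕ y) (toℕ z)) ⟩
        residue (toℕ x ℕ.+ (toℕ y ℕ.+ toℕ z)) ≡⟨ residue-+ (toℕ x) (toℕ y ℕ.+ toℕ z) ⟨
        residue (toℕ x) ⊕ residue (toℕ y ℕ.+ toℕ z) ≡⟨ cong (_⊕ residue (toℕ y ℕ.+ toℕ z)) (residue-toℕ x) ⟩
        x ⊕ (y ⊕ z) ∎
        where open ≡-Reasoning
      identityˡ : ∀ (x : Fin n) → 0ᶠ ⊕ x ≡ x
      identityˡ x = residue-toℕ x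
      inverseˡ : ∀ (x : Fin n) → neg x ⊕ x ≡ 0ᶠ
      inverseˡ x = trans (cong (neg x ⊕_) (sym (residue-toℕ x))) (trans (residue-+ (n ℕ.∸ toℕ x) (toℕ x))
        (trans (cong residue (m∸n+n≡m (<⇒≤ (toℕ<n x)))) (residue-cong {n} {0} (n%n≡0 n))))

  open Multiples ⊕-isAbelianGroup using (_⋆_)

  toℕ-⋆ : ∀ j x → toℕ (j ⋆ x) ≡ (j ℕ.* toℕ x) % n
  toℕ-⋆ zero x = refl
  toℕ-⋆ (suc j) x = begin
    toℕ (x ⊕ (j ⋆ x)) ≡⟨ toℕ-residue (toℕ x ℕ.+ toℕ (j ⋆ x)) ⟩
    (toℕ x ℕ.+ toℕ (j ⋆ x)) % n ≡⟨ cong₂ (λ a c → (a ℕ.+ c) % n) (sym (toℕ-% x)) (toℕ-⋆ j x) ⟩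
    (toℕ x % n ℕ.+ (j ℕ.* toℕ x) % n) % n ≡⟨ %-distribˡ-+ (toℕ x) (j ℕ.* toℕ x) n ⟨
    (toℕ x ℕ.+ j ℕ.* toℕ x) % n ∎
    where open ≡-Reasoning

  residue-⋆ : ∀ {a b l l′} j (x y : Fin n) → toℕ x ≡ a → toℕ y ≡ b → a ℕ.+ l ℕ.* n ≡ j ℕ.* b ℕ.+ l′ ℕ.* n → x ≡ j ⋆ y
  residue-⋆ {l = l} {l′} j x y refl refl eq = toℕ-injective (begin
    toℕ x ≡⟨ toℕ-% x ⟨
    toℕ x % n ≡⟨ [m+kn]%n≡m%n (toℕ x) l n ⟨
    (toℕ x ℕ.+ l ℕ.* n) % n ≡⟨ cong (_% n) eq ⟩
    (j ℕ.* toℕ y ℕ.+ l′ ℕ.* n) % n ≡⟨ [m+kn]%n≡m%n (j ℕ.* toℕ y) l′ n ⟩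
    (j ℕ.* toℕ y) % n ≡⟨ toℕ-⋆ j y ⟨
    toℕ (j ⋆ y) ∎)
    where open ≡-Reasoning

  torsion : ∀ x → n ⋆ x ≡ 0ᶠ
  torsion x = toℕ-injective (trans (toℕ-⋆ n x) (trans (cong (_% n) (*-comm n (toℕ x))) (m*n%n≡0 (toℕ x) n)))

module Comparable where
  open import Data.Nat
  open import Data.Nat.Properties
  open import Data.Nat.Divisibility
  open import Data.Nat.Solver using (module +-*-Solver)
  open +-*-Solver using (solve; _:=_; con; _:*_) renaming (_:+_ to _⊹_)
  open PrimePowers

  MultipleMod : ℕ → ℕ → ℕ → Set
  MultipleMod n a b = ∃ λ k → ∃₂ λ l l′ → a + l * n ≡ k * b + l′ * n

  unit-divides : ∀ {p} → Prime p → ∀ e {a} → p ∤ a → ∀ b → MultipleMod (p ^ e) b a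
  unit-divides {p} pr e {a} p∤a b with inverse-mod (coprime-^ pr p∤a e)
  ... | k′ , l , l′ , eq = b * k′ , b * l′ , b * l , (begin
    b + b * l′ * p ^ e ≡⟨ solve 3 (λ b l n → b ⊹ b :* l :* n := b :* (con 1 ⊹ l :* n)) refl b l′ (p ^ e) ⟩
    b * (1 + l′ * p ^ e) ≡⟨ cong (b *_) eq ⟨
    b * (k′ * a + l * p ^ e) ≡⟨ solve 5 (λ b k a l n → b :* (k :* a ⊹ l :* n) := b :* k :* a ⊹ b :* l :* n) refl b k′ a l (p ^ e) ⟩
    b * k′ * a + b * l * p ^ e ∎)
    where open ≡-Reasoning

  scale-multiple : ∀ p n {a b} → MultipleMod n a b → MultipleMod (p * n) (a * p) (b * p)
  scale-multiple p n {a} {b} (k , l , l′ , eq) = k , l , l′ , (begin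
    a * p + l * (p * n) ≡⟨ solve 4 (λ a p l n → a :* p ⊹ l :* (p :* n) := (a ⊹ l :* n) :* p) refl a p l n ⟩
    (a + l * n) * p ≡⟨ cong (_* p) eq ⟩
    (k * b + l′ * n) * p ≡⟨ solve 5 (λ k b p l n → (k :* b ⊹ l :* n) :* p := k :* (b :* p) ⊹ l :* (p :* n)) refl k b p l′ n ⟩
    k * (b * p) + l′ * (p * n) ∎)
    where open ≡-Reasoning

  -- Common factors p are stripped, each lowering the exponent of the modulus, until one of the
  -- numbers is a unit and divides everything, or the modulus has become 1.
  comparable : ∀ {p} → Prime p → ∀ e a b → MultipleMod (p ^ e) a b ⊎ MultipleMod (p ^ e) b a
  comparable pr zero a b = inj₁ (0 , 0 , a , trans (+-identityʳ a) (sym (*-identityʳ a)))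
  comparable {p} pr (suc e) a b with p ∣? a | p ∣? b
  ... | no p∤a | _ = inj₂ (unit-divides pr (suc e) p∤a b)
  ... | yes _ | no p∤b = inj₁ (unit-divides pr (suc e) p∤b a)
  ... | yes (divides a′ refl) | yes (divides b′ refl) with comparable pr e a′ b′
  ...   | inj₁ r = inj₁ (scale-multiple p (p ^ e) r)
  ...   | inj₂ r = inj₂ (scale-multiple p (p ^ e) r)

-- ℤ_{2m} ≅ ℤ_m × ℤ_2 for odd m = suc k.
module Splitting (k : ℕ) (k-even : ∃ λ h → k ≡ 2 ℕ.* h) {N} (N≡ : suc N ≡ 2 ℕ.* suc k) where
  open import Data.Nat.DivMod
  open import Data.Nat.Divisibility using (_∣_; divides)
  open import Data.Nat.Properties
  open import Data.Fin.Properties using (toℕ<n; toℕ-injective)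
  open import Data.Bool.Properties using (not-involutive)

  module H = Residue N
  module C = Residue k

  odd? : ℕ → Bool
  odd? zero = false
  odd? (suc a) = not (odd? a)

  odd?-+ : ∀ a b → odd? (a ℕ.+ b) ≡ odd? a xor odd? b
  odd?-+ zero b = refl
  odd?-+ (suc a) b = trans (cong not (odd?-+ a b)) (not-xor (odd? a) (odd? b))
    where
    not-xor : ∀ c d → not (c xor d) ≡ not c xor d
    not-xor true d = not-involutive d
    not-xor false d = refl

  odd?-2* : ∀ a → odd? (2 ℕ.* a) ≡ false
  odd?-2* a = trans (cong (λ c → odd? (a ℕ.+ c)) (+-identityʳ a)) (trans (odd?-+ a a) (xor-same (odd? a)))
    where open import Data.Bool.Properties using (xor-same)

  odd?-%N : ∀ a → odd? (a % suc N) ≡ odd? a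
  odd?-%N a = sym (begin
    odd? a ≡⟨ cong odd? (m≡m%n+[m/n]*n a (suc N)) ⟩
    odd? (a % suc N ℕ.+ (a / suc N) ℕ.* suc N) ≡⟨ odd?-+ (a % suc N) _ ⟩
    odd? (a % suc N) xor odd? ((a / suc N) ℕ.* suc N) ≡⟨ cong (λ c → odd? (a % suc N) xor odd? c) even ⟩
    odd? (a % suc N) xor odd? (2 ℕ.* ((a / suc N) ℕ.* suc k)) ≡⟨ cong (odd? (a % suc N) xor_) (odd?-2* ((a / suc N) ℕ.* suc k)) ⟩
    odd? (a % suc N) xor false ≡⟨ xor-identityʳ _ ⟩
    odd? (a % suc N) ∎)
    where
    open ≡-Reasoning
    open import Data.Bool.Properties using (xor-identityʳ)
    open import Data.Nat.Solver using (module +-*-Solver)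
    open +-*-Solver using (solve; _:=_; con; _:*_)
    even : (a / suc N) ℕ.* suc N ≡ 2 ℕ.* ((a / suc N) ℕ.* suc k)
    even = trans (cong ((a / suc N) ℕ.*_) N≡) (solve 2 (λ q m → q :* (con 2 :* m) := con 2 :* (q :* m)) refl (a / suc N) (suc k))

  odd?-m : odd? (suc k) ≡ true
  odd?-m = trans (cong (λ k → odd? (suc k)) (proj₂ k-even)) (cong not (odd?-2* (proj₁ k-even)))

  split : Fin (suc N) → Fin (suc k) × Bool
  split x = C.residue (toℕ x) , odd? (toℕ x)

  m∣N : suc k ∣ suc N
  m∣N = divides 2 N≡

  split-⊕ : ∀ x y → split (x ⊕ y) ≡ (proj₁ (split x) ⊕ proj₁ (split y) , proj₂ (split x) xor proj₂ (split y))
  split-⊕ x y = cong₂ _,_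
    (trans (C.residue-cong {toℕ (x ⊕ y)} {toℕ x ℕ.+ toℕ y} (trans (cong (_% suc k) (H.toℕ-residue (toℕ x ℕ.+ toℕ y))) (m∣n⇒o%n%m≡o%m (suc k) (suc N) (toℕ x ℕ.+ toℕ y) m∣N)))
           (sym (C.residue-+ (toℕ x) (toℕ y))))
    (trans (cong odd? (H.toℕ-residue (toℕ x ℕ.+ toℕ y))) (trans (odd?-%N (toℕ x ℕ.+ toℕ y)) (odd?-+ (toℕ x) (toℕ y))))

  split-residue : ∀ a → split (H.residue a) ≡ (C.residue a , odd? a)
  split-residue a = cong₂ _,_ (C.residue-cong {toℕ (H.residue a)} {a} (trans (cong (_% suc k) (H.toℕ-residue a)) (m∣n⇒o%n%m≡o%m (suc k) (suc N) a m∣N)))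
    (trans (cong odd? (H.toℕ-residue a)) (odd?-%N a))

  opaque
    -- With m = suc k, the two lifts c and c + m have opposite parities because m is odd, so the bit
    -- selects one of them.
    glue : Fin (suc k) × Bool → Fin (suc N)
    glue (c , β) with odd? (toℕ c) Boolₚ.≟ β
      where import Data.Bool.Properties as Boolₚ
    ... | yes _ = H.residue (toℕ c)
    ... | no _ = H.residue (suc k ℕ.+ toℕ c)

    split-glue : ∀ z → split (glue z) ≡ z
    split-glue (c , β) with odd? (toℕ c) Boolₚ.≟ β
      where import Data.Bool.Properties as Boolₚ
    ... | yes e = trans (split-residue (toℕ c)) (cong₂ _,_ (C.residue-toℕ c) e)
    ... | no ¬e = trans (split-residue (suc k ℕ.+ toℕ c)) (cong₂ _,_
          (trans (C.residue-cong {suc k ℕ.+ toℕ c} {toℕ c} (trans (cong (_% suc k) (+-comm (suc k) (toℕ c))) ([m+n]%n≡m%n (toℕ c) (suc k)))) (C.residue-toℕ c))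
          (trans (odd?-+ (suc k) (toℕ c)) (trans (cong (_xor odd? (toℕ c)) odd?-m) (flip (odd? (toℕ c)) β ¬e))))
      where
      flip : ∀ a β → a ≢ β → true xor a ≡ β
      flip true true ne = ⊥-elim (ne refl)
      flip true false ne = refl
      flip false true ne = refl
      flip false false ne = ⊥-elim (ne refl)

  low-or-high : ∀ a → a < suc N → a ≡ a % suc k ⊎ a ≡ suc k ℕ.+ a % suc k
  low-or-high a a<N with a <? suc k
  ... | yes a<m = inj₁ (sym (m<n⇒m%n≡m a<m))
  ... | no a≮m = inj₂ (trans (sym (m+[n∸m]≡n m≤a)) (cong (suc k ℕ.+_) (sym (begin
      a % suc k ≡⟨ cong (_% suc k) (m∸n+n≡m m≤a) ⟨
      (a ℕ.∸ suc k ℕ.+ suc k) % suc k ≡⟨ [m+n]%n≡m%n (a ℕ.∸ suc k) (suc k) ⟩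
      (a ℕ.∸ suc k) % suc k ≡⟨ m<n⇒m%n≡m a-m<m ⟩
      a ℕ.∸ suc k ∎))))
    where
    open ≡-Reasoning
    m≤a : suc k ≤ a
    m≤a = ≮⇒≥ a≮m
    a-m<m : a ℕ.∸ suc k < suc k
    a-m<m = +-cancelʳ-< (suc k) _ _ (subst₂ _<_ (sym (m∸n+n≡m m≤a)) (trans N≡ (cong (suc k ℕ.+_) (+-identityʳ (suc k)))) a<N)

  split-injective : ∀ {x y} → split x ≡ split y → x ≡ y
  split-injective {x} {y} e = toℕ-injective (go (low-or-high (toℕ x) (toℕ<n x)) (low-or-high (toℕ y) (toℕ<n y)))
    where
    same% : toℕ x % suc k ≡ toℕ y % suc k
    same% = trans (sym (C.toℕ-residue (toℕ x))) (trans (cong (λ z → toℕ (proj₁ z)) e) (C.toℕ-residue (toℕ y)))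
    clash : ∀ {a b r} → a ≡ r → b ≡ suc k ℕ.+ r → odd? a ≢ odd? b
    clash {r = r} refl refl q = not-fixed (trans q (trans (odd?-+ (suc k) r) (cong (_xor odd? r) odd?-m)))
      where
      not-fixed : ∀ {c} → c ≢ not c
      not-fixed {true} ()
      not-fixed {false} ()
    go : _ → _ → toℕ x ≡ toℕ y
    go (inj₁ ex) (inj₁ ey) = trans ex (trans same% (sym ey))
    go (inj₂ ex) (inj₂ ey) = trans ex (trans (cong (suc k ℕ.+_) same%) (sym ey))
    go (inj₁ ex) (inj₂ ey) = ⊥-elim (clash ex (trans ey (cong (suc k ℕ.+_) (sym same%))) (cong proj₂ e))
    go (inj₂ ex) (inj₁ ey) = ⊥-elim (clash ey (trans ex (cong (suc k ℕ.+_) same%)) (sym (cong proj₂ e)))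

  glue-split : ∀ x → glue (split x) ≡ x
  glue-split x = split-injective (split-glue (split x))

  odd?-∣ : ∀ a → odd? a ≡ false → 2 ∣ a
  odd?-∣ zero _ = divides 0 refl
  odd?-∣ (suc (suc a)) e with odd?-∣ a (trans (sym (not-involutive (odd? a))) e)
  ... | divides q refl = divides (suc q) refl

  ∣-odd? : ∀ {a} → 2 ∣ a → odd? a ≡ false
  ∣-odd? (divides q refl) = trans (cong odd? (*-comm q 2)) (odd?-2* q)

open import Data.Fin.Subset using (Subset; _∈_; _∉_)
open import Function.Bundles using (Equivalence)
open import Function.Construct.Identity using (↔-id)
open import Data.Nat.Divisibility using (_∤_)

decide : ∀ {P R : Set} → Dec P → (P → R) → (¬ P → R) → R
decide (yes p) f g = f p
decide (no ¬p) f g = g ¬p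

-- Circulant graphs

module Circulant {p e k N} (pr : Prime p) (p-odd : ∃ λ h → p ≡ suc (2 ℕ.* h)) (e>0 : 0 < e)
  (m≡ : p ℕ.^ e ≡ suc k) (N≡ : suc N ≡ 2 ℕ.* suc k) (S : Subset (suc N)) where

  open import Data.Fin.Subset.Properties using (_∈?_)
  open import Data.Nat.Divisibility using (_∣_)
  import Data.Bool.Properties as Boolₚ
  open import Relation.Nullary.Decidable using (dec-true; dec-false)

  private
    module K = Residue k
    module KM = Multiples K.⊕-isAbelianGroup

  torsion : ∀ x → (p ℕ.^ e) KM.⋆ x ≡ K.0ᶠ
  torsion x = trans (cong (KM._⋆ x) m≡) (K.torsion x)

  cyclic : ∀ x y → (∃ λ j → x ≡ j KM.⋆ y) ⊎ (∃ λ j → y ≡ j KM.⋆ x)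
  cyclic x y with Comparable.comparable pr e (toℕ x) (toℕ y)
  ... | inj₁ (j , l , l′ , eq) = inj₁ (j , K.residue-⋆ {l = l} {l′} j x y refl refl (subst (λ n → toℕ x ℕ.+ l ℕ.* n ≡ j ℕ.* toℕ y ℕ.+ l′ ℕ.* n) m≡ eq))
  ... | inj₂ (j , l , l′ , eq) = inj₂ (j , K.residue-⋆ {l = l} {l′} j y x refl refl (subst (λ n → toℕ y ℕ.+ l ℕ.* n ≡ j ℕ.* toℕ x ℕ.+ l′ ℕ.* n) m≡ eq))

  k-even : ∃ λ h → k ≡ 2 ℕ.* h
  k-even = proj₁ odd , ℕ-suc-injective (trans (sym m≡) (proj₂ odd))
    where
    open import Data.Nat.Properties renaming (suc-injective to ℕ-suc-injective)
    odd : ∃ λ h → p ℕ.^ e ≡ suc (2 ℕ.* h)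
    odd = KM.CyclicPGroup.m-odd e>0 pr p-odd torsion cyclic

  open Splitting k k-even N≡
  open Multiples H.⊕-isAbelianGroup using () renaming
    (solve to solveᴴ; _⊜_ to _⊜ᴴ_; _:+_ to _⊞_; _:-_ to _⊟ᴴ_; :-_ to ⊟ᴴ_; :0 to ∅ᴴ)

  mem : Fin (suc N) → Bool
  mem x = does (x ∈? S)

  mem⇒∈ : ∀ {x} → mem x ≡ true → x ∈ S
  mem⇒∈ {x} e with x ∈? S
  ... | yes x∈S = x∈S

  ∈⇒mem : ∀ {x} → x ∈ S → mem x ≡ true
  ∈⇒mem {x} = dec-true (x ∈? S)

  Sᶜ : Bool → Fin (suc k) → Bool
  Sᶜ τ c = mem (glue (c , τ))

  open PrimePowerCover K.⊕-isAbelianGroup (↔-id (Fin (suc k))) Sᶜ e>0 pr p-odd torsion cyclic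

  Γ Δ : Graph
  Γ = Cay (suc N) ⟦ S ⟧
  Δ = Γ ×K₂

  join : Fin (suc N) → Bool → G
  join x ℓ = proj₁ (split x) , proj₂ (split x) , ℓ

  Ψ : Fin (suc N) × Bool → G
  Ψ (x , ℓ) = join x ℓ

  Ψ⁻¹ : G → Fin (suc N) × Bool
  Ψ⁻¹ (c , τ , ℓ) = glue (c , τ) , ℓ

  Ψ-Ψ⁻¹ : ∀ z → Ψ (Ψ⁻¹ z) ≡ z
  Ψ-Ψ⁻¹ (c , τ , ℓ) = cong (λ w → proj₁ w , proj₂ w , ℓ) (split-glue (c , τ))

  Ψ⁻¹-Ψ : ∀ x → Ψ⁻¹ (Ψ x) ≡ x
  Ψ⁻¹-Ψ (x , ℓ) = cong (_, ℓ) (glue-split x)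

  infixl 6 _⊝_
  _⊝_ : Fin (suc N) → Fin (suc N) → Fin (suc N)
  x ⊝ y = x ⊕ H.neg y

  join-⊕ : ∀ x y ℓ ℓ′ → join (x ⊕ y) (ℓ xor ℓ′) ≡ join x ℓ ⊹ join y ℓ′
  join-⊕ x y ℓ ℓ′ = cong (λ w → proj₁ w , proj₂ w , (ℓ xor ℓ′)) (split-⊕ x y)

  split-0 : split H.0ᶠ ≡ (K.0ᶠ , false)
  split-0 = cong (_, false) (K.residue-toℕ K.0ᶠ)

  join-⊝ : ∀ x y ℓ ℓ′ → join (x ⊝ y) (ℓ xor ℓ′) ≡ join x ℓ ⊟ join y ℓ′
  join-⊝ x y ℓ ℓ′ = trans (solveᴳ 2 (λ a b → a ⊜ᴳ (a ∔ b) ∸ b) refl (join (x ⊝ y) (ℓ xor ℓ′)) (join y ℓ′))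
    (cong (_⊟ join y ℓ′) (trans (sym (join-⊕ (x ⊝ y) y (ℓ xor ℓ′) ℓ′)) (cong₂ join
      (solveᴴ 2 (λ x y → (x ⊟ᴴ y) ⊞ y ⊜ᴴ x) refl x y)
      (trans (Boolₚ.xor-assoc ℓ ℓ′ ℓ′) (trans (cong (ℓ xor_) (Boolₚ.xor-same ℓ′)) (Boolₚ.xor-identityʳ ℓ))))))

  adj-join : ∀ x → adj (join x true) ≡ mem x
  adj-join x = cong mem (glue-split x)

  adj-⊟ : ∀ x y ℓ ℓ′ → adj (join y ℓ′ ⊟ join x ℓ) ≡ (ℓ′ xor ℓ) ∧ mem (y ⊝ x)
  adj-⊟ x y ℓ ℓ′ = trans (cong adj (sym (join-⊝ y x ℓ′ ℓ))) (go (ℓ′ xor ℓ))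
    where
    go : ∀ ℓ → adj (join (y ⊝ x) ℓ) ≡ ℓ ∧ mem (y ⊝ x)
    go true = adj-join (y ⊝ x)
    go false = refl

  E⇒mem : ∀ {x y} → E Γ x y → mem (y ⊝ x) ≡ true
  E⇒mem {x} (s , s∈S , y≡) = ∈⇒mem (subst (_∈ S) (trans (solveᴴ 2 (λ s x → s ⊜ᴴ (s ⊞ x) ⊟ᴴ x) refl s x) (cong (_⊝ x) (sym y≡))) s∈S)

  mem⇒E : ∀ {x y} → mem (y ⊝ x) ≡ true → E Γ x y
  mem⇒E {x} {y} e = y ⊝ x , mem⇒∈ e , solveᴴ 2 (λ x y → y ⊜ᴴ (y ⊟ᴴ x) ⊞ x) refl x y

  EΔ⇒adj : ∀ {x y} → E Δ x y → adj (Ψ y ⊟ Ψ x) ≡ true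
  EΔ⇒adj {x , ℓ} {y , ℓ′} (e , ℓ≢ℓ′) = trans (adj-⊟ x y ℓ ℓ′) (cong₂ _∧_ (differ ℓ ℓ′ ℓ≢ℓ′) (E⇒mem e))
    where
    differ : ∀ ℓ ℓ′ → ℓ ≢ ℓ′ → ℓ′ xor ℓ ≡ true
    differ true true ne = ⊥-elim (ne refl)
    differ false false ne = ⊥-elim (ne refl)
    differ true false _ = refl
    differ false true _ = refl

  adj⇒EΔ : ∀ {x y} → adj (Ψ y ⊟ Ψ x) ≡ true → E Δ x y
  adj⇒EΔ {x , ℓ} {y , ℓ′} e = mem⇒E (∧-right (ℓ′ xor ℓ) both) , λ { refl → true≢false (sym (∧-left′ (Boolₚ.xor-same ℓ) both)) }
    where
    both : (ℓ′ xor ℓ) ∧ mem (y ⊝ x) ≡ true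
    both = trans (sym (adj-⊟ x y ℓ ℓ′)) e
    ∧-right : ∀ a {c} → a ∧ c ≡ true → c ≡ true
    ∧-right true e = e
    ∧-left′ : ∀ {a c} → a ≡ false → a ∧ c ≡ true → false ≡ true
    ∧-left′ refl e = e

  toAutomorphism : Aut Δ → Automorphism
  toAutomorphism g = record
    { fun = λ z → Ψ (to g (Ψ⁻¹ z))
    ; inv = λ z → Ψ (from g (Ψ⁻¹ z))
    ; fun-inv = λ z → trans (cong (λ x → Ψ (to g x)) (Ψ⁻¹-Ψ _)) (trans (cong Ψ (to-from g _)) (Ψ-Ψ⁻¹ z))
    ; inv-fun = λ z → trans (cong (λ x → Ψ (from g x)) (Ψ⁻¹-Ψ _)) (trans (cong Ψ (from-to g _)) (Ψ-Ψ⁻¹ z))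
    ; adj-pres = λ z w → trans (boolean-ext (λ e → EΔ⇒adj (refl' g _ _ (adj⇒EΔ e))) (λ e → EΔ⇒adj (pres g _ _ (adj⇒EΔ e))))
                           (cong₂ (λ w z → adj (w ⊟ z)) (Ψ-Ψ⁻¹ w) (Ψ-Ψ⁻¹ z)) }

  fromAutomorphism : Automorphism → Aut Δ
  fromAutomorphism f = record
    { to = λ x → Ψ⁻¹ (fun f (Ψ x))
    ; from = λ x → Ψ⁻¹ (inv f (Ψ x))
    ; from-to = λ x → trans (cong (λ z → Ψ⁻¹ (inv f z)) (Ψ-Ψ⁻¹ _)) (trans (cong Ψ⁻¹ (inv-fun f _)) (Ψ⁻¹-Ψ x))
    ; to-from = λ x → trans (cong (λ z → Ψ⁻¹ (fun f z)) (Ψ-Ψ⁻¹ _)) (trans (cong Ψ⁻¹ (fun-inv f _)) (Ψ⁻¹-Ψ x))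
    ; pres = λ x y e → adj⇒EΔ (trans (moved x y) (EΔ⇒adj e))
    ; refl' = λ x y e → adj⇒EΔ (trans (sym (moved x y)) (EΔ⇒adj e)) }
    where
    moved : ∀ x y → adj (Ψ (Ψ⁻¹ (fun f (Ψ y))) ⊟ Ψ (Ψ⁻¹ (fun f (Ψ x)))) ≡ adj (Ψ y ⊟ Ψ x)
    moved x y = trans (cong₂ (λ w z → adj (w ⊟ z)) (Ψ-Ψ⁻¹ (fun f (Ψ y))) (Ψ-Ψ⁻¹ (fun f (Ψ x)))) (adj-pres f (Ψ x) (Ψ y))

  up : G
  up = K.0ᶠ , false , true

  Ψ-up : ∀ x i → Ψ (x , i) ⊹ up ≡ Ψ (x , not i)
  Ψ-up x i = triple (solve 1 (λ c → c :+ :0 ⊜ c) refl (proj₁ (split x))) (Boolₚ.xor-identityʳ _) (xor-true i)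
    where
    xor-true : ∀ i → i xor true ≡ not i
    xor-true true = refl
    xor-true false = refl

  -- Pairs in Aut Γ × ℤ₂ act alike on both layers, and stability, even by an abstract isomorphism,
  -- would make every automorphism such a pair.
  unstable-if : ∀ (f : Automorphism) c τ →
    (part (fun f (c , τ , false)) , twist (fun f (c , τ , false))) ≢ (part (fun f (c , τ , true)) , twist (fun f (c , τ , true))) → Unstable Γ
  unstable-if f c τ ne AI = ne (trans (sym (at false)) (trans (cong split same) (at true)))
    where
    x : Fin (suc N)
    x = glue (c , τ)
    same : proj₁ (Ψ⁻¹ (fun f (Ψ (x , false)))) ≡ proj₁ (Ψ⁻¹ (fun f (Ψ (x , true))))
    same = Stability.Rigid.all-standard (E Γ) AI (fromAutomorphism f) x
    at : ∀ i → split (proj₁ (Ψ⁻¹ (fun f (Ψ (x , i))))) ≡ (part (fun f (c , τ , i)) , twist (fun f (c , τ , i)))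
    at i = trans (split-glue _) (cong (λ z → part (fun f z) , twist (fun f z)) (Ψ-Ψ⁻¹ (c , τ , i)))

  -- Translate by `t` exactly the vertices with τ xor ℓ true. An edge with twist has both ends on
  -- the same side of this division; one without twist crosses it, but comes from S₀, which has
  -- period `t`. The two layers over 0 are moved differently.
  shift-unstable : ∀ t → t ≢ K.0ᶠ → (∀ c → Sᶜ false c ≡ Sᶜ false (c ⊕ t)) → Unstable Γ
  shift-unstable t t≢0 period = unstable-if shift K.0ᶠ false λ e → t≢0 (sym (begin
      K.0ᶠ ≡⟨ identity-0 ⟨
      K.0ᶠ ⊕ K.0ᶠ ≡⟨ cong proj₁ e ⟩
      K.0ᶠ ⊕ t ≡⟨ solve 1 (λ t → :0 :+ t ⊜ t) refl t ⟩
      t ∎))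
    where
    open ≡-Reasoning
    identity-0 : K.0ᶠ ⊕ K.0ᶠ ≡ K.0ᶠ
    identity-0 = solve 0 (:0 :+ :0 ⊜ :0) refl
    σ : Bool → Fin (suc k)
    σ true = t
    σ false = K.0ᶠ
    move-by : (Fin (suc k) → Fin (suc k)) → G → G
    move-by φ (x , τ , ℓ) = x ⊕ φ (σ (τ xor ℓ)) , τ , ℓ
    relative : ∀ a b ℓ δ → adj (δ ⊕ (σ b ⊕ K.neg (σ a)) , (a xor b) xor ℓ , ℓ) ≡ adj (δ , (a xor b) xor ℓ , ℓ)
    relative a b false δ = refl
    relative true true true δ = cong (Sᶜ true) (solve 2 (λ δ t → δ :+ (t :- t) ⊜ δ) refl δ t)
    relative false false true δ = cong (Sᶜ true) (solve 1 (λ δ → δ :+ (:0 :- :0) ⊜ δ) refl δ)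
    relative false true true δ = trans (cong (Sᶜ false) (solve 2 (λ δ t → δ :+ (t :- :0) ⊜ δ :+ t) refl δ t)) (sym (period δ))
    relative true false true δ = trans (period _) (cong (Sᶜ false) (solve 2 (λ δ t → (δ :+ (:0 :- t)) :+ t ⊜ δ) refl δ t))
    twist-of : ∀ τ ℓ τ′ ℓ′ → ((τ xor ℓ) xor (τ′ xor ℓ′)) xor (ℓ′ xor ℓ) ≡ τ′ xor τ
    twist-of false false false false = refl
    twist-of false false false true = refl
    twist-of false false true false = refl
    twist-of false false true true = refl
    twist-of false true false false = refl
    twist-of false true false true = refl
    twist-of false true true false = refl
    twist-of false true true true = refl
    twist-of true false false false = refl
    twist-of true false false true = refl
    twist-of true false true false = refl
    twist-of true false true true = refl
    twist-of true true false false = refl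
    twist-of true true false true = refl
    twist-of true true true false = refl
    twist-of true true true true = refl
    preserved : ∀ z w → adj (move-by (λ c → c) w ⊟ move-by (λ c → c) z) ≡ adj (w ⊟ z)
    preserved (x , τ , ℓ) (y , τ′ , ℓ′) = begin
      adj ((y ⊕ σ b) ⊕ K.neg (x ⊕ σ a) , τ′ xor τ , ℓ′ xor ℓ)
        ≡⟨ cong₂ (λ c τ → adj (c , τ , ℓ′ xor ℓ)) (solve 4 (λ x y a b → (y :+ b) :- (x :+ a) ⊜ (y :- x) :+ (b :- a)) refl x y (σ a) (σ b)) (sym (twist-of τ ℓ τ′ ℓ′)) ⟩
      adj ((y ⊕ K.neg x) ⊕ (σ b ⊕ K.neg (σ a)) , (a xor b) xor (ℓ′ xor ℓ) , ℓ′ xor ℓ)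
        ≡⟨ relative a b (ℓ′ xor ℓ) (y ⊕ K.neg x) ⟩
      adj (y ⊕ K.neg x , (a xor b) xor (ℓ′ xor ℓ) , ℓ′ xor ℓ)
        ≡⟨ cong (λ τ → adj (y ⊕ K.neg x , τ , ℓ′ xor ℓ)) (twist-of τ ℓ τ′ ℓ′) ⟩
      adj (y ⊕ K.neg x , τ′ xor τ , ℓ′ xor ℓ) ∎
      where
      a b : Bool
      a = τ xor ℓ
      b = τ′ xor ℓ′
    shift : Automorphism
    shift = record
      { fun = move-by (λ c → c)
      ; inv = move-by K.neg
      ; fun-inv = λ (x , τ , ℓ) → triple (solve 2 (λ x c → (x :- c) :+ c ⊜ x) refl x (σ (τ xor ℓ))) refl refl
      ; inv-fun = λ (x , τ , ℓ) → triple (solve 2 (λ x c → (x :+ c) :- c ⊜ x) refl x (σ (τ xor ℓ))) refl refl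
      ; adj-pres = preserved }

  cond1⇒unstable : Cond1 (suc N) e S → Unstable Γ
  cond1⇒unstable (_ , h , h-even , h≢0 , iff) = shift-unstable t t≢0 λ c → boolean-ext (forth c) (back c)
    where
    t : Fin (suc k)
    t = proj₁ (split h)
    split-h : split h ≡ (t , false)
    split-h = cong (t ,_) (∣-odd? h-even)
    t≢0 : t ≢ K.0ᶠ
    t≢0 t≡0 = h≢0 (cong toℕ (split-injective (trans split-h (trans (cong (_, false) t≡0) (sym split-0)))))
    even : ∀ c → InH₀ (glue (c , false))
    even c = odd?-∣ _ (cong proj₂ (split-glue (c , false)))
    glue-⊕ : ∀ c → glue (c , false) ⊕ h ≡ glue (c ⊕ t , false)
    glue-⊕ c = split-injective (trans (split-⊕ (glue (c , false)) h)
      (trans (cong₂ (λ z w → proj₁ z ⊕ proj₁ w , proj₂ z xor proj₂ w) (split-glue (c , false)) split-h) (sym (split-glue (c ⊕ t , false)))))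
    forth : ∀ c → Sᶜ false c ≡ true → Sᶜ false (c ⊕ t) ≡ true
    forth c e = ∈⇒mem (proj₁ (Equivalence.to (iff (glue (c ⊕ t , false))) (glue (c , false) , (mem⇒∈ e , even c) , sym (glue-⊕ c))))
    back : ∀ c → Sᶜ false (c ⊕ t) ≡ true → Sᶜ false c ≡ true
    back c e = let (s , (s∈S , _) , eq) = Equivalence.from (iff (glue (c ⊕ t , false))) (mem⇒∈ e , even (c ⊕ t)) in
               ∈⇒mem (subst (_∈ S) (s≡ s eq) s∈S)
      where
      s≡ : ∀ s → glue (c ⊕ t , false) ≡ s ⊕ h → s ≡ glue (c , false)
      s≡ s eq = trans (solveᴴ 2 (λ s h → s ⊜ᴴ (s ⊞ h) ⊟ᴴ h) refl s h)
        (trans (cong (_⊝ h) (trans (sym eq) (sym (glue-⊕ c)))) (solveᴴ 2 (λ s h → (s ⊞ h) ⊟ᴴ h ⊜ᴴ s) refl (glue (c , false)) h))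

  module WithInvolution (ι : Fin (suc N)) (ι-inv : Involution ι) where

    ι⊕ι : ι ⊕ ι ≡ H.0ᶠ
    ι⊕ι = toℕ-injective (proj₂ ι-inv)
      where open import Data.Fin.Properties using (toℕ-injective)

    split-ι : split ι ≡ (K.0ᶠ , true)
    split-ι = cong₂ _,_ c≡0 (not-false (proj₂ (split ι)) λ τ≡false → proj₁ ι-inv (cong toℕ (split-injective (trans (cong₂ _,_ c≡0 τ≡false) (sym split-0)))))
      where
      not-false : ∀ β → β ≢ false → β ≡ true
      not-false true _ = refl
      not-false false ne = ⊥-elim (ne refl)
      c≡0 : proj₁ (split ι) ≡ K.0ᶠ
      c≡0 = 2⋆-injective (trans (cong (proj₁ (split ι) ⊕_) (solve 1 (λ c → c :+ :0 ⊜ c) refl (proj₁ (split ι))))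
        (trans (cong proj₁ (trans (sym (split-⊕ ι ι)) (trans (cong split ι⊕ι) split-0))) (sym (⋆-zero 2))))

    Eι⇒mem : ∀ {x y} → E (Cay (suc N) (S · ι)) x y → mem ((y ⊝ x) ⊕ ι) ≡ true
    Eι⇒mem {x} {y} (_ , (s , s∈S , refl) , refl) = ∈⇒mem (subst (_∈ S) (sym (begin
      (((s ⊕ ι) ⊕ x) ⊝ x) ⊕ ι ≡⟨ solveᴴ 3 (λ s ι x → (((s ⊞ ι) ⊞ x) ⊟ᴴ x) ⊞ ι ⊜ᴴ s ⊞ (ι ⊞ ι)) refl s ι x ⟩
      s ⊕ (ι ⊕ ι) ≡⟨ cong (s ⊕_) ι⊕ι ⟩
      s ⊕ H.0ᶠ ≡⟨ solveᴴ 1 (λ s → s ⊞ ∅ᴴ ⊜ᴴ s) refl s ⟩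
      s ∎)) s∈S)
      where open ≡-Reasoning

    mem⇒Eι : ∀ {x y} → mem ((y ⊝ x) ⊕ ι) ≡ true → E (Cay (suc N) (S · ι)) x y
    mem⇒Eι {x} {y} e = ((y ⊝ x) ⊕ ι) ⊕ ι , ((y ⊝ x) ⊕ ι , mem⇒∈ e , refl) , sym (begin
      (((y ⊝ x) ⊕ ι) ⊕ ι) ⊕ x ≡⟨ solveᴴ 3 (λ x y ι → (((y ⊟ᴴ x) ⊞ ι) ⊞ ι) ⊞ x ⊜ᴴ y ⊞ (ι ⊞ ι)) refl x y ι ⟩
      y ⊕ (ι ⊕ ι) ≡⟨ cong (y ⊕_) ι⊕ι ⟩
      y ⊕ H.0ᶠ ≡⟨ solveᴴ 1 (λ s → s ⊞ ∅ᴴ ⊜ᴴ s) refl y ⟩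
      y ∎)
      where open ≡-Reasoning

    -- Apply `F` in both layers and add ι in layer 1 only. An edge joins the layers, so its
    -- displacement gains ι once, which turns S b back into S.
    cond2⇒unstable : Cond2 (suc N) S ι → Unstable Γ
    cond2⇒unstable F = unstable-if f K.0ᶠ false λ e → true≢false (sym (not-fixed (cong proj₂ e)))
      where
      open ≡-Reasoning
      tilt : Bool → Fin (suc N)
      tilt true = ι
      tilt false = H.0ᶠ
      tilt-tilt : ∀ ℓ → tilt ℓ ⊕ tilt ℓ ≡ H.0ᶠ
      tilt-tilt true = ι⊕ι
      tilt-tilt false = solveᴴ 0 (∅ᴴ ⊞ ∅ᴴ ⊜ᴴ ∅ᴴ) refl
      cancel : ∀ x ℓ → (x ⊕ tilt ℓ) ⊕ tilt ℓ ≡ x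
      cancel x ℓ = trans (solveᴴ 2 (λ x t → (x ⊞ t) ⊞ t ⊜ᴴ x ⊞ (t ⊞ t)) refl x (tilt ℓ)) (trans (cong (x ⊕_) (tilt-tilt ℓ)) (solveᴴ 1 (λ x → x ⊞ ∅ᴴ ⊜ᴴ x) refl x))
      g g⁻¹ : Fin (suc N) × Bool → Fin (suc N) × Bool
      g (x , ℓ) = to F x ⊕ tilt ℓ , ℓ
      g⁻¹ (x , ℓ) = from F (x ⊕ tilt ℓ) , ℓ
      mem-F : ∀ x y → mem ((to F y ⊝ to F x) ⊕ ι) ≡ mem (y ⊝ x)
      mem-F x y = boolean-ext (λ e → E⇒mem (refl' F x y (mem⇒Eι e))) (λ e → Eι⇒mem (pres F x y (mem⇒E e)))
      adj-g : ∀ x y → adj (Ψ (g y) ⊟ Ψ (g x)) ≡ adj (Ψ y ⊟ Ψ x)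
      adj-g (x , ℓ) (y , ℓ′) = trans (adj-⊟ (to F x ⊕ tilt ℓ) (to F y ⊕ tilt ℓ′) ℓ ℓ′) (trans (go ℓ ℓ′) (sym (adj-⊟ x y ℓ ℓ′)))
        where
        go : ∀ ℓ ℓ′ → (ℓ′ xor ℓ) ∧ mem ((to F y ⊕ tilt ℓ′) ⊝ (to F x ⊕ tilt ℓ)) ≡ (ℓ′ xor ℓ) ∧ mem (y ⊝ x)
        go true true = refl
        go false false = refl
        go false true = trans (cong mem (solveᴴ 3 (λ a b ι → (b ⊞ ι) ⊟ᴴ (a ⊞ ∅ᴴ) ⊜ᴴ (b ⊟ᴴ a) ⊞ ι) refl (to F x) (to F y) ι)) (mem-F x y)
        go true false = trans (cong mem (begin
          (to F y ⊕ H.0ᶠ) ⊝ (to F x ⊕ ι) ≡⟨ solveᴴ 3 (λ a b ι → (b ⊞ ∅ᴴ) ⊟ᴴ (a ⊞ ι) ⊜ᴴ ((b ⊟ᴴ a) ⊞ ι) ⊟ᴴ (ι ⊞ ι)) refl (to F x) (to F y) ι ⟩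
          ((to F y ⊝ to F x) ⊕ ι) ⊝ (ι ⊕ ι) ≡⟨ cong (((to F y ⊝ to F x) ⊕ ι) ⊝_) ι⊕ι ⟩
          ((to F y ⊝ to F x) ⊕ ι) ⊝ H.0ᶠ ≡⟨ solveᴴ 1 (λ x → x ⊟ᴴ ∅ᴴ ⊜ᴴ x) refl _ ⟩
          (to F y ⊝ to F x) ⊕ ι ∎)) (mem-F x y)
      aut : Aut Δ
      aut = record
        { to = g ; from = g⁻¹
        ; from-to = λ (x , ℓ) → cong (_, ℓ) (trans (cong (from F) (cancel (to F x) ℓ)) (from-to F x))
        ; to-from = λ (x , ℓ) → cong (_, ℓ) (trans (cong (_⊕ tilt ℓ) (to-from F _)) (cancel x ℓ))
        ; pres = λ x y e → adj⇒EΔ (trans (adj-g x y) (EΔ⇒adj e))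
        ; refl' = λ x y e → adj⇒EΔ (trans (sym (adj-g x y)) (EΔ⇒adj e)) }
      f : Automorphism
      f = toAutomorphism aut
      x₀ : Fin (suc N)
      x₀ = glue (K.0ᶠ , false)
      not-fixed : proj₂ (split (to F x₀ ⊕ H.0ᶠ)) ≡ proj₂ (split (to F x₀ ⊕ ι)) → false ≡ true
      not-fixed q = begin
        false ≡⟨ cong proj₂ split-0 ⟨
        proj₂ (split H.0ᶠ) ≡⟨ cancelˡ (proj₂ (split (to F x₀))) (trans (sym (cong proj₂ (split-⊕ (to F x₀) H.0ᶠ))) (trans q (cong proj₂ (split-⊕ (to F x₀) ι)))) ⟩
        proj₂ (split ι) ≡⟨ cong proj₂ split-ι ⟩
        true ∎
        where
        cancelˡ : ∀ a {c d} → a xor c ≡ a xor d → c ≡ d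
        cancelˡ true {true} {true} _ = refl
        cancelˡ true {false} {false} _ = refl
        cancelˡ false e = e

    -- From instability to the two conditions.

    module Unstability (id∉S : IdNotIn S) (connected : Connected Γ) (nonBipartite : NonBipartite Γ) where

      Adjacent : G → Set
      Adjacent z = adj z ≡ true

      S-0 : Sᶜ false K.0ᶠ ≡ false
      S-0 = dec-false (glue (K.0ᶠ , false) ∈? S) (subst (_∉ S) (sym (trans (cong glue (sym split-0)) (glue-split H.0ᶠ))) (id∉S H.0ᶠ refl))

      -- If S avoided H₀, parity would be a proper 2-colouring.
      even-element : ∃ λ c → Sᶜ false c ≡ true
      even-element = decide (∃? (λ c → Sᶜ false c Boolₚ.≟ true)) (λ found → found) λ ∄ →
          ⊥-elim (nonBipartite ((λ x → proj₂ (split x)) , proper ∄))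
        where
        module _ (∄ : ¬ ∃ λ c → Sᶜ false c ≡ true) where
          odd-step : ∀ s → s ∈ S → proj₂ (split s) ≡ true
          odd-step s s∈S = go (proj₂ (split s)) refl
            where
            go : ∀ τ → proj₂ (split s) ≡ τ → proj₂ (split s) ≡ true
            go true eq = eq
            go false eq = ⊥-elim (∄ (proj₁ (split s) , ∈⇒mem (subst (_∈ S) (trans (sym (glue-split s)) (cong (λ τ → glue (proj₁ (split s) , τ)) eq)) s∈S)))
          proper : ∀ x y → E Γ x y → proj₂ (split x) ≢ proj₂ (split y)
          proper x y (s , s∈S , refl) q = not-fixed (proj₂ (split x)) (trans q (trans (cong proj₂ (split-⊕ s x)) (cong (_xor proj₂ (split x)) (odd-step s s∈S))))
            where
            not-fixed : ∀ β → β ≢ not β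
            not-fixed true ()
            not-fixed false ()

      -- Going m times along an even element gives a closed walk of odd length. It links the two
      -- layers over a vertex, which connectedness of Γ alone does not.
      up-span : Span Adjacent up
      up-span = let (c , Sc) = even-element in
        subst (Span Adjacent) (trans (odd-⋆ (proj₁ m-odd) (proj₂ m-odd) (c , false , true)) (triple (torsion c) refl refl)) (Span-⋆ m (Span-gen Sc))

      walk-span : ∀ {x y} → Walk Γ x y → ∃ λ ℓ → Span Adjacent (join (y ⊝ x) ℓ)
      walk-span {x} here = false , subst (Span Adjacent) (trans (triple (sym (cong proj₁ split-0)) (sym (cong proj₂ split-0)) refl) (cong (λ z → join z false) (solveᴴ 1 (λ x → ∅ᴴ ⊜ᴴ x ⊟ᴴ x) refl x))) []
      walk-span {x} {z} (step {y = y} e w) = let (ℓ , s) = walk-span w in true xor ℓ , subst (Span Adjacent) (trans (sym (join-⊕ (y ⊝ x) (z ⊝ y) true ℓ)) (cong (λ d → join d (true xor ℓ))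
              (solveᴴ 3 (λ x y z → (y ⊟ᴴ x) ⊞ (z ⊟ᴴ y) ⊜ᴴ z ⊟ᴴ x) refl x y z))) (trans (adj-join (y ⊝ x)) (E⇒mem e) ∷ s)

      spanning : ∀ z → Span Adjacent z
      spanning (c , τ , ℓ) = let (ℓ′ , s) = walk-span (connected H.0ᶠ (glue (c , τ))) in
          adjust ℓ′ ℓ (subst (Span Adjacent) (trans (cong (λ x → join x ℓ′) (solveᴴ 1 (λ x → x ⊟ᴴ ∅ᴴ ⊜ᴴ x) refl (glue (c , τ)))) (Ψ-Ψ⁻¹ (c , τ , ℓ′))) s)
        where
        raise : ∀ ℓ → Span Adjacent (c , τ , ℓ) → Span Adjacent (c , τ , ℓ xor true)
        raise ℓ s = subst (Span Adjacent) (triple (solve 1 (λ c → c :+ :0 ⊜ c) refl c) (Boolₚ.xor-identityʳ τ) refl) (Span-+ s up-span)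
        adjust : ∀ ℓ′ ℓ → Span Adjacent (c , τ , ℓ′) → Span Adjacent (c , τ , ℓ)
        adjust true true s = s
        adjust false false s = s
        adjust true false s = raise true s
        adjust false true s = raise false s

      module R = Rigidity S-0 spanning

      -- If `up` is alone in its orbit, every automorphism commutes with the exchange of layers. As
      -- displacements also keep their layer, it is an automorphism of Γ together with a flip.
      stable-if : (∀ {w} → up ≈ w → w ≡ up) → Stable Γ
      stable-if fixed = Stability.stable (E Γ) paired layered
        where
        paired : ∀ (g : Aut Δ) x i → to g (x , not i) ≡ (proj₁ (to g (x , i)) , not (proj₂ (to g (x , i))))
        paired g x i = trans (sym (Ψ⁻¹-Ψ (to g (x , not i)))) (trans (cong Ψ⁻¹ (begin
          Ψ (to g (x , not i)) ≡⟨ cong (λ y → Ψ (to g y)) (Ψ⁻¹-Ψ (x , not i)) ⟨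
          fun f (Ψ (x , not i)) ≡⟨ cong (fun f) (Ψ-up x i) ⟨
          fun f (Ψ (x , i) ⊹ up) ≡⟨ move-spec f (Ψ (x , i)) up ⟩
          fun f (Ψ (x , i)) ⊹ move f (Ψ (x , i)) up ≡⟨ cong (fun f (Ψ (x , i)) ⊹_) (fixed (≈-move f (Ψ (x , i)) up)) ⟩
          fun f (Ψ (x , i)) ⊹ up ≡⟨ cong (λ y → Ψ (to g y) ⊹ up) (Ψ⁻¹-Ψ (x , i)) ⟩
          Ψ (to g (x , i)) ⊹ up ≡⟨ Ψ-up (proj₁ (to g (x , i))) (proj₂ (to g (x , i))) ⟩
          Ψ (proj₁ (to g (x , i)) , not (proj₂ (to g (x , i)))) ∎)) (Ψ⁻¹-Ψ _))
          where
          open ≡-Reasoning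
          f : Automorphism
          f = toAutomorphism g
        layered : ∀ (g : Aut Δ) x → proj₂ (to g (x , false)) ≡ proj₂ (to g (Fin.zero , false))
        layered g x = trans (sym (at x)) (trans (xor-zero (sym (R.layer-closed (≈-difference f (Ψ (Fin.zero , false)) (Ψ (x , false)))))) (at Fin.zero))
          where
          f : Automorphism
          f = toAutomorphism g
          at : ∀ x → layer (fun f (Ψ (x , false))) ≡ proj₂ (to g (x , false))
          at x = cong (λ y → proj₂ (to g y)) (Ψ⁻¹-Ψ (x , false))
          xor-zero : ∀ {a c} → a xor c ≡ false → a ≡ c
          xor-zero {true} {true} _ = refl
          xor-zero {false} {false} _ = refl

      period⇒cond1 : (∀ {s t} → Sᶜ false s ≡ true → J 1 t → Sᶜ false (s ⊕ t) ≡ true) → Cond1 (suc N) e S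
      period⇒cond1 period = e>1 , h , odd?-∣ _ (cong proj₂ (split-glue (t , false)))
        , (λ h≡0 → t≢0 (trans (sym (cong proj₁ (split-glue (t , false)))) (cong proj₁ (trans (cong split (toℕ-injective {j = H.0ᶠ} h≡0)) split-0))))
        , λ y → mk⇔ (forth y) (back y)
        where
        open import Data.Fin.Properties using (toℕ-injective)
        open import Data.Nat.Properties using (m≤n⇒m<n∨m≡n; *-comm; m^n≢0; m<m*n)
        open import Data.Nat using (nonTrivial⇒n>1)
        -- For e = 1 the group `J 1` is all of H₀, and the period -c would carry an element c of S₀
        -- to 0.
        e>1 : 1 < e
        e>1 = go (m≤n⇒m<n∨m≡n e>0)
          where
          go : 1 < e ⊎ 1 ≡ e → 1 < e
          go (inj₁ 1<e) = 1<e
          go (inj₂ 1≡e) = ⊥-elim (true≢false (trans (sym (subst (λ y → Sᶜ false y ≡ true) (solve 1 (λ c → c :- c ⊜ :0) refl c)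
            (period Sc (J-neg (torsion-by (subst (λ e → (p ℕ.^ e) ⋆ c ≡ K.0ᶠ) (sym 1≡e) (torsion c))))))) S-0))
            where
            c : Fin (suc k)
            c = proj₁ even-element
            Sc : Sᶜ false c ≡ true
            Sc = proj₂ even-element
        q : ℕ
        q = p ℕ.^ ℕ.pred e
        p*q : p ℕ.* q ≡ suc k
        p*q = trans (cong (p ℕ.^_) (suc-pred e {{ℕ.>-nonZero e>0}})) m≡
          where open import Data.Nat.Properties using (suc-pred)
        instance
          q≢0 : ℕ.NonZero q
          q≢0 = m^n≢0 p (ℕ.pred e) {{prime⇒nonZero pr}}
        -- The residue of p^(e-1), a generator of `J 1`.
        t : Fin (suc k)
        t = K.residue q
        toℕ-t : toℕ t ≡ q
        toℕ-t = trans (K.toℕ-residue q) (m<n⇒m%n≡m (subst (q <_) (trans (*-comm q p) p*q) (m<m*n q p (nonTrivial⇒n>1 p {{prime⇒nonTrivial pr}}))))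
          where open import Data.Nat.DivMod using (m<n⇒m%n≡m)
        t≢0 : t ≢ K.0ᶠ
        t≢0 t≡0 = ℕ.≢-nonZero⁻¹ q (trans (sym toℕ-t) (cong toℕ t≡0))
        Jt : J 1 t
        Jt = torsion-by (trans (cong (_⋆ t) (*-identityʳ p)) (toℕ-injective (trans (K.toℕ-⋆ p t)
          (trans (cong (λ a → (p ℕ.* a) % suc k) toℕ-t) (trans (cong (_% suc k) p*q) (n%n≡0 (suc k)))))))
          where
          open import Data.Nat.DivMod using (_%_; n%n≡0)
          open import Data.Nat.Properties using (*-identityʳ)
        h : Fin (suc N)
        h = glue (t , false)
        in-S₀ : ∀ {x} → x ∈ S → InH₀ x → Sᶜ false (proj₁ (split x)) ≡ true
        in-S₀ {x} x∈S x-even = ∈⇒mem (subst (_∈ S) (trans (sym (glue-split x)) (cong (λ τ → glue (proj₁ (split x) , τ)) (∣-odd? x-even))) x∈S)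
        from-S₀ : ∀ {x c} → split x ≡ (c , false) → Sᶜ false c ≡ true → InSH₀ S x
        from-S₀ {x} {c} e Sc = subst (_∈ S) (trans (cong glue (sym e)) (glue-split x)) (mem⇒∈ Sc) , odd?-∣ _ (cong proj₂ e)
        split-even : ∀ {x} → InH₀ x → split x ≡ (proj₁ (split x) , false)
        split-even {x} x-even = cong (proj₁ (split x) ,_) (∣-odd? x-even)
        forth : ∀ y → (Σ (Fin (suc N)) λ s → InSH₀ S s × (y ≡ s ⊕ h)) → InSH₀ S y
        forth y (s , (s∈S , s-even) , refl) = from-S₀ (trans (split-⊕ s h) (cong₂ (λ z w → proj₁ z ⊕ proj₁ w , proj₂ z xor proj₂ w) (split-even s-even) (split-glue (t , false))))
          (period (in-S₀ s∈S s-even) Jt)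
        back : ∀ y → InSH₀ S y → Σ (Fin (suc N)) λ s → InSH₀ S s × (y ≡ s ⊕ h)
        back y (y∈S , y-even) = s , from-S₀ (split-glue _) (period (in-S₀ y∈S y-even) (J-neg Jt))
          , split-injective (sym (trans (split-⊕ s h) (trans (cong₂ (λ z w → proj₁ z ⊕ proj₁ w , proj₂ z xor proj₂ w) (split-glue _) (split-glue (t , false)))
              (trans (cong (_, false) (solve 2 (λ y t → (y :- t) :+ t ⊜ y) refl (proj₁ (split y)) t)) (sym (split-even y-even))))))
          where
          s : Fin (suc N)
          s = glue (proj₁ (split y) ⊕ K.neg t , false)

      twist⇒cond2 : R.Twist → Cond2 (suc N) S ι
      twist⇒cond2 T = record
        { to = α γ ; from = α γ⁻¹
        ; from-to = inverse-of γ γ⁻¹ γ-layer γ⁻¹-γ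
        ; to-from = inverse-of γ⁻¹ γ γ⁻¹-layer γ-γ⁻¹
        ; pres = λ x y e → mem⇒Eι (trans (sym (carried x y)) (E⇒mem e))
        ; refl' = λ x y e → mem⇒E (trans (carried x y) (Eι⇒mem e)) }
        where
        open R.Twist T
        open ≡-Reasoning
        γ⁻¹-layer : ∀ z → layer (γ⁻¹ z) ≡ layer z
        γ⁻¹-layer z = trans (sym (γ-layer (γ⁻¹ z))) (cong layer (γ-γ⁻¹ z))
        α : (G → G) → Fin (suc N) → Fin (suc N)
        α γ x = proj₁ (Ψ⁻¹ (γ (Ψ (x , false))))
        Ψ-α : ∀ γ → (∀ z → layer (γ z) ≡ layer z) → ∀ x → Ψ (α γ x , false) ≡ γ (Ψ (x , false))
        Ψ-α γ γ-layer x = trans (cong (λ ℓ → Ψ (α γ x , ℓ)) (sym (γ-layer (Ψ (x , false))))) (Ψ-Ψ⁻¹ (γ (Ψ (x , false))))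
        inverse-of : ∀ γ γ⁻¹ → (∀ z → layer (γ z) ≡ layer z) → (∀ z → γ⁻¹ (γ z) ≡ z) → ∀ x → α γ⁻¹ (α γ x) ≡ x
        inverse-of γ γ⁻¹ γ-layer inverse x = cong proj₁ (trans (cong (λ z → Ψ⁻¹ (γ⁻¹ z)) (Ψ-α γ γ-layer x)) (trans (cong Ψ⁻¹ (inverse _)) (Ψ⁻¹-Ψ (x , false))))
        u⊹b : R.u ⊹ R.b ≡ join ι true
        u⊹b = triple (trans (solve 0 (:0 :+ :0 ⊜ :0) refl) (sym (cong proj₁ split-ι))) (sym (cong proj₂ split-ι)) refl
        carried : ∀ x y → mem (y ⊝ x) ≡ mem ((α γ y ⊝ α γ x) ⊕ ι)
        carried x y = begin
          mem (y ⊝ x) ≡⟨ adj-join (y ⊝ x) ⟨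
          adj (join (y ⊝ x) true) ≡⟨ cong adj (trans (sym (Ψ-up (y ⊝ x) false)) (cong (_⊹ up) (join-⊝ y x false false))) ⟩
          adj ((Ψ (y , false) ⊟ Ψ (x , false)) ⊹ R.u) ≡⟨ γ-adj (Ψ (x , false)) (Ψ (y , false)) refl ⟩
          adj ((γ (Ψ (y , false)) ⊟ γ (Ψ (x , false))) ⊹ (R.u ⊹ R.b)) ≡⟨ cong adj (cong₂ (λ d w → d ⊹ w) (trans (cong₂ _⊟_ (sym (Ψ-α γ γ-layer y)) (sym (Ψ-α γ γ-layer x))) (sym (join-⊝ (α γ y) (α γ x) false false))) u⊹b) ⟩
          adj (join (α γ y ⊝ α γ x) false ⊹ join ι true) ≡⟨ cong adj (join-⊕ (α γ y ⊝ α γ x) ι false true) ⟨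
          adj (join ((α γ y ⊝ α γ x) ⊕ ι) true) ≡⟨ adj-join ((α γ y ⊝ α γ x) ⊕ ι) ⟩
          mem ((α γ y ⊝ α γ x) ⊕ ι) ∎

      unstable⇒ : Unstable Γ → Cond1 (suc N) e S ⊎ Cond2 (suc N) S ι
      unstable⇒ unstable = decide (∃? λ s → ∃? λ t → (Sᶜ false s Boolₚ.≟ true) ×-dec R.J? 1 t ×-dec ¬? (Sᶜ false (s ⊕ t) Boolₚ.≟ true))
          (λ (s , t , Ss , Jt , ¬Sst) → inj₂ (twist⇒cond2 (aperiodic Ss Jt ¬Sst)))
          (λ ∄ → inj₁ (period⇒cond1 λ {s} {t} Ss Jt → decidable-stable (Sᶜ false (s ⊕ t) Boolₚ.≟ true) λ ¬Sst → ∄ (s , t , Ss , Jt , ¬Sst)))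
        where
        open import Relation.Nullary.Decidable using (_×-dec_; ¬?; decidable-stable)
        aperiodic : ∀ {s t} → Sᶜ false s ≡ true → J 1 t → Sᶜ false (s ⊕ t) ≢ true → R.Twist
        aperiodic Ss Jt ¬Sst = decide (up ≈? (K.0ᶠ , true , true)) (R.Central.twisting central) λ ¬u≈v → ⊥-elim (unstable (stable-if (fixed ¬u≈v)))
          where
          central : ∀ {o} → up ≈ o → part o ≡ K.0ᶠ
          central = R.Aperiodic.O-central Ss Jt ¬Sst
          fixed : ¬ (up ≈ (K.0ᶠ , true , true)) → ∀ {w} → up ≈ w → w ≡ up
          fixed ¬u≈v {w} r = triple (central r) (untwisted (twist w) refl) (R.O-layer r)
            where
            untwisted : ∀ τ → twist w ≡ τ → twist w ≡ false
            untwisted false e = e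
            untwisted true e = ⊥-elim (¬u≈v (subst (up ≈_) (triple (central r) e (R.O-layer r)) r))

open import Data.Nat using (ℕ; _*_; _^_; _≥_)

theorem1p5 : (p e : ℕ) → Prime p → 2 ∤ p → e ≥ 1 →
    (S : Subset (2 * p ^ e)) → IdNotIn S → InverseClosed S →
    (b : Fin (2 * p ^ e)) → Involution b →
    Connected (Cay (2 * p ^ e) ⟦ S ⟧) → NonBipartite (Cay (2 * p ^ e) ⟦ S ⟧) →
    Unstable (Cay (2 * p ^ e) ⟦ S ⟧) ⇔ (Cond1 (2 * p ^ e) e S ⊎ Cond2 (2 * p ^ e) S b)
theorem1p5 p e pr 2∤p e≥1 = at (2 * p ^ e) (p ^ e) refl refl
  where
  -- The orders 2 p^e and p^e become variables so that matching exposes them as successors, the form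
  -- in which `_⊕_` computes.
  at : ∀ n m → p ^ e ≡ m → n ≡ 2 * m → (S : Subset n) → IdNotIn S → InverseClosed S →
    (b : Fin n) → Involution b → Connected (Cay n ⟦ S ⟧) → NonBipartite (Cay n ⟦ S ⟧) →
    Unstable (Cay n ⟦ S ⟧) ⇔ (Cond1 n e S ⊎ Cond2 n S b)
  at zero _ _ _ _ _ _ ()
  at (suc N) zero _ ()
  at (suc N) (suc k) m≡ N≡ S id∉S _ b involution connected nonBipartite = mk⇔
    (Unstability.unstable⇒ id∉S connected nonBipartite)
    λ { (inj₁ cond1) → cond1⇒unstable cond1 ; (inj₂ cond2) → cond2⇒unstable cond2 }
    where
    open Circulant pr (PrimePowers.2∤⇒odd 2∤p) e≥1 m≡ N≡ S
    open WithInvolution b involution
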